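{- Let $n\geqslant 4$. Every Cameron–Liebler line class in $PG(n,4)$ is one of the following line sets or the complement (in the set of all lines of $PG(n,4)$) of one of them: the set of all lines of $PG(n,4)$; the set of all lines contained in a hyperplane $H$; the set ${\rm Star}(P)$ of all lines through a point $P$; the set of all lines that pass through $P$ or are contained in $H$, for a point $P$ and a hyperplane $H$ with $P\notin H$.
   Context: Let $q$ be a prime power and $n\geqslant 3$. A set $\mathcal L$ of lines of $PG(n,q)$ is a Cameron–Liebler line class if there exists an integer $x$ such that for every line $l$, $$|\{m\in\mathcal L\setminus\{l\}: m \text{ meets } l\}| = (q+1)x+(q^{n-1}+q^{n-2}+\dots+q^2-1)\chi_{\mathcal L}(l),$$ where $\chi_{\mathcal L}$ is the characteristic function of $\mathcal L$. -}

module Defs where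

open import Data.Bool using (Bool; true; false; T; not; _∧_; _∨_; if_then_else_)
open import Data.Unit using (tt)
open import Data.Nat using (ℕ; zero; suc; _^_; _<ᵇ_; _≡ᵇ_)
open import Data.Integer as ℤ using (ℤ; +_)
open import Data.List using (List; []; _∷_; map; concatMap; cartesianProduct; filterᵇ; length; drop; upTo)
open import Data.Bool.ListAction using (any)
open import Data.Nat.ListAction using (sum)
open import Data.Vec using (Vec; []; _∷_; zipWith)
open import Data.Product using (Σ; ∃; ∃-syntax; _×_; _,_; proj₁; proj₂)
open import Data.Sum using (_⊎_)
open import Relation.Binary.PropositionalEquality using (_≡_; subst; sym)

-- The field GF(4) = {0, 1, ω, ω² = ω + 1}

data GF4 : Set where
  o i w w² : GF4

elems : List GF4
elems = o ∷ i ∷ w ∷ w² ∷ []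

_⊕_ : GF4 → GF4 → GF4
o  ⊕ y  = y
x  ⊕ o  = x
i  ⊕ i  = o
i  ⊕ w  = w²
i  ⊕ w² = w
w  ⊕ i  = w²
w  ⊕ w  = o
w  ⊕ w² = i
w² ⊕ i  = w
w² ⊕ w  = i
w² ⊕ w² = o

_⊗_ : GF4 → GF4 → GF4
o  ⊗ y  = o
x  ⊗ o  = o
i  ⊗ y  = y
x  ⊗ i  = x
w  ⊗ w  = w²
w  ⊗ w² = i
w² ⊗ w  = i
w² ⊗ w² = w

_==_ : GF4 → GF4 → Bool
o  == o  = true
i  == i  = true
w  == w  = true
w² == w² = true
_  == _  = false

isZero : GF4 → Bool
isZero x = x == o

Vecs : ℕ → Set
Vecs k = Vec GF4 k

_=ᵥ_ : ∀ {k} → Vecs k → Vecs k → Bool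
[] =ᵥ [] = true
(x ∷ xs) =ᵥ (y ∷ ys) = (x == y) ∧ (xs =ᵥ ys)

_+ᵥ_ : ∀ {k} → Vecs k → Vecs k → Vecs k
_+ᵥ_ = zipWith _⊕_

_·ᵥ_ : ∀ {k} → GF4 → Vecs k → Vecs k
a ·ᵥ [] = []
a ·ᵥ (x ∷ xs) = (a ⊗ x) ∷ (a ·ᵥ xs)

dot : ∀ {k} → Vecs k → Vecs k → GF4
dot [] [] = o
dot (x ∷ xs) (y ∷ ys) = (x ⊗ y) ⊕ dot xs ys

allVecs : (k : ℕ) → List (Vecs k)
allVecs zero = [] ∷ []
allVecs (suc k) = concatMap (λ x → map (x ∷_) (allVecs k)) elems

normalized : ∀ {k} → Vecs k → Bool
normalized [] = false
normalized (x ∷ xs) = if isZero x then normalized xs else (x == i)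

-- index of the first nonzero coordinate (k if the vector is zero)
pivot : ∀ {k} → Vecs k → ℕ
pivot [] = zero
pivot (x ∷ xs) = if isZero x then suc (pivot xs) else zero

-- coordinate at a given index (0 if out of range)
entryAt : ∀ {k} → ℕ → Vecs k → GF4
entryAt _ [] = o
entryAt zero (x ∷ xs) = x
entryAt (suc j) (x ∷ xs) = entryAt j xs

scalarPairs : List (GF4 × GF4)
scalarPairs = cartesianProduct elems elems

nonzeroPairs : List (GF4 × GF4)
nonzeroPairs = filterᵇ (λ ab → not (isZero (proj₁ ab) ∧ isZero (proj₂ ab))) scalarPairs

comb : ∀ {k} → GF4 × GF4 → Vecs k → Vecs k → Vecs k
comb (a , b) u v = (a ·ᵥ u) +ᵥ (b ·ᵥ v)

keep : ∀ {A : Set} (f : A → Bool) → List A → List (Σ A (λ a → T (f a)))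
keep f [] = []
keep f (x ∷ xs) with f x in eq
... | true  = (x , subst T (sym eq) tt) ∷ keep f xs
... | false = keep f xs

-- The projective space PG(n,4), modelled on GF(4)^(n+1).

-- Points (and, dually, hyperplanes) are normalized nonzero vectors.
Point : ℕ → Set
Point n = Σ (Vecs (suc n)) (λ p → T (normalized p))

-- A hyperplane H is given by a normalized nonzero linear form h: H = {x | h·x = 0}.
Hyperplane : ℕ → Set
Hyperplane n = Σ (Vecs (suc n)) (λ h → T (normalized h))

-- Lines are 2-dimensional subspaces, represented canonically by the
-- 2-row reduced row echelon form basis (u , v).
isRREF : ∀ {k} → Vecs k × Vecs k → Bool
isRREF (u , v) = normalized u ∧ normalized v ∧ (pivot u <ᵇ pivot v)
                 ∧ isZero (entryAt (pivot v) u)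

Line : ℕ → Set
Line n = Σ (Vecs (suc n) × Vecs (suc n)) (λ p → T (isRREF p))

allLines : (n : ℕ) → List (Line n)
allLines n = keep isRREF (cartesianProduct (allVecs (suc n)) (allVecs (suc n)))

sameLine : ∀ {n} → Line n → Line n → Bool
sameLine ((u , v) , _) ((u' , v') , _) = (u =ᵥ u') ∧ (v =ᵥ v')

meets : ∀ {n} → Line n → Line n → Bool
meets ((u , v) , _) ((u' , v') , _) =
  any (λ ab → any (λ cd → comb ab u v =ᵥ comb cd u' v') scalarPairs) nonzeroPairs

onLine : ∀ {n} → Point n → Line n → Bool
onLine (p , _) ((u , v) , _) = any (λ ab → comb ab u v =ᵥ p) scalarPairs

inHyp : ∀ {n} → Point n → Hyperplane n → Bool
inHyp (p , _) (h , _) = isZero (dot h p)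

lineInHyp : ∀ {n} → Line n → Hyperplane n → Bool
lineInHyp ((u , v) , _) (h , _) = isZero (dot h u) ∧ isZero (dot h v)

LineSet : ℕ → Set
LineSet n = Line n → Bool

χ : ∀ {n} → LineSet n → Line n → ℕ
χ L l = if L l then 1 else 0

meetCount : ∀ {n} → LineSet n → Line n → ℕ
meetCount {n} L l =
  length (filterᵇ (λ m → L m ∧ not (sameLine m l) ∧ meets m l) (allLines n))

q : ℕ
q = 4

geomPart : ℕ → ℕ
geomPart n = sum (map (q ^_) (drop 2 (upTo n)))

IsCameronLiebler : (n : ℕ) → LineSet n → Set
IsCameronLiebler n L =
  ∃[ x ] ∀ (l : Line n) →
    + meetCount L l ≡ (+ (suc q)) ℤ.* x ℤ.+ ((+ geomPart n) ℤ.- + 1) ℤ.* (+ χ L l)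

allLineSet : ∀ {n} → LineSet n
allLineSet _ = true

linesIn : ∀ {n} → Hyperplane n → LineSet n
linesIn H l = lineInHyp l H

Star : ∀ {n} → Point n → LineSet n
Star P l = onLine P l

starOrIn : ∀ {n} → Point n → Hyperplane n → LineSet n
starOrIn P H l = onLine P l ∨ lineInHyp l H

complement : ∀ {n} → LineSet n → LineSet n
complement S l = not (S l)

_≐_ : ∀ {n} → LineSet n → LineSet n → Set
L ≐ S = ∀ l → L l ≡ S l

IsExample : (n : ℕ) → LineSet n → Set
IsExample n S =
    (S ≐ allLineSet)
  ⊎ (∃[ H ] (S ≐ linesIn H))
  ⊎ (∃[ P ] (S ≐ Star P))
  ⊎ (∃[ P ] ∃[ H ] (T (not (inHyp P H)) × (S ≐ starOrIn P H)))

{-# OPTIONS --safe #-}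
-- The number of lines of the class through a point, suitably rescaled, is an integral function f
-- on points whose sum over a line l is s + 4χ(l).  Then the sums over planes, solids and
-- 4-spaces have parameters k, y, z, given linearly by counting lines, planes and solids on a
-- pencil, and χ² = χ summed over all lines of a subspace gives the sum of the weights
-- f(f − 1) as a quadratic polynomial in the parameter.  Integrality for solids forces s ≡ 0, 1
-- (mod 5), so s ∈ {0, 1} after subtracting a constant from f, and then y(16 − y) ≡ 0 (mod 5) and
-- z(64 − z) ≡ 0 (mod 7).  If f(P) = −1, the lines of the class through P form a cap in the
-- quotient PG(3,4), and the two congruences leave a cap with at most one point or a parameter z
-- that is excluded by passing to the complement f ↦ 1 − f.  In the former case some solid on P
-- contains no line of the class through P, which a count modulo 9 refutes.  So f omits −1 and 2,
-- hence also −2 and 3, and takes values in {0, 1} except for at most one point of value 4 or −3,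
-- whose removal leaves a hyperplane or a constant.
module Submission where

open import Defs
open import Data.Bool using (Bool; true; false; T; not; _∧_; _∨_; if_then_else_)
open import Data.Bool.ListAction using (any)
open import Data.Empty using (⊥; ⊥-elim)
open import Data.Integer as ℤ using (ℤ; +_; -[1+_]; 0ℤ; 1ℤ; -1ℤ; _+_; _*_; _-_; -_; +≤+)
  renaming (_≤_ to _≤ℤ_)
open import Data.Integer.DivMod using (_/_; _%_; n%d<d; a≡a%n+[a/n]*n)
import Data.Integer.Properties as ℤₚ
open import Data.Integer.Tactic.RingSolver using (solve-∀)
open import Data.List using (List; []; _∷_; _++_; cartesianProduct; filterᵇ; length; applyUpTo)
open import Data.List.Membership.Propositional using (_∈_; find; lose)
open import Data.List.Membership.Propositional.Properties using (∈-cartesianProduct⁺; ∈-filter⁺; ∈-filter⁻)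
open import Data.List.Relation.Unary.Any using (here; there)
open import Data.List.Relation.Unary.Any.Properties using (any⁺; any⁻)
open import Data.Nat as ℕ using (ℕ; zero; suc; z≤n; s≤s; _≤_)
open import Data.Nat.Divisibility using (divides; _∣?_)
import Data.Nat.ListAction as ℕᴸ
import Data.Nat.Properties as ℕₚ
open import Data.Product using (Σ; ∃-syntax; _×_; _,_; proj₁; proj₂)
open import Data.Sum using (_⊎_; inj₁; inj₂)
open import Data.Unit using (⊤; tt)
open import Data.Vec using (Vec; []; _∷_; replicate; map)
open import Relation.Nullary using (¬_; Dec; yes; no; contradiction; T?)
open import Relation.Nullary.Decidable using (False; toWitnessFalse)
open import Relation.Binary.PropositionalEquality
  using (_≡_; _≢_; refl; sym; trans; cong; cong₂; subst; subst₂; module ≡-Reasoning)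

-- The field GF(4)

-- Sums run over the vectors of a subspace instead of its points. With f extended to the zero vector
-- by f 0 = s, every double count becomes either the pencil identity `Sp-pencil` or a change of
-- variables in a sum over GF(4)^d, and no lists of points, planes or solids are needed. The weight
-- f(f - 1) is the right measure because it is nonnegative at integers and vanishes only at 0 and 1,
-- the values that f takes for a hyperplane: a total weight that is too small, or in a wrong residue
-- class, excludes values. The integral f arises from the degrees: with x subtracted, the degrees of
-- the points of a line l sum to 4Mχ(l) for M = 1 + 4 + ... + 4^(n-2), and comparing two points of
-- one plane shows that all degrees are congruent modulo M. Rank 5 enters twice: a solid on P can
-- avoid a given line through P only inside a larger space, and the congruence modulo 7 belongs to
-- 4-spaces.

every : (GF4 → Bool) → Bool
every p = p o ∧ (p i ∧ (p w ∧ p w²))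

∧-T : ∀ {a b} → T (a ∧ b) → T a × T b
∧-T {true} t = tt , t

T-∧ : ∀ {a b} → T a → T b → T (a ∧ b)
T-∧ {true} _ t = t

every-sound : ∀ p → T (every p) → ∀ x → T (p x)
every-sound p t o = proj₁ (∧-T {p o} t)
every-sound p t i = proj₁ (∧-T {p i} (proj₂ (∧-T {p o} t)))
every-sound p t w = proj₁ (∧-T {p w} (proj₂ (∧-T {p i} (proj₂ (∧-T {p o} t)))))
every-sound p t w² = proj₂ (∧-T {p w} (proj₂ (∧-T {p i} (proj₂ (∧-T {p o} t)))))

==-sound : ∀ x y → T (x == y) → x ≡ y
==-sound o o _ = refl
==-sound i i _ = refl
==-sound w w _ = refl
==-sound w² w² _ = refl

==-refl : ∀ x → (x == x) ≡ true
==-refl o = refl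
==-refl i = refl
==-refl w = refl
==-refl w² = refl

_≟₄_ : ∀ (x y : GF4) → x ≡ y ⊎ x ≢ y
x ≟₄ y with x == y in e
... | true = inj₁ (==-sound x y (subst T (sym e) tt))
... | false = inj₂ λ { refl → contradiction (trans (sym e) (==-refl x)) λ () }

-- Field laws are settled by running through all elements: for a closed law the hypothesis evaluates
-- to the unit type and is proved by `tt`.
identity₁ : (f g : GF4 → GF4) → T (every λ a → f a == g a) → ∀ a → f a ≡ g a
identity₁ f g t a = ==-sound _ _ (every-sound (λ a → f a == g a) t a)

identity₂ : (f g : GF4 → GF4 → GF4) → T (every λ a → every λ b → f a b == g a b) →
            ∀ a b → f a b ≡ g a b
identity₂ f g t a = identity₁ (f a) (g a) (every-sound (λ a → every λ b → f a b == g a b) t a)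

identity₃ : (f g : GF4 → GF4 → GF4 → GF4) →
            T (every λ a → every λ b → every λ c → f a b c == g a b c) →
            ∀ a b c → f a b c ≡ g a b c
identity₃ f g t a = identity₂ (f a) (g a)
  (every-sound (λ a → every λ b → every λ c → f a b c == g a b c) t a)

identity₄ : (f g : GF4 → GF4 → GF4 → GF4 → GF4) →
            T (every λ a → every λ b → every λ c → every λ d → f a b c d == g a b c d) →
            ∀ a b c d → f a b c d ≡ g a b c d
identity₄ f g t a = identity₃ (f a) (g a)
  (every-sound (λ a → every λ b → every λ c → every λ d → f a b c d == g a b c d) t a)

⊕-comm : ∀ a b → a ⊕ b ≡ b ⊕ a
⊕-comm = identity₂ _ _ tt

⊕-assoc : ∀ a b c → (a ⊕ b) ⊕ c ≡ a ⊕ (b ⊕ c)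
⊕-assoc = identity₃ _ _ tt

⊕-self : ∀ a → a ⊕ a ≡ o
⊕-self = identity₁ _ _ tt

⊕-identityʳ : ∀ a → a ⊕ o ≡ a
⊕-identityʳ = identity₁ _ _ tt

⊗-comm : ∀ a b → a ⊗ b ≡ b ⊗ a
⊗-comm = identity₂ _ _ tt

⊗-assoc : ∀ a b c → (a ⊗ b) ⊗ c ≡ a ⊗ (b ⊗ c)
⊗-assoc = identity₃ _ _ tt

⊗-zeroʳ : ∀ a → a ⊗ o ≡ o
⊗-zeroʳ = identity₁ _ _ tt

⊗-identityˡ : ∀ a → i ⊗ a ≡ a
⊗-identityˡ = identity₁ _ _ tt

⊗-distribˡ : ∀ a b c → a ⊗ (b ⊕ c) ≡ (a ⊗ b) ⊕ (a ⊗ c)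
⊗-distribˡ = identity₃ _ _ tt

⊗-distribʳ : ∀ a b c → (a ⊕ b) ⊗ c ≡ (a ⊗ c) ⊕ (b ⊗ c)
⊗-distribʳ = identity₃ _ _ tt

_⁻¹ : GF4 → GF4
o ⁻¹ = o
i ⁻¹ = i
w ⁻¹ = w²
w² ⁻¹ = w

⁻¹-inverseˡ : ∀ a → a ≢ o → (a ⁻¹) ⊗ a ≡ i
⁻¹-inverseˡ o a≢o = ⊥-elim (a≢o refl)
⁻¹-inverseˡ i _ = refl
⁻¹-inverseˡ w _ = refl
⁻¹-inverseˡ w² _ = refl

⁻¹-nonzero : ∀ a → a ≢ o → (a ⁻¹) ≢ o
⁻¹-nonzero o a≢o _ = a≢o refl

0ᵥ : ∀ {k} → Vecs k
0ᵥ = replicate _ o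

=ᵥ-refl : ∀ {k} (x : Vecs k) → (x =ᵥ x) ≡ true
=ᵥ-refl [] = refl
=ᵥ-refl (a ∷ x) rewrite ==-refl a = =ᵥ-refl x

=ᵥ-sound : ∀ {k} (x y : Vecs k) → T (x =ᵥ y) → x ≡ y
=ᵥ-sound [] [] _ = refl
=ᵥ-sound (a ∷ x) (b ∷ y) t =
  cong₂ _∷_ (==-sound a b (proj₁ (∧-T {a == b} t))) (=ᵥ-sound x y (proj₂ (∧-T {a == b} t)))

_≟ᵥ_ : ∀ {k} (x y : Vecs k) → x ≡ y ⊎ x ≢ y
x ≟ᵥ y with x =ᵥ y in e
... | true = inj₁ (=ᵥ-sound x y (subst T (sym e) tt))
... | false = inj₂ λ { refl → subst T (trans (sym (=ᵥ-refl x)) e) tt }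

≢⇒=ᵥ-false : ∀ {k} {x y : Vecs k} → x ≢ y → (x =ᵥ y) ≡ false
≢⇒=ᵥ-false {x = x} {y} x≢y with x =ᵥ y in e
... | true = ⊥-elim (x≢y (=ᵥ-sound x y (subst T (sym e) tt)))
... | false = refl

+ᵥ-comm : ∀ {k} (x y : Vecs k) → x +ᵥ y ≡ y +ᵥ x
+ᵥ-comm [] [] = refl
+ᵥ-comm (a ∷ x) (b ∷ y) = cong₂ _∷_ (⊕-comm a b) (+ᵥ-comm x y)

+ᵥ-assoc : ∀ {k} (x y z : Vecs k) → (x +ᵥ y) +ᵥ z ≡ x +ᵥ (y +ᵥ z)
+ᵥ-assoc [] [] [] = refl
+ᵥ-assoc (a ∷ x) (b ∷ y) (c ∷ z) = cong₂ _∷_ (⊕-assoc a b c) (+ᵥ-assoc x y z)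

+ᵥ-identityˡ : ∀ {k} (x : Vecs k) → 0ᵥ +ᵥ x ≡ x
+ᵥ-identityˡ [] = refl
+ᵥ-identityˡ (a ∷ x) = cong (a ∷_) (+ᵥ-identityˡ x)

+ᵥ-identityʳ : ∀ {k} (x : Vecs k) → x +ᵥ 0ᵥ ≡ x
+ᵥ-identityʳ x = trans (+ᵥ-comm x 0ᵥ) (+ᵥ-identityˡ x)

+ᵥ-self : ∀ {k} (x : Vecs k) → x +ᵥ x ≡ 0ᵥ
+ᵥ-self [] = refl
+ᵥ-self (a ∷ x) = cong₂ _∷_ (⊕-self a) (+ᵥ-self x)

·ᵥ-zeroˡ : ∀ {k} (x : Vecs k) → o ·ᵥ x ≡ 0ᵥ
·ᵥ-zeroˡ [] = refl
·ᵥ-zeroˡ (a ∷ x) = cong (o ∷_) (·ᵥ-zeroˡ x)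

·ᵥ-zeroʳ : ∀ {k} c → c ·ᵥ 0ᵥ {k} ≡ 0ᵥ
·ᵥ-zeroʳ {zero} c = refl
·ᵥ-zeroʳ {suc k} c = cong₂ _∷_ (⊗-zeroʳ c) (·ᵥ-zeroʳ c)

·ᵥ-identity : ∀ {k} (x : Vecs k) → i ·ᵥ x ≡ x
·ᵥ-identity [] = refl
·ᵥ-identity (a ∷ x) = cong₂ _∷_ (⊗-identityˡ a) (·ᵥ-identity x)

·ᵥ-assoc : ∀ {k} a b (x : Vecs k) → (a ⊗ b) ·ᵥ x ≡ a ·ᵥ (b ·ᵥ x)
·ᵥ-assoc a b [] = refl
·ᵥ-assoc a b (c ∷ x) = cong₂ _∷_ (⊗-assoc a b c) (·ᵥ-assoc a b x)

·ᵥ-distribˡ : ∀ {k} a (x y : Vecs k) → a ·ᵥ (x +ᵥ y) ≡ (a ·ᵥ x) +ᵥ (a ·ᵥ y)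
·ᵥ-distribˡ a [] [] = refl
·ᵥ-distribˡ a (b ∷ x) (c ∷ y) = cong₂ _∷_ (⊗-distribˡ a b c) (·ᵥ-distribˡ a x y)

·ᵥ-distribʳ : ∀ {k} a b (x : Vecs k) → (a ⊕ b) ·ᵥ x ≡ (a ·ᵥ x) +ᵥ (b ·ᵥ x)
·ᵥ-distribʳ a b [] = refl
·ᵥ-distribʳ a b (c ∷ x) = cong₂ _∷_ (⊗-distribʳ a b c) (·ᵥ-distribʳ a b x)

-- x + y = z is solved by x = y + z, as the characteristic is 2.
+ᵥ-solve : ∀ {k} {x y z : Vecs k} → x +ᵥ y ≡ z → x ≡ y +ᵥ z
+ᵥ-solve {x = x} {y} refl =
  sym (trans (cong (y +ᵥ_) (+ᵥ-comm x y))
      (trans (sym (+ᵥ-assoc y y x)) (trans (cong (_+ᵥ x) (+ᵥ-self y)) (+ᵥ-identityˡ x))))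

·ᵥ-cancel : ∀ {k} c → c ≢ o → (x : Vecs k) → (c ⁻¹) ·ᵥ (c ·ᵥ x) ≡ x
·ᵥ-cancel c c≢o x = trans (sym (·ᵥ-assoc (c ⁻¹) c x))
  (trans (cong (_·ᵥ x) (⁻¹-inverseˡ c c≢o)) (·ᵥ-identity x))

-- Sums over GF(4) and over vectors

+-congʳ : ∀ x {y z} → y ≡ z → x + y ≡ x + z
+-congʳ x = cong (λ y → x + y)

Σ₄ : (GF4 → ℤ) → ℤ
Σ₄ f = f o + (f i + (f w + f w²))

Σ₄-cong : ∀ {f g : GF4 → ℤ} → (∀ a → f a ≡ g a) → Σ₄ f ≡ Σ₄ g
Σ₄-cong e = cong₂ _+_ (e o) (cong₂ _+_ (e i) (cong₂ _+_ (e w) (e w²)))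

private
  shuffle-i : ∀ a b c d → b + (a + (d + c)) ≡ a + (b + (c + d))
  shuffle-i = solve-∀
  shuffle-w : ∀ a b c d → c + (d + (a + b)) ≡ a + (b + (c + d))
  shuffle-w = solve-∀
  shuffle-w² : ∀ a b c d → d + (c + (b + a)) ≡ a + (b + (c + d))
  shuffle-w² = solve-∀
  rotate-w : ∀ a b c d → a + (c + (d + b)) ≡ a + (b + (c + d))
  rotate-w = solve-∀
  rotate-w² : ∀ a b c d → a + (d + (b + c)) ≡ a + (b + (c + d))
  rotate-w² = solve-∀
  interchange₄ : ∀ a b c d a' b' c' d' → (a + a') + ((b + b') + ((c + c') + (d + d')))
               ≡ (a + (b + (c + d))) + (a' + (b' + (c' + d')))
  interchange₄ = solve-∀
  factor₄ : ∀ x a b c d → x * a + (x * b + (x * c + x * d)) ≡ x * (a + (b + (c + d)))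
  factor₄ = solve-∀
  four-times : ∀ a → a + (a + (a + a)) ≡ + 4 * a
  four-times = solve-∀

Σ₄-translate : ∀ f t → Σ₄ (λ a → f (a ⊕ t)) ≡ Σ₄ f
Σ₄-translate f o = refl
Σ₄-translate f i = shuffle-i (f o) (f i) (f w) (f w²)
Σ₄-translate f w = shuffle-w (f o) (f i) (f w) (f w²)
Σ₄-translate f w² = shuffle-w² (f o) (f i) (f w) (f w²)

Σ₄-scale : ∀ f c → c ≢ o → Σ₄ (λ a → f (c ⊗ a)) ≡ Σ₄ f
Σ₄-scale f o c≢o = ⊥-elim (c≢o refl)
Σ₄-scale f i _ = refl
Σ₄-scale f w _ = rotate-w (f o) (f i) (f w) (f w²)
Σ₄-scale f w² _ = rotate-w² (f o) (f i) (f w) (f w²)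

Σ₄-+ : ∀ f g → Σ₄ (λ a → f a + g a) ≡ Σ₄ f + Σ₄ g
Σ₄-+ f g = interchange₄ (f o) (f i) (f w) (f w²) (g o) (g i) (g w) (g w²)

Σ₄-* : ∀ c f → Σ₄ (λ a → c * f a) ≡ c * Σ₄ f
Σ₄-* c f = factor₄ c (f o) (f i) (f w) (f w²)

Σ₄-const : ∀ c → Σ₄ (λ _ → c) ≡ + 4 * c
Σ₄-const = four-times

Σ₄-mono : ∀ {f g : GF4 → ℤ} → (∀ a → f a ≤ℤ g a) → Σ₄ f ≤ℤ Σ₄ g
Σ₄-mono h = ℤₚ.+-mono-≤ (h o) (ℤₚ.+-mono-≤ (h i) (ℤₚ.+-mono-≤ (h w) (h w²)))

pow4 : ℕ → ℤ
pow4 zero = 1ℤ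
pow4 (suc d) = + 4 * pow4 d

opaque
  -- Opaque because the dimensions 2 to 5 occur as literals, where unfolding would expose up to 4^5
  -- summands. Only the blocks that need the recursion unfold it.
  Σᵥ : ∀ d → (Vecs d → ℤ) → ℤ
  Σᵥ zero f = f []
  Σᵥ (suc d) f = Σ₄ λ a → Σᵥ d λ x → f (a ∷ x)

  Σᵥ-cong : ∀ d {f g : Vecs d → ℤ} → (∀ x → f x ≡ g x) → Σᵥ d f ≡ Σᵥ d g
  Σᵥ-cong zero e = e []
  Σᵥ-cong (suc d) e = Σ₄-cong λ a → Σᵥ-cong d λ x → e (a ∷ x)

  Σᵥ-+ : ∀ d (f g : Vecs d → ℤ) → Σᵥ d (λ x → f x + g x) ≡ Σᵥ d f + Σᵥ d g
  Σᵥ-+ zero f g = refl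
  Σᵥ-+ (suc d) f g = trans (Σ₄-cong λ a → Σᵥ-+ d (λ x → f (a ∷ x)) (λ x → g (a ∷ x)))
    (Σ₄-+ (λ a → Σᵥ d λ x → f (a ∷ x)) (λ a → Σᵥ d λ x → g (a ∷ x)))

  Σᵥ-* : ∀ d c (f : Vecs d → ℤ) → Σᵥ d (λ x → c * f x) ≡ c * Σᵥ d f
  Σᵥ-* zero c f = refl
  Σᵥ-* (suc d) c f = trans (Σ₄-cong λ a → Σᵥ-* d c (λ x → f (a ∷ x)))
    (Σ₄-* c (λ a → Σᵥ d λ x → f (a ∷ x)))

  Σᵥ-*ʳ : ∀ d c (f : Vecs d → ℤ) → Σᵥ d (λ x → f x * c) ≡ Σᵥ d f * c
  Σᵥ-*ʳ d c f = trans (Σᵥ-cong d λ x → ℤₚ.*-comm (f x) c) (trans (Σᵥ-* d c f) (ℤₚ.*-comm c _))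

  Σᵥ-const : ∀ d c → Σᵥ d (λ _ → c) ≡ pow4 d * c
  Σᵥ-const zero c = sym (ℤₚ.*-identityˡ c)
  Σᵥ-const (suc d) c = trans (Σ₄-cong λ _ → Σᵥ-const d c)
    (trans (Σ₄-const (pow4 d * c)) (sym (ℤₚ.*-assoc (+ 4) (pow4 d) c)))

  Σᵥ-zero : ∀ d {f : Vecs d → ℤ} → (∀ x → f x ≡ 0ℤ) → Σᵥ d f ≡ 0ℤ
  Σᵥ-zero d e = trans (Σᵥ-cong d e) (trans (Σᵥ-const d 0ℤ) (ℤₚ.*-zeroʳ (pow4 d)))

  Σᵥ-mono : ∀ d {f g : Vecs d → ℤ} → (∀ x → f x ≤ℤ g x) → Σᵥ d f ≤ℤ Σᵥ d g
  Σᵥ-mono zero h = h []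
  Σᵥ-mono (suc d) h = Σ₄-mono λ a → Σᵥ-mono d λ x → h (a ∷ x)

  Σᵥ-Σ₄ : ∀ d (f : Vecs d → GF4 → ℤ) →
          Σᵥ d (λ x → Σ₄ (f x)) ≡ Σ₄ λ a → Σᵥ d λ x → f x a
  Σᵥ-Σ₄ d f =
    trans (Σᵥ-+ d (λ x → f x o) (λ x → f x i + (f x w + f x w²))) (+-congʳ (Σᵥ d λ x → f x o)
    (trans (Σᵥ-+ d (λ x → f x i) (λ x → f x w + f x w²)) (+-congʳ (Σᵥ d λ x → f x i)
    (Σᵥ-+ d (λ x → f x w) (λ x → f x w²)))))

  Σᵥ-swap : ∀ d e (f : Vecs d → Vecs e → ℤ) →
            Σᵥ d (λ x → Σᵥ e (f x)) ≡ Σᵥ e λ y → Σᵥ d λ x → f x y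
  Σᵥ-swap d zero f = refl
  Σᵥ-swap d (suc e) f = trans (Σᵥ-Σ₄ d λ x a → Σᵥ e λ y → f x (a ∷ y))
    (Σ₄-cong λ a → Σᵥ-swap d e λ x y → f x (a ∷ y))

  Σ₄-swap : ∀ (f : GF4 → GF4 → ℤ) → Σ₄ (λ a → Σ₄ (f a)) ≡ Σ₄ λ b → Σ₄ λ a → f a b
  -- Scalars are treated as vectors of length 1; once unfolded, the two kinds of sum agree.
  Σ₄-swap f = Σᵥ-swap 1 1 λ { (a ∷ []) (b ∷ []) → f a b }

  Σᵥ-translate : ∀ d (f : Vecs d → ℤ) t → Σᵥ d (λ x → f (x +ᵥ t)) ≡ Σᵥ d f
  Σᵥ-translate zero f [] = refl
  Σᵥ-translate (suc d) f (b ∷ t) =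
    trans (Σ₄-cong λ a → Σᵥ-translate d (λ x → f ((a ⊕ b) ∷ x)) t)
          (Σ₄-translate (λ a → Σᵥ d λ x → f (a ∷ x)) b)

  Σᵥ-scale : ∀ d (f : Vecs d → ℤ) c → c ≢ o → Σᵥ d (λ x → f (c ·ᵥ x)) ≡ Σᵥ d f
  Σᵥ-scale zero f c c≢o = refl
  Σᵥ-scale (suc d) f c c≢o =
    trans (Σ₄-cong λ a → Σᵥ-scale d (λ x → f ((c ⊗ a) ∷ x)) c c≢o)
          (Σ₄-scale (λ a → Σᵥ d λ x → f (a ∷ x)) c c≢o)

δ : ∀ {k} → Vecs k → Vecs k → ℤ
δ x y = if x =ᵥ y then 1ℤ else 0ℤ

δ-self : ∀ {k} (x : Vecs k) → δ x x ≡ 1ℤ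
δ-self x rewrite =ᵥ-refl x = refl

δ-distinct : ∀ {k} {x y : Vecs k} → x ≢ y → δ x y ≡ 0ℤ
δ-distinct x≢y rewrite ≢⇒=ᵥ-false x≢y = refl

Σ₄-single : ∀ (f : GF4 → ℤ) c → (∀ a → a ≢ c → f a ≡ 0ℤ) → Σ₄ f ≡ f c
Σ₄-single f o h rewrite h i (λ ()) | h w (λ ()) | h w² (λ ()) = ℤₚ.+-identityʳ _
Σ₄-single f i h rewrite h o (λ ()) | h w (λ ()) | h w² (λ ()) =
  trans (ℤₚ.+-identityˡ _) (ℤₚ.+-identityʳ _)
Σ₄-single f w h rewrite h i (λ ()) | h o (λ ()) | h w² (λ ()) =
  trans (ℤₚ.+-identityˡ _) (trans (ℤₚ.+-identityˡ _) (ℤₚ.+-identityʳ _))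
Σ₄-single f w² h rewrite h i (λ ()) | h w (λ ()) | h o (λ ()) =
  trans (ℤₚ.+-identityˡ _) (trans (ℤₚ.+-identityˡ _) (ℤₚ.+-identityˡ _))

opaque
  unfolding Σᵥ

  Σᵥ-single : ∀ d (f : Vecs d → ℤ) z → (∀ x → x ≢ z → f x ≡ 0ℤ) → Σᵥ d f ≡ f z
  Σᵥ-single zero f [] h = refl
  Σᵥ-single (suc d) f (c ∷ z) h =
    trans (Σ₄-single (λ a → Σᵥ d λ x → f (a ∷ x)) c
            λ a a≢c → Σᵥ-zero d λ x → h (a ∷ x) λ { refl → a≢c refl })
          (Σᵥ-single d (λ x → f (c ∷ x)) z λ x x≢z → h (c ∷ x) λ { refl → x≢z refl })

Σᵥ-δ : ∀ d (f : Vecs d → ℤ) z → Σᵥ d (λ x → δ z x * f x) ≡ f z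
Σᵥ-δ d f z = trans
  (Σᵥ-single d _ z λ x x≢z → trans (cong (_* f x) (δ-distinct (λ e → x≢z (sym e)))) (ℤₚ.*-zeroˡ (f x)))
  (trans (cong (_* f z) (δ-self z)) (ℤₚ.*-identityˡ (f z)))

-- Opaque, since with-abstractions would otherwise unfold the search for concrete d.
opaque
  search : ∀ d (p : Vecs d → Bool) → (∃[ x ] p x ≡ true) ⊎ (∀ x → p x ≡ false)
  search zero p with p [] in e
  ... | true = inj₁ ([] , e)
  ... | false = inj₂ λ { [] → e }
  search (suc d) p
    with search d (λ x → p (o ∷ x)) | search d (λ x → p (i ∷ x))
       | search d (λ x → p (w ∷ x)) | search d (λ x → p (w² ∷ x))
  ... | inj₁ (x , e) | _ | _ | _ = inj₁ (o ∷ x , e)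
  ... | inj₂ _ | inj₁ (x , e) | _ | _ = inj₁ (i ∷ x , e)
  ... | inj₂ _ | inj₂ _ | inj₁ (x , e) | _ = inj₁ (w ∷ x , e)
  ... | inj₂ _ | inj₂ _ | inj₂ _ | inj₁ (x , e) = inj₁ (w² ∷ x , e)
  ... | inj₂ ho | inj₂ hi | inj₂ hw | inj₂ hw² =
    inj₂ λ { (o ∷ x) → ho x ; (i ∷ x) → hi x ; (w ∷ x) → hw x ; (w² ∷ x) → hw² x }

-- Spans

lin : ∀ {j k} → Vec (Vecs k) j → Vecs j → Vecs k
lin [] [] = 0ᵥ
lin (u ∷ U) (a ∷ A) = (a ·ᵥ u) +ᵥ lin U A

-- A record, so that `U` can be inferred from a proof; the bare statement about `lin U` would not
-- determine it.
record Indep {j k} (U : Vec (Vecs k) j) : Set where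
  constructor indep
  field independent : ∀ A → lin U A ≡ 0ᵥ → A ≡ 0ᵥ
open Indep

-- The sum runs over coefficient vectors. It is the sum over the span if `U` is independent and
-- counts each vector of the span several times otherwise; the quadratic identity uses both cases.
Sp : ∀ {j k} → Vec (Vecs k) j → (Vecs k → ℤ) → ℤ
Sp U φ = Σᵥ _ λ A → φ (lin U A)

private
  +ᵥ-interchange : ∀ {k} (a b c d : Vecs k) → (a +ᵥ b) +ᵥ (c +ᵥ d) ≡ (a +ᵥ c) +ᵥ (b +ᵥ d)
  +ᵥ-interchange [] [] [] [] = refl
  +ᵥ-interchange (a ∷ x) (b ∷ y) (c ∷ z) (d ∷ t) =
    cong₂ _∷_ (identity₄ (λ a b c d → (a ⊕ b) ⊕ (c ⊕ d)) (λ a b c d → (a ⊕ c) ⊕ (b ⊕ d)) tt a b c d)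
              (+ᵥ-interchange x y z t)

  +ᵥ-swap : ∀ {k} (a b c : Vecs k) → a +ᵥ (b +ᵥ c) ≡ b +ᵥ (a +ᵥ c)
  +ᵥ-swap a b c = trans (sym (+ᵥ-assoc a b c)) (trans (cong (_+ᵥ c) (+ᵥ-comm a b)) (+ᵥ-assoc b a c))

lin-0 : ∀ {j k} (U : Vec (Vecs k) j) → lin U 0ᵥ ≡ 0ᵥ
lin-0 [] = refl
lin-0 (u ∷ U) = trans (cong₂ _+ᵥ_ (·ᵥ-zeroˡ u) (lin-0 U)) (+ᵥ-identityˡ 0ᵥ)

lin-+ : ∀ {j k} (U : Vec (Vecs k) j) A B → lin U (A +ᵥ B) ≡ lin U A +ᵥ lin U B
lin-+ [] [] [] = sym (+ᵥ-identityˡ 0ᵥ)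
lin-+ (u ∷ U) (a ∷ A) (b ∷ B) =
  trans (cong₂ _+ᵥ_ (·ᵥ-distribʳ a b u) (lin-+ U A B)) (+ᵥ-interchange _ _ _ _)

lin-· : ∀ {j k} (U : Vec (Vecs k) j) c A → lin U (c ·ᵥ A) ≡ c ·ᵥ lin U A
lin-· [] c [] = sym (·ᵥ-zeroʳ c)
lin-· (u ∷ U) c (a ∷ A) =
  trans (cong₂ _+ᵥ_ (·ᵥ-assoc c a u) (lin-· U c A)) (sym (·ᵥ-distribˡ c (a ·ᵥ u) (lin U A)))

lin-map : ∀ {i j k} (U : Vec (Vecs k) j) (C : Vec (Vecs j) i) A →
          lin (map (lin U) C) A ≡ lin U (lin C A)
lin-map U [] [] = sym (lin-0 U)
lin-map U (c ∷ C) (a ∷ A) = sym (trans (lin-+ U (a ·ᵥ c) (lin C A))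
  (cong₂ _+ᵥ_ (lin-· U a c) (sym (lin-map U C A))))

Indep-map : ∀ {i j k} {U : Vec (Vecs k) j} {C : Vec (Vecs j) i} →
            Indep U → Indep C → Indep (map (lin U) C)
Indep-map {U = U} {C} iU iC = indep λ A e →
  independent iC A (independent iU (lin C A) (trans (sym (lin-map U C A)) e))

lin-injective : ∀ {j k} {U : Vec (Vecs k) j} → Indep U → ∀ A B → lin U A ≡ lin U B → A ≡ B
lin-injective {U = U} iU A B e =
  trans (+ᵥ-solve {x = A} {B} (independent iU (A +ᵥ B) (trans (lin-+ U A B)
    (trans (cong (_+ᵥ lin U B) e) (+ᵥ-self (lin U B)))))) (+ᵥ-identityʳ B)

inSpan? : ∀ {j k} (U : Vec (Vecs k) j) x → (∃[ A ] lin U A ≡ x) ⊎ (∀ A → lin U A ≢ x)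
inSpan? U x with search _ (λ A → lin U A =ᵥ x)
... | inj₁ (A , e) = inj₁ (A , =ᵥ-sound _ _ (subst T (sym e) tt))
... | inj₂ h = inj₂ λ A e →
  subst T (trans (sym (=ᵥ-refl x)) (trans (cong (_=ᵥ x) (sym e)) (h A))) tt

-- A relation with nonzero coefficient at `x` can be divided by that coefficient, which puts `x`
-- into the span of `U`.
Indep-∷ : ∀ {j k} {U : Vec (Vecs k) j} {x} → Indep U → (∀ A → lin U A ≢ x) → Indep (x ∷ U)
Indep-∷ {U = U} {x} iU h = indep go
  where
  go : ∀ A → lin (x ∷ U) A ≡ 0ᵥ → A ≡ 0ᵥ
  go (a ∷ A) e with a ≟₄ o
  ... | inj₁ refl = cong (o ∷_) (independent iU A (trans (sym (trans (cong (_+ᵥ lin U A) (·ᵥ-zeroˡ x))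
                    (+ᵥ-identityˡ (lin U A)))) e))
  ... | inj₂ a≢o = ⊥-elim (h ((a ⁻¹) ·ᵥ A) (trans (lin-· U (a ⁻¹) A)
    (trans (cong ((a ⁻¹) ·ᵥ_) (sym (trans (+ᵥ-solve {x = a ·ᵥ x} e) (+ᵥ-identityʳ (lin U A)))))
           (·ᵥ-cancel a a≢o x))))

Indep-[] : ∀ {k} → Indep {k = k} []
Indep-[] = indep λ { [] _ → refl }

Indep-single : ∀ {k} {x : Vecs k} → x ≢ 0ᵥ → Indep (x ∷ [])
Indep-single x≢0 = Indep-∷ Indep-[] λ { [] e → x≢0 (sym e) }

∷-head : ∀ {k a b} {A B : Vecs k} → a ∷ A ≡ b ∷ B → a ≡ b
∷-head refl = refl

∷-tail : ∀ {k a b} {A B : Vecs k} → a ∷ A ≡ b ∷ B → A ≡ B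
∷-tail refl = refl

Indep-tail : ∀ {j k} {U : Vec (Vecs k) j} {x} → Indep (x ∷ U) → Indep U
Indep-tail {U = U} {x} h = indep λ A e → ∷-tail (independent h (o ∷ A)
  (trans (cong (_+ᵥ lin U A) (·ᵥ-zeroˡ x)) (trans (+ᵥ-identityˡ _) e)))

Indep-skip : ∀ {j k} {U : Vec (Vecs k) j} {x y} → Indep (x ∷ y ∷ U) → Indep (x ∷ U)
Indep-skip {U = U} {x} {y} h = indep λ { (a ∷ A) e →
  let q = independent h (a ∷ o ∷ A) (trans (cong ((a ·ᵥ x) +ᵥ_)
            (trans (cong (_+ᵥ lin U A) (·ᵥ-zeroˡ y)) (+ᵥ-identityˡ _))) e)
  in cong₂ _∷_ (∷-head q) (∷-tail (∷-tail q)) }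

Indep-swap : ∀ {j k} {U : Vec (Vecs k) j} {x y} → Indep (x ∷ y ∷ U) → Indep (y ∷ x ∷ U)
Indep-swap h = indep λ { (a ∷ b ∷ A) e →
  let q = independent h (b ∷ a ∷ A) (trans (+ᵥ-swap _ _ _) e)
  in cong₂ _∷_ (∷-head (∷-tail q)) (cong₂ _∷_ (∷-head q) (∷-tail (∷-tail q))) }

private
  shear-lin : ∀ {k} a c (x y z : Vecs k) b →
              (a ·ᵥ (x +ᵥ (c ·ᵥ y))) +ᵥ ((b ·ᵥ y) +ᵥ z) ≡ (a ·ᵥ x) +ᵥ (((b ⊕ (a ⊗ c)) ·ᵥ y) +ᵥ z)
  shear-lin a c [] [] [] b = refl
  shear-lin a c (x ∷ xs) (y ∷ ys) (z ∷ zs) b =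
    cong₂ _∷_ (trans (cong (_⊕ ((b ⊗ y) ⊕ z)) (⊗-distribˡ a x (c ⊗ y)))
              (trans (⊕-assoc (a ⊗ x) (a ⊗ (c ⊗ y)) ((b ⊗ y) ⊕ z))
              (cong ((a ⊗ x) ⊕_) (trans (sym (⊕-assoc (a ⊗ (c ⊗ y)) (b ⊗ y) z))
                (cong (_⊕ z) (identity₄ (λ a b c y → (a ⊗ (c ⊗ y)) ⊕ (b ⊗ y))
                                         (λ a b c y → (b ⊕ (a ⊗ c)) ⊗ y) tt a b c y))))))
              (shear-lin a c xs ys zs b)

Indep-shear : ∀ {j k} {U : Vec (Vecs k) j} {x y} c → Indep (x ∷ y ∷ U) → Indep ((x +ᵥ (c ·ᵥ y)) ∷ y ∷ U)
Indep-shear {U = U} {x} {y} c h = indep go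
  where
  go : ∀ A → lin ((x +ᵥ (c ·ᵥ y)) ∷ y ∷ U) A ≡ 0ᵥ → A ≡ 0ᵥ
  go (a ∷ b ∷ A) e with independent h (a ∷ (b ⊕ (a ⊗ c)) ∷ A) (trans (sym (shear-lin a c x y (lin U A) b)) e)
  ... | q with ∷-head q
  ... | refl = cong (o ∷_) (trans (cong (_∷ A) (sym (⊕-identityʳ b))) (∷-tail q))

-- Makes each x + c y a valid generator for a member of the pencil between `U` and the span of `x`,
-- `y`, `U`; the remaining member is generated by `y`.
Indep-pencil : ∀ {j k} {U : Vec (Vecs k) j} {x y} c → Indep (x ∷ y ∷ U) → Indep ((x +ᵥ (c ·ᵥ y)) ∷ U)
Indep-pencil c h = Indep-skip (Indep-shear c h)

Indep⇒≢0 : ∀ {j k} {U : Vec (Vecs k) j} {x} → Indep (x ∷ U) → x ≢ 0ᵥ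
Indep⇒≢0 {U = U} {x} h e with independent h (i ∷ 0ᵥ) (trans (cong₂ _+ᵥ_ (trans (·ᵥ-identity x) e) (lin-0 U))
  (+ᵥ-identityˡ _))
... | ()

Sp-cong : ∀ {j k} (U : Vec (Vecs k) j) {φ ψ : Vecs k → ℤ} → (∀ x → φ x ≡ ψ x) → Sp U φ ≡ Sp U ψ
Sp-cong U e = Σᵥ-cong _ λ A → e (lin U A)

Sp-map : ∀ {i j k} (U : Vec (Vecs k) j) (C : Vec (Vecs j) i) φ →
         Sp (map (lin U) C) φ ≡ Sp C (λ A → φ (lin U A))
Sp-map U C φ = Σᵥ-cong _ λ A → cong φ (lin-map U C A)

-- Both sides equal the sum of δ (lin U A) y · φ y over all A and y, because by independence a
-- vector y has at most one coefficient vector.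
Σᵥ-support : ∀ {j k} {U : Vec (Vecs k) j} → Indep U → ∀ φ →
             (∀ y → (∀ A → lin U A ≢ y) → φ y ≡ 0ℤ) → Σᵥ k φ ≡ Sp U φ
Σᵥ-support {j} {k} {U} iU φ h = sym (begin
  Sp U φ
    ≡⟨ Σᵥ-cong j (λ A → sym (Σᵥ-δ k φ (lin U A))) ⟩
  Σᵥ j (λ A → Σᵥ k λ y → δ (lin U A) y * φ y)
    ≡⟨ Σᵥ-swap j k _ ⟩
  Σᵥ k (λ y → Σᵥ j λ A → δ (lin U A) y * φ y)
    ≡⟨ Σᵥ-cong k fibre ⟩
  Σᵥ k φ ∎)
  where
  open ≡-Reasoning
  fibre : ∀ y → Σᵥ j (λ A → δ (lin U A) y * φ y) ≡ φ y
  fibre y with inSpan? U y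
  ... | inj₁ (A , refl) = trans
    (Σᵥ-single j _ A λ B B≢A → cong (_* φ y) (δ-distinct λ e → B≢A (lin-injective iU B A e)))
    (trans (cong (_* φ y) (δ-self y)) (ℤₚ.*-identityˡ (φ y)))
  ... | inj₂ n = trans (Σᵥ-zero j λ A → trans (cong (_* φ y) (δ-distinct (n A))) (ℤₚ.*-zeroˡ (φ y)))
    (sym (h y n))

-- Dimension by counting vectors

pow4-suc≰ : ∀ d → ¬ (pow4 (suc d) ≤ℤ pow4 d)
pow4-suc≰ d h = ℕₚ.<⇒≱ (lt d) (drop (subst₂ _≤ℤ_ (pos (suc d)) (pos d) h))
  where
  n4 : ℕ → ℕ
  n4 zero = 1
  n4 (suc d) = 4 ℕ.* n4 d
  pos : ∀ d → pow4 d ≡ + n4 d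
  pos zero = refl
  pos (suc d) = trans (cong (λ x → + 4 * x) (pos d)) (sym (ℤₚ.pos-* 4 (n4 d)))
  drop : ∀ {a b} → + a ≤ℤ + b → a ≤ b
  drop (+≤+ l) = l
  nz : ∀ d → ℕ.NonZero (n4 d)
  nz zero = _
  nz (suc d) = ℕₚ.m*n≢0 4 (n4 d) {{_}} {{nz d}}
  lt : ∀ d → n4 d ℕ.< n4 (suc d)
  lt d = subst (n4 d ℕ.<_) (ℕₚ.*-comm (n4 d) 4) (ℕₚ.m<m*n (n4 d) 4 {{nz d}} (s≤s (s≤s z≤n)))

-- In place of an exchange argument, the indicator of the span is summed over the whole space: the
-- sum is 4^j by independence, and termwise it is at most 4^k.
Indep⇒pow4≤ : ∀ {j k} {U : Vec (Vecs k) j} → Indep U → pow4 j ≤ℤ pow4 k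
Indep⇒pow4≤ {j} {k} {U} iU = subst₂ _≤ℤ_ count (trans (Σᵥ-const k 1ℤ) (ℤₚ.*-identityʳ _))
  (Σᵥ-mono k λ y → ind≤1 y)
  where
  ind : Vecs k → ℤ
  ind y with inSpan? U y
  ... | inj₁ _ = 1ℤ
  ... | inj₂ _ = 0ℤ
  ind≤1 : ∀ y → ind y ≤ℤ 1ℤ
  ind≤1 y with inSpan? U y
  ... | inj₁ _ = ℤₚ.≤-refl
  ... | inj₂ _ = +≤+ z≤n
  ind-out : ∀ y → (∀ A → lin U A ≢ y) → ind y ≡ 0ℤ
  ind-out y n with inSpan? U y
  ... | inj₁ (A , e) = ⊥-elim (n A e)
  ... | inj₂ _ = refl
  ind-in : ∀ A → ind (lin U A) ≡ 1ℤ
  ind-in A with inSpan? U (lin U A)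
  ... | inj₁ _ = refl
  ... | inj₂ n = ⊥-elim (n A refl)
  count : Σᵥ k ind ≡ pow4 j
  count = trans (Σᵥ-support iU ind ind-out)
    (trans (Σᵥ-cong j ind-in) (trans (Σᵥ-const j 1ℤ) (ℤₚ.*-identityʳ _)))

-- A vector outside the span would give k + 1 independent vectors in a space of only 4^k vectors.
basis-spans : ∀ {k} {U : Vec (Vecs k) k} → Indep U → ∀ x → ∃[ A ] lin U A ≡ x
basis-spans {k} {U} iU x with inSpan? U x
... | inj₁ h = h
... | inj₂ n = ⊥-elim (pow4-suc≰ k (Indep⇒pow4≤ (Indep-∷ iU n)))

Sp-basis : ∀ {k} {U : Vec (Vecs k) k} → Indep U → ∀ φ → Sp U φ ≡ Σᵥ k φ
Sp-basis iU φ = sym (Σᵥ-support iU φ λ y n → ⊥-elim (let (A , e) = basis-spans iU y in n A e))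

pow4-mono : ∀ {j k} → j ≤ k → pow4 j ≤ℤ pow4 k
pow4-mono {k = k} z≤n = ind k
  where
  ind : ∀ k → 1ℤ ≤ℤ pow4 k
  ind zero = ℤₚ.≤-refl
  ind (suc k) = ℤₚ.≤-trans (+≤+ (s≤s z≤n)) (ℤₚ.*-monoˡ-≤-nonNeg (+ 4) (ind k))
pow4-mono (s≤s h) = ℤₚ.*-monoˡ-≤-nonNeg (+ 4) (pow4-mono h)

notInSpan : ∀ {j k} → Vec (Vecs k) j → Vecs k → Bool
notInSpan U x with inSpan? U x
... | inj₁ _ = false
... | inj₂ _ = true

-- If the span exhausted the space, counting vectors would give 4^k = 4^j.
Indep-extend : ∀ {j k} {U : Vec (Vecs k) j} → Indep U → j ℕ.< k → ∃[ x ] Indep (x ∷ U)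
Indep-extend {j} {k} {U} iU j<k with search k (notInSpan U)
... | inj₁ (x , e) = x , Indep-∷ iU (outside x e)
  where
  outside : ∀ x → notInSpan U x ≡ true → ∀ A → lin U A ≢ x
  outside x e with inSpan? U x
  ... | inj₂ n = n
... | inj₂ all-in = ⊥-elim (pow4-suc≰ j (subst (pow4 (suc j) ≤ℤ_) total (pow4-mono j<k)))
  where
  in-span : ∀ x → notInSpan U x ≡ false → ∃[ A ] lin U A ≡ x
  in-span x e with inSpan? U x
  ... | inj₁ h = h
  total : pow4 k ≡ pow4 j
  total = trans (sym (trans (Σᵥ-const k 1ℤ) (ℤₚ.*-identityʳ _)))
    (trans (Σᵥ-support iU (λ _ → 1ℤ) λ y n → ⊥-elim (let (A , e) = in-span y (all-in y) in n A e))
           (trans (Σᵥ-const j 1ℤ) (ℤₚ.*-identityʳ _)))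

opaque
  unfolding Σᵥ

  Sp₀ : ∀ {k} (φ : Vecs k → ℤ) → Sp [] φ ≡ φ 0ᵥ
  Sp₀ φ = refl

  Sp₁ : ∀ {k} (x : Vecs k) φ → Sp (x ∷ []) φ ≡ Σ₄ λ a → φ ((a ·ᵥ x) +ᵥ 0ᵥ)
  Sp₁ x φ = refl

  Sp₂ : ∀ {k} (x y : Vecs k) φ → Sp (x ∷ y ∷ []) φ ≡ Σ₄ λ a → Σ₄ λ b → φ ((a ·ᵥ x) +ᵥ ((b ·ᵥ y) +ᵥ 0ᵥ))
  Sp₂ x y φ = refl

  Sp-swap : ∀ {j k} (x y : Vecs k) (U : Vec (Vecs k) j) φ → Sp (x ∷ y ∷ U) φ ≡ Sp (y ∷ x ∷ U) φ
  Sp-swap x y U φ = trans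
    (Σ₄-swap λ a b → Σᵥ _ λ A → φ ((a ·ᵥ x) +ᵥ ((b ·ᵥ y) +ᵥ lin U A)))
    (Σ₄-cong λ b → Σ₄-cong λ a → Σᵥ-cong _ λ A → cong φ (+ᵥ-swap (a ·ᵥ x) (b ·ᵥ y) (lin U A)))

  Sp-∷-cong : ∀ {j j' k} (x : Vecs k) (U : Vec (Vecs k) j) (U' : Vec (Vecs k) j') →
              (∀ φ → Sp U φ ≡ Sp U' φ) → ∀ φ → Sp (x ∷ U) φ ≡ Sp (x ∷ U') φ
  Sp-∷-cong x U U' e φ = Σ₄-cong λ a → e λ y → φ ((a ·ᵥ x) +ᵥ y)

  Sp-scale : ∀ {j k} c → c ≢ o → ∀ (x : Vecs k) (U : Vec (Vecs k) j) φ → Sp ((c ·ᵥ x) ∷ U) φ ≡ Sp (x ∷ U) φ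
  Sp-scale c c≢o x U φ = trans
    (Σ₄-cong λ a → Σᵥ-cong _ λ A → cong (λ y → φ (y +ᵥ lin U A))
      (trans (sym (·ᵥ-assoc a c x)) (cong (_·ᵥ x) (⊗-comm a c))))
    (Σ₄-scale (λ a → Σᵥ _ λ A → φ ((a ·ᵥ x) +ᵥ lin U A)) c c≢o)

  Sp-shear : ∀ {j k} (x y : Vecs k) c (U : Vec (Vecs k) j) φ →
             Sp ((x +ᵥ (c ·ᵥ y)) ∷ y ∷ U) φ ≡ Sp (x ∷ y ∷ U) φ
  Sp-shear x y c U φ = Σ₄-cong λ a → trans
    (Σ₄-cong λ b → Σᵥ-cong _ λ A → cong φ (shear-lin a c x y (lin U A) b))
    (Σ₄-translate (λ b → Σᵥ _ λ A → φ ((a ·ᵥ x) +ᵥ ((b ·ᵥ y) +ᵥ lin U A))) (a ⊗ c))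

private
  pencil-lin : ∀ {k} a c (x y z : Vecs k) →
               (a ·ᵥ (x +ᵥ (c ·ᵥ y))) +ᵥ z ≡ (a ·ᵥ x) +ᵥ (((a ⊗ c) ·ᵥ y) +ᵥ z)
  pencil-lin a c x y z = trans (cong (_+ᵥ z) (trans (·ᵥ-distribˡ a x (c ·ᵥ y))
    (cong ((a ·ᵥ x) +ᵥ_) (sym (·ᵥ-assoc a c y))))) (+ᵥ-assoc _ _ _)

  gather : ∀ p a b c d → (p + (b + (c + d))) + + 4 * a ≡ p + ((a + (a + (a + a))) + (b + (c + d)))
  gather = solve-∀

opaque
  unfolding Σᵥ

  -- The subspaces between U and ⟨x, y, U⟩ of codimension one in the latter cover it, and
  -- any two of them meet in U.
  Sp-pencil : ∀ {j k} (x y : Vecs k) (U : Vec (Vecs k) j) φ →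
              Sp (x ∷ y ∷ U) φ + + 4 * Sp U φ ≡ Sp (y ∷ U) φ + Σ₄ λ c → Sp ((x +ᵥ (c ·ᵥ y)) ∷ U) φ
  Sp-pencil {j} x y U φ = begin
    Σ₄ (λ a → Σ₄ (H a)) + + 4 * Sp U φ
      ≡⟨ cong (λ t → Σ₄ (λ a → Σ₄ (H a)) + + 4 * t) (sym H₀₀) ⟩
    Σ₄ (λ a → Σ₄ (H a)) + + 4 * H o o
      ≡⟨ gather (Σ₄ (H o)) (H o o) (Σ₄ (H i)) (Σ₄ (H w)) (Σ₄ (H w²)) ⟩
    Σ₄ (H o) + ((H o o + (H o o + (H o o + H o o))) + (Σ₄ (H i) + (Σ₄ (H w) + Σ₄ (H w²))))
      -- For a ≠ o the map c ↦ a ⊗ c permutes the coefficients of `y`; for a = o it is constant,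
      -- which accounts for the four copies of `H o o`.
      ≡⟨ cong₂ _+_ (Σ₄-cong H₀) (+-congʳ (Σ₄ λ c → H o (o ⊗ c)) (+-congʳ (Σ₄ (H i))
         (cong₂ _+_ (sym (Σ₄-scale (H w) w λ ())) (sym (Σ₄-scale (H w²) w² λ ()))))) ⟩
    Sp (y ∷ U) φ + Σ₄ (λ a → Σ₄ λ c → H a (a ⊗ c))
      ≡⟨ +-congʳ (Sp (y ∷ U) φ) (Σ₄-swap λ a c → H a (a ⊗ c)) ⟩
    Sp (y ∷ U) φ + Σ₄ (λ c → Σ₄ λ a → H a (a ⊗ c))
      ≡⟨ +-congʳ (Sp (y ∷ U) φ) (Σ₄-cong λ c → Σ₄-cong λ a → Σᵥ-cong j λ A →
           cong φ (sym (pencil-lin a c x y (lin U A)))) ⟩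
    Sp (y ∷ U) φ + Σ₄ (λ c → Sp ((x +ᵥ (c ·ᵥ y)) ∷ U) φ) ∎
    where
    open ≡-Reasoning
    H : GF4 → GF4 → ℤ
    H a b = Σᵥ j λ A → φ ((a ·ᵥ x) +ᵥ ((b ·ᵥ y) +ᵥ lin U A))
    H₀ : ∀ b → H o b ≡ Σᵥ j λ A → φ ((b ·ᵥ y) +ᵥ lin U A)
    H₀ b = Σᵥ-cong j λ A → cong φ (trans (cong (_+ᵥ _) (·ᵥ-zeroˡ x)) (+ᵥ-identityˡ _))
    H₀₀ : H o o ≡ Sp U φ
    H₀₀ = trans (H₀ o) (Σᵥ-cong j λ A → cong φ (trans (cong (_+ᵥ _) (·ᵥ-zeroˡ y)) (+ᵥ-identityˡ _)))

-- The quadratic identity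

weight : ℤ → ℤ
weight z = z * (z - 1ℤ)

private
  p-row : ∀ q s F x → (q * s + (F + (F + F))) + ((q * x + (F + (F + F))) + ((q * x + (F + (F + F))) + (q * x + (F + (F + F)))))
        ≡ + 12 * F + q * (s + + 3 * x)
  p-row = solve-∀
  p-total : ∀ q s F → q * (+ 12 * F) + q * (q * s + + 3 * F) ≡ + 15 * q * F + q * q * s
  p-total = solve-∀
  p-times : ∀ q s F x → (+ 12 * F + q * (s + + 3 * x)) * x ≡ + 12 * F * x + (q * s * x + + 3 * q * (x * x))
  p-times = solve-∀
  p-phi : ∀ B s → (B - + 4 * s) * (B - + 4 * s - + 12)
        ≡ B * B + ((- (+ 8 * s + + 12)) * B + + 4 * s * (+ 4 * s + + 12))
  p-phi = solve-∀
  p-dep : ∀ x s → (+ 4 * (s + + 3 * x) - + 4 * s) * (+ 4 * (s + + 3 * x) - + 4 * s - + 12) ≡ + 144 * (x * (x - 1ℤ))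
  p-dep = solve-∀
  p-final₁ : ∀ q W s → + 9 * ((+ 80 - + 5 * q) * W)
           ≡ (+ 576 * W + (+ 144 * W - + 576 * (s * (s - 1ℤ)))) + (+ 576 * (s * (s - 1ℤ)) - + 45 * q * W)
  p-final₁ = solve-∀
  p-final₂ : ∀ q W s F →
    (((+ 15 * q * F + q * q * s) * s + + 15 * (+ 12 * F * F + (q * s * F + + 3 * q * (W + F))))
      + ((- (+ 8 * s + + 12)) * (+ 15 * q * F + q * q * s) + q * (q * (+ 4 * s * (+ 4 * s + + 12)))))
    + (+ 576 * (s * (s - 1ℤ)) - + 45 * q * W)
    ≡ + 9 * (+ 20 * F * F - + 10 * q * s * F - + 15 * q * F + q * q * (s * s + + 4 * s) + + 64 * (s * (s - 1ℤ)))
  p-final₂ = solve-∀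
  p-sq : ∀ x → x * x ≡ x * (x - 1ℤ) + x
  p-sq = solve-∀
  p-T : ∀ a b → (a + (b + (b + b))) + ((b + (b + (b + b))) + ((b + (b + (b + b))) + (b + (b + (b + b))))) ≡ a + + 15 * b
  p-T = solve-∀
  p-row₀ : ∀ W y s t → y ≡ s * (s - 1ℤ) → t ≡ 1ℤ →
           + 144 * W ≡ + 576 * y + t * (+ 144 * W - + 576 * (s * (s - 1ℤ)))
  p-row₀ W _ s _ refl refl = p W (s * (s - 1ℤ))
    where
    p : ∀ W y → + 144 * W ≡ + 576 * y + 1ℤ * (+ 144 * W - + 576 * y)
    p = solve-∀
  p-row₁ : ∀ W y s t → t ≡ 0ℤ → + 4 * (+ 144 * y) ≡ + 576 * y + t * (+ 144 * W - + 576 * (s * (s - 1ℤ)))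
  p-row₁ W y s _ refl = p y (+ 144 * W - + 576 * (s * (s - 1ℤ)))
    where
    p : ∀ y z → + 4 * (+ 144 * y) ≡ + 576 * y + 0ℤ * z
    p = solve-∀

  p-reduced : ∀ W s r k F q → q ≡ + 16 * r → F ≡ + 4 * r * s + + 12 * k →
    + 20 * F * F - + 10 * q * s * F - + 15 * q * F + q * q * (s * s + + 4 * s) + + 64 * (s * (s - 1ℤ))
    ≡ (+ 80 - + 5 * q) * W →
    + 16 * (+ 4 * ((r * r - 1ℤ) * (s * (s - 1ℤ))) + + 180 * (k * (r - k))) ≡ + 16 * (+ 5 * ((r - 1ℤ) * W))
  p-reduced W s r k _ _ refl refl e = trans (p s r k) (trans (cong -_ e) (p' W r))
    where
    p : ∀ s r k → + 16 * (+ 4 * ((r * r - 1ℤ) * (s * (s - 1ℤ))) + + 180 * (k * (r - k)))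
      ≡ - (+ 20 * (+ 4 * r * s + + 12 * k) * (+ 4 * r * s + + 12 * k) - + 10 * (+ 16 * r) * s * (+ 4 * r * s + + 12 * k)
          - + 15 * (+ 16 * r) * (+ 4 * r * s + + 12 * k) + + 16 * r * (+ 16 * r) * (s * s + + 4 * s) + + 64 * (s * (s - 1ℤ)))
    p = solve-∀
    p' : ∀ W r → - ((+ 80 - + 5 * (+ 16 * r)) * W) ≡ + 16 * (+ 5 * ((r - 1ℤ) * W))
    p' = solve-∀

-- The product in `two-valued` vanishes at independent pairs. Its sum over all pairs is computed
-- twice: from the dependent pairs alone, which yields weights, and by expanding the product, which
-- yields a polynomial in `F`.
module Quadratic (d : ℕ) (f : Vecs d → ℤ) (s : ℤ)
                 (hom : ∀ c x → c ≢ o → f (c ·ᵥ x) ≡ f x) (f0 : f 0ᵥ ≡ s)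
                 (two-valued : ∀ x y → Indep (x ∷ y ∷ []) →
                   (Sp (x ∷ y ∷ []) f - + 4 * s) * (Sp (x ∷ y ∷ []) f - + 4 * s - + 12) ≡ 0ℤ)
  where

  q' F W : ℤ
  q' = pow4 d
  F = Σᵥ d f
  W = Σᵥ d (λ x → weight (f x))

  B : Vecs d → Vecs d → ℤ
  B x y = Sp (x ∷ y ∷ []) f

  pt : GF4 → GF4 → Vecs d → Vecs d → Vecs d
  pt a b x y = (a ·ᵥ x) +ᵥ ((b ·ᵥ y) +ᵥ 0ᵥ)

  f-o· : ∀ x → f (o ·ᵥ x) ≡ s
  f-o· x = trans (cong f (·ᵥ-zeroˡ x)) f0

  private
    sum-pt : ∀ a x b → b ≢ o → Σᵥ d (λ y → f (pt a b x y)) ≡ F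
    sum-pt a x b b≢o = trans
      (Σᵥ-cong d λ y → cong f (trans (cong ((a ·ᵥ x) +ᵥ_) (+ᵥ-identityʳ (b ·ᵥ y))) (+ᵥ-comm (a ·ᵥ x) (b ·ᵥ y))))
      (trans (Σᵥ-scale d (λ z → f (z +ᵥ (a ·ᵥ x))) b b≢o) (Σᵥ-translate d f (a ·ᵥ x)))
    sum-pt₀ : ∀ a x → Σᵥ d (λ y → f (pt a o x y)) ≡ q' * f (a ·ᵥ x)
    sum-pt₀ a x = trans
      (Σᵥ-cong d λ y → cong f (trans (cong (λ z → (a ·ᵥ x) +ᵥ (z +ᵥ 0ᵥ)) (·ᵥ-zeroˡ y))
        (trans (cong ((a ·ᵥ x) +ᵥ_) (+ᵥ-identityˡ 0ᵥ)) (+ᵥ-identityʳ (a ·ᵥ x)))))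
      (Σᵥ-const d (f (a ·ᵥ x)))
    sum-b : ∀ a x z → f (a ·ᵥ x) ≡ z → Σᵥ d (λ y → Σ₄ λ b → f (pt a b x y)) ≡ q' * z + (F + (F + F))
    sum-b a x z e = trans (Σᵥ-Σ₄ d λ y b → f (pt a b x y))
      (cong₂ _+_ (trans (sum-pt₀ a x) (cong (λ t → q' * t) e))
        (cong₂ _+_ (sum-pt a x i λ ()) (cong₂ _+_ (sum-pt a x w λ ()) (sum-pt a x w² λ ()))))

  -- Of the 16 coefficient pairs, the 12 with b ≠ o make y ↦ a x + b y a bijection and contribute
  -- `F` each. The four with b = o contribute `q'` times f (a x), which is `s` once and f x three
  -- times.
  row-sum : ∀ x → Σᵥ d (B x) ≡ + 12 * F + q' * (s + + 3 * f x)
  row-sum x = trans (Σᵥ-cong d λ y → Sp₂ x y f) (trans (Σᵥ-Σ₄ d λ y a → Σ₄ λ b → f (pt a b x y)) (trans (cong₂ _+_ (sum-b o x s (f-o· x)) (cong₂ _+_ (sum-b i x (f x) (hom i x λ ()))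
      (cong₂ _+_ (sum-b w x (f x) (hom w x λ ())) (sum-b w² x (f x) (hom w² x λ ())))))
      (p-row q' s F (f x))))

  total : ℤ
  total = Σᵥ d λ x → Σᵥ d (B x)

  total-value : total ≡ + 15 * q' * F + q' * q' * s
  total-value = trans (Σᵥ-cong d row-sum)
    (trans (Σᵥ-+ d (λ _ → + 12 * F) (λ x → q' * (s + + 3 * f x)))
    (trans (cong₂ _+_ (Σᵥ-const d (+ 12 * F)) (trans (Σᵥ-* d q' (λ x → s + + 3 * f x))
      (cong (λ t → q' * t) (trans (Σᵥ-+ d (λ _ → s) (λ x → + 3 * f x))
        (cong₂ _+_ (Σᵥ-const d s) (Σᵥ-* d (+ 3) f))))))
      (p-total q' s F)))

  weighted : ℤ
  weighted = Σᵥ d λ x → Σᵥ d λ y → B x y * f x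

  squares : Σᵥ d (λ x → f x * f x) ≡ W + F
  squares = trans (Σᵥ-cong d λ x → p-sq (f x)) (Σᵥ-+ d (λ x → weight (f x)) f)

  weighted-value : weighted ≡ + 12 * F * F + (q' * s * F + + 3 * q' * (W + F))
  weighted-value = trans (Σᵥ-cong d λ x → trans (Σᵥ-*ʳ d (f x) (B x))
      (trans (cong (_* f x) (row-sum x)) (p-times q' s F (f x))))
    (trans (Σᵥ-+ d (λ x → + 12 * F * f x) (λ x → q' * s * f x + + 3 * q' * (f x * f x)))
    (cong₂ _+_ (Σᵥ-* d (+ 12 * F) f)
      (trans (Σᵥ-+ d (λ x → q' * s * f x) (λ x → + 3 * q' * (f x * f x)))
        (cong₂ _+_ (Σᵥ-* d (q' * s) f)
          (trans (Σᵥ-* d (+ 3 * q') (λ x → f x * f x)) (cong (λ t → + 3 * q' * t) squares))))))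

  B-swap : ∀ x y → B x y ≡ B y x
  B-swap x y = Sp-swap x y [] f

  twisted : GF4 → GF4 → ℤ
  twisted a b = Σᵥ d λ x → Σᵥ d λ y → B x y * f (pt a b x y)

  -- A pair (x, y) may be replaced by any other basis of its span.
  twisted-value : ∀ a b → (a ≢ o ⊎ b ≢ o) → twisted a b ≡ weighted
  twisted-value a b nz with a ≟₄ o
  ... | inj₂ a≢o = trans (Σᵥ-swap d d _) (trans (Σᵥ-cong d λ y →
      trans (Σᵥ-cong d λ x → cong₂ _*_
        (sym (trans (Sp-shear (a ·ᵥ x) y b [] f) (Sp-scale a a≢o x (y ∷ []) f)))
        (cong (λ z → f ((a ·ᵥ x) +ᵥ z)) (+ᵥ-identityʳ (b ·ᵥ y))))
      (trans (Σᵥ-scale d (λ z → B (z +ᵥ (b ·ᵥ y)) y * f (z +ᵥ (b ·ᵥ y))) a a≢o)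
             (Σᵥ-translate d (λ z → B z y * f z) (b ·ᵥ y))))
    (Σᵥ-swap d d (λ y x → B x y * f x)))
  ... | inj₁ refl = trans (Σᵥ-swap d d _) (Σᵥ-cong d λ y → Σᵥ-cong d λ x → cong₂ _*_ (B-swap x y)
      (trans (cong f (trans (cong₂ _+ᵥ_ (·ᵥ-zeroˡ x) (+ᵥ-identityʳ (b ·ᵥ y))) (+ᵥ-identityˡ (b ·ᵥ y))))
             (hom b y (b≢o nz))))
    where
    b≢o : o ≢ o ⊎ b ≢ o → b ≢ o
    b≢o (inj₁ n) = ⊥-elim (n refl)
    b≢o (inj₂ n) = n

  twisted₀₀ : twisted o o ≡ total * s
  twisted₀₀ = trans (Σᵥ-cong d λ x → trans (Σᵥ-cong d λ y → cong (B x y *_)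
      (trans (cong f (trans (cong₂ _+ᵥ_ (·ᵥ-zeroˡ x) (trans (+ᵥ-identityʳ (o ·ᵥ y)) (·ᵥ-zeroˡ y)))
        (+ᵥ-identityˡ 0ᵥ))) f0))
      (Σᵥ-*ʳ d s (B x))) (Σᵥ-*ʳ d s (λ x → Σᵥ d (B x)))

  -- One factor `B x y` is expanded into its 16 terms. The pair (o, o) contributes f 0 = s, and the
  -- other 15 pairs give equal sums by a change of basis.
  sum-of-squares : Σᵥ d (λ x → Σᵥ d λ y → B x y * B x y) ≡ total * s + + 15 * weighted
  sum-of-squares = begin
    Σᵥ d (λ x → Σᵥ d λ y → B x y * B x y)
      ≡⟨ (Σᵥ-cong d λ x → Σᵥ-cong d λ y → sym (trans (Σ₄-cong λ a → Σ₄-* (B x y) (λ b → f (pt a b x y)))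
           (trans (Σ₄-* (B x y) (λ a → Σ₄ λ b → f (pt a b x y))) (cong (B x y *_) (sym (Sp₂ x y f)))))) ⟩
    Σᵥ d (λ x → Σᵥ d λ y → Σ₄ λ a → Σ₄ λ b → B x y * f (pt a b x y))
      ≡⟨ (Σᵥ-cong d λ x → trans (Σᵥ-Σ₄ d λ y a → Σ₄ λ b → B x y * f (pt a b x y))
           (Σ₄-cong λ a → Σᵥ-Σ₄ d λ y b → B x y * f (pt a b x y))) ⟩
    Σᵥ d (λ x → Σ₄ λ a → Σ₄ λ b → Σᵥ d λ y → B x y * f (pt a b x y))
      ≡⟨ trans (Σᵥ-Σ₄ d λ x a → Σ₄ λ b → Σᵥ d λ y → B x y * f (pt a b x y))
           (Σ₄-cong λ a → Σᵥ-Σ₄ d λ x b → Σᵥ d λ y → B x y * f (pt a b x y)) ⟩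
    Σ₄ (λ a → Σ₄ λ b → twisted a b)
      ≡⟨ cong₂ _+_ (cong₂ _+_ twisted₀₀ (three o)) (cong₂ _+_ (four i λ ()) (cong₂ _+_ (four w λ ()) (four w² λ ()))) ⟩
    (total * s + (weighted + (weighted + weighted))) + (four' + (four' + four'))
      ≡⟨ p-T (total * s) weighted ⟩
    total * s + + 15 * weighted ∎
    where
    open ≡-Reasoning
    four' = weighted + (weighted + (weighted + weighted))
    three : ∀ a → twisted a i + (twisted a w + twisted a w²) ≡ weighted + (weighted + weighted)
    three a = cong₂ _+_ (twisted-value a i (inj₂ λ ()))
      (cong₂ _+_ (twisted-value a w (inj₂ λ ())) (twisted-value a w² (inj₂ λ ())))
    four : ∀ a → a ≢ o → Σ₄ (twisted a) ≡ four'
    four a a≢o = cong₂ _+_ (twisted-value a o (inj₁ a≢o)) (three a)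

  φ : Vecs d → Vecs d → ℤ
  φ x y = (B x y - + 4 * s) * (B x y - + 4 * s - + 12)

  B-0 : ∀ y → B 0ᵥ y ≡ + 4 * (s + + 3 * f y)
  B-0 y = trans (Sp₂ 0ᵥ y f) (trans (Σ₄-cong λ a → cong₂ _+_ (val a o s (f-o· y)) (cong₂ _+_ (val a i (f y) (hom i y λ ()))
      (cong₂ _+_ (val a w (f y) (hom w y λ ())) (val a w² (f y) (hom w² y λ ())))))
    (trans (Σ₄-const _) (cong (λ t → + 4 * t) (p s (f y)))))
    where
    val : ∀ a b z → f (b ·ᵥ y) ≡ z → f (pt a b 0ᵥ y) ≡ z
    val a b z e = trans (cong f (trans (cong₂ _+ᵥ_ (·ᵥ-zeroʳ a) (+ᵥ-identityʳ (b ·ᵥ y))) (+ᵥ-identityˡ _))) e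
    p : ∀ s z → s + (z + (z + z)) ≡ s + + 3 * z
    p = solve-∀

  B-multiple : ∀ x c → B x ((c ·ᵥ x) +ᵥ 0ᵥ) ≡ + 4 * (s + + 3 * f x)
  B-multiple x c = trans (B-swap x _) (trans (cong (λ z → B z x)
      (trans (+ᵥ-identityʳ (c ·ᵥ x)) (sym (+ᵥ-identityˡ (c ·ᵥ x)))))
    (trans (Sp-shear 0ᵥ x c [] f) (B-0 x)))

  -- For a dependent pair B x y - 4s is 12 z, with z the value at a generator of the span, so the
  -- product turns into 144 z (z - 1).
  φ-dep : ∀ x y z → B x y ≡ + 4 * (s + + 3 * z) → φ x y ≡ + 144 * weight z
  φ-dep x y z e = trans (cong (λ t → (t - + 4 * s) * (t - + 4 * s - + 12)) e) (p-dep z s)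

  row-φ₀ : Σᵥ d (φ 0ᵥ) ≡ + 144 * W
  row-φ₀ = trans (Σᵥ-cong d λ y → φ-dep 0ᵥ y (f y) (B-0 y)) (Σᵥ-* d (+ 144) (λ y → weight (f y)))

  row-φ₁ : ∀ x → x ≢ 0ᵥ → Σᵥ d (φ x) ≡ + 4 * (+ 144 * weight (f x))
  row-φ₁ x x≢0 = trans (Σᵥ-support (Indep-single x≢0) (φ x) vanish)
    (trans (Sp₁ x (φ x)) (trans (Σ₄-cong λ c → φ-dep x _ (f x) (B-multiple x c)) (Σ₄-const (+ 144 * weight (f x)))))
    where
    vanish : ∀ y → (∀ A → lin (x ∷ []) A ≢ y) → φ x y ≡ 0ℤ
    vanish y n = trans (cong (λ t → (t - + 4 * s) * (t - + 4 * s - + 12)) (B-swap x y))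
      (two-valued y x (Indep-∷ (Indep-single x≢0) n))

  -- For x ≠ 0 only the four multiples of `x` are dependent on it; for x = 0 all vectors are. The δ
  -- term corrects this single row.
  row-φ : ∀ x → Σᵥ d (φ x) ≡ + 576 * weight (f x) + δ 0ᵥ x * (+ 144 * W - + 576 * (s * (s - 1ℤ)))
  row-φ x = go (0ᵥ ≟ᵥ x)
    where
    go : 0ᵥ ≡ x ⊎ 0ᵥ ≢ x → Σᵥ d (φ x) ≡ + 576 * weight (f x) + δ 0ᵥ x * (+ 144 * W - + 576 * (s * (s - 1ℤ)))
    go (inj₁ refl) = trans row-φ₀ (p-row₀ W (weight (f 0ᵥ)) s (δ (0ᵥ {d}) (0ᵥ {d})) (cong weight f0) (δ-self (0ᵥ {d})))
    go (inj₂ 0≢x) = trans (row-φ₁ x λ e → 0≢x (sym e)) (p-row₁ W (weight (f x)) s (δ 0ᵥ x) (δ-distinct 0≢x))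

  sum-φ : Σᵥ d (λ x → Σᵥ d (φ x)) ≡ + 576 * W + (+ 144 * W - + 576 * (s * (s - 1ℤ)))
  sum-φ = trans (Σᵥ-cong d row-φ) (trans (Σᵥ-+ d (λ x → + 576 * weight (f x)) _)
    (cong₂ _+_ (Σᵥ-* d (+ 576) (λ x → weight (f x))) (Σᵥ-δ d (λ _ → + 144 * W - + 576 * (s * (s - 1ℤ))) 0ᵥ)))

  expand-φ : Σᵥ d (λ x → Σᵥ d (φ x))
           ≡ (total * s + + 15 * weighted) + ((- (+ 8 * s + + 12)) * total + q' * (q' * (+ 4 * s * (+ 4 * s + + 12))))
  expand-φ = begin
    Σᵥ d (λ x → Σᵥ d (φ x))
      ≡⟨ (Σᵥ-cong d λ x → trans (Σᵥ-cong d λ y → p-phi (B x y) s)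
           (trans (Σᵥ-+ d (λ y → B x y * B x y) (λ y → m * B x y + c)) (+-congʳ (Σᵥ d λ y → B x y * B x y)
             (trans (Σᵥ-+ d (λ y → m * B x y) (λ _ → c)) (cong₂ _+_ (Σᵥ-* d m (B x)) (Σᵥ-const d c)))))) ⟩
    Σᵥ d (λ x → Σᵥ d (λ y → B x y * B x y) + (m * Σᵥ d (B x) + q' * c))
      ≡⟨ trans (Σᵥ-+ d (λ x → Σᵥ d λ y → B x y * B x y) (λ x → m * Σᵥ d (B x) + q' * c))
         (cong₂ _+_ sum-of-squares (trans (Σᵥ-+ d (λ x → m * Σᵥ d (B x)) (λ _ → q' * c))
           (cong₂ _+_ (Σᵥ-* d m (λ x → Σᵥ d (B x))) (Σᵥ-const d (q' * c))))) ⟩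
    (total * s + + 15 * weighted) + (m * total + q' * (q' * c)) ∎
    where
    open ≡-Reasoning
    m = - (+ 8 * s + + 12)
    c = + 4 * s * (+ 4 * s + + 12)

  quadratic : (+ 80 - + 5 * q') * W
            ≡ + 20 * F * F - + 10 * q' * s * F - + 15 * q' * F + q' * q' * (s * s + + 4 * s) + + 64 * (s * (s - 1ℤ))
  -- After `rest` is added, both evaluations of the sum of φ are multiples of 9.
  quadratic = ℤₚ.*-cancelˡ-≡ (+ 9) ((+ 80 - + 5 * q') * W)
      (+ 20 * F * F - + 10 * q' * s * F - + 15 * q' * F + q' * q' * (s * s + + 4 * s) + + 64 * (s * (s - 1ℤ)))
      (trans (p-final₁ q' W s) (trans (cong (_+ rest) (trans (sym sum-φ) (trans expand-φ
        (cong₂ expansion total-value weighted-value)))) (p-final₂ q' W s F)))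
    where
    rest : ℤ
    rest = + 576 * (s * (s - 1ℤ)) - + 45 * q' * W
    expansion : ℤ → ℤ → ℤ
    expansion t u = (t * s + + 15 * u) + ((- (+ 8 * s + + 12)) * t + q' * (q' * (+ 4 * s * (+ 4 * s + + 12))))

  -- In these coordinates the complementary class corresponds to k ↦ r - k and s ↦ 1 - s, which
  -- explains why only k (r - k) and s (s - 1) remain.
  quadratic-reduced : ∀ r k → q' ≡ + 16 * r → F ≡ + 4 * r * s + + 12 * k →
    + 5 * ((r - 1ℤ) * W) ≡ + 4 * ((r * r - 1ℤ) * (s * (s - 1ℤ))) + + 180 * (k * (r - k))
  quadratic-reduced r k eq eF = sym (ℤₚ.*-cancelˡ-≡ (+ 16)
    (+ 4 * ((r * r - 1ℤ) * (s * (s - 1ℤ))) + + 180 * (k * (r - k))) (+ 5 * ((r - 1ℤ) * W))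
    (p-reduced W s r k F q' eq eF (sym quadratic)))

-- f is a function of projective points.  As f 0 = s, a line with sum s + 4k over its 5 points has
-- sum 4s + 12k over its 16 vectors; the sums of planes, solids and 4-spaces will be written
-- 16s + 12k, 64s + 12y and 256s + 12z.
record CL {m} (f : Vecs m → ℤ) (s : ℤ) : Set where
  field
    hom : ∀ c x → c ≢ o → f (c ·ᵥ x) ≡ f x
    at-0 : f 0ᵥ ≡ s
    on-line : ∀ x y → Indep (x ∷ y ∷ []) →
              Sp (x ∷ y ∷ []) f ≡ + 4 * s ⊎ Sp (x ∷ y ∷ []) f ≡ + 4 * s + + 12
open CL

Bit : ℤ → Set
Bit s = s ≡ 0ℤ ⊎ s ≡ 1ℤ

private
  p-line-value : ∀ s → + 4 * s ≡ + 4 * s + + 12 * + 0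
  p-line-value = solve-∀
  p-two₁ : ∀ s → (+ 4 * s - + 4 * s) * (+ 4 * s - + 4 * s - + 12) ≡ 0ℤ
  p-two₁ = solve-∀
  p-two₂ : ∀ s → (+ 4 * s + + 12 - + 4 * s) * (+ 4 * s + + 12 - + 4 * s - + 12) ≡ 0ℤ
  p-two₂ = solve-∀

differs : ℤ → ℤ → ℕ
differs s z with z ℤₚ.≟ + 4 * s
... | yes _ = 0
... | no _ = 1

-- The characteristic function of the class, read off from the line sum. Its values are natural
-- numbers, so that adding over a pencil counts lines.
X : ∀ {m} (f : Vecs m → ℤ) → ℤ → Vecs m → Vecs m → ℕ
X f s x y = differs s (Sp (x ∷ y ∷ []) f)

X-bit : ∀ {m} (f : Vecs m → ℤ) s x y → X f s x y ≡ 0 ⊎ X f s x y ≡ 1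
X-bit f s x y with Sp (x ∷ y ∷ []) f ℤₚ.≟ + 4 * s
... | yes _ = inj₁ refl
... | no _ = inj₂ refl

X≤1 : ∀ {m} (f : Vecs m → ℤ) s x y → X f s x y ≤ 1
X≤1 f s x y with X-bit f s x y
... | inj₁ e rewrite e = z≤n
... | inj₂ e rewrite e = s≤s z≤n

line-value : ∀ {m} {f : Vecs m → ℤ} {s x y} → CL f s → Indep (x ∷ y ∷ []) →
             Sp (x ∷ y ∷ []) f ≡ + 4 * s + + 12 * + X f s x y
line-value {f = f} {s} {x} {y} C ind with Sp (x ∷ y ∷ []) f ℤₚ.≟ + 4 * s
... | yes e = trans e (p-line-value s)
... | no ne with on-line C x y ind
...   | inj₁ e = ⊥-elim (ne e)
...   | inj₂ e = e

two-valued : ∀ {m} {f : Vecs m → ℤ} {s} → CL f s → ∀ x y → Indep (x ∷ y ∷ []) →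
             (Sp (x ∷ y ∷ []) f - + 4 * s) * (Sp (x ∷ y ∷ []) f - + 4 * s - + 12) ≡ 0ℤ
two-valued {f = f} {s} C x y ind with on-line C x y ind
... | inj₁ e = trans (cong (λ t → (t - + 4 * s) * (t - + 4 * s - + 12)) e) (p-two₁ s)
... | inj₂ e = trans (cong (λ t → (t - + 4 * s) * (t - + 4 * s - + 12)) e) (p-two₂ s)

-- Restriction to a subspace keeps `s`, so claims about solids and 4-spaces may be proved in ambient
-- rank 4 or 5.
pull : ∀ {j m} {f : Vecs m → ℤ} {s} {U : Vec (Vecs m) j} → CL f s → Indep U → CL (λ A → f (lin U A)) s
pull {f = f} {s} {U} C iU = record
  { hom = λ c x c≢o → trans (cong f (lin-· U c x)) (hom C c (lin U x) c≢o)
  ; at-0 = trans (cong f (lin-0 U)) (at-0 C)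
  ; on-line = λ x y ind → subst (λ t → t ≡ + 4 * s ⊎ t ≡ + 4 * s + + 12) (Sp-map U (x ∷ y ∷ []) f)
      (on-line C (lin U x) (lin U y) (Indep-map iU ind))
  }

Σᵥ-mirror : ∀ j (g : Vecs j → ℤ) → Σᵥ j (λ x → 1ℤ - g x) ≡ pow4 j - Σᵥ j g
Σᵥ-mirror j g = trans (Σᵥ-+ j (λ _ → 1ℤ) (λ A → - g A))
  (cong₂ _+_ (trans (Σᵥ-const j 1ℤ) (ℤₚ.*-identityʳ (pow4 j)))
    (trans (Σᵥ-cong j λ A → sym (ℤₚ.-1*i≡-i (g A))) (trans (Σᵥ-* j (- 1ℤ) g) (ℤₚ.-1*i≡-i (Σᵥ j g)))))

Sp-mirror : ∀ {j m} (f : Vecs m → ℤ) (U : Vec (Vecs m) j) → Sp U (λ x → 1ℤ - f x) ≡ pow4 j - Sp U f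
Sp-mirror {j} f U = Σᵥ-mirror j λ A → f (lin U A)

private
  p-mirror₁ : ∀ s → + 16 - + 4 * s ≡ + 4 * (1ℤ - s) + + 12
  p-mirror₁ = solve-∀
  p-mirror₂ : ∀ s → + 16 - (+ 4 * s + + 12) ≡ + 4 * (1ℤ - s)
  p-mirror₂ = solve-∀

-- Corresponds to the complementary class: a line sum 4s + 12χ becomes 16 - 4s - 12χ = 4(1 - s) +
-- 12(1 - χ).
mirror : ∀ {m} {f : Vecs m → ℤ} {s} → CL f s → CL (λ x → 1ℤ - f x) (1ℤ - s)
mirror {f = f} {s} C = record
  { hom = λ c x c≢o → cong (λ t → 1ℤ - t) (hom C c x c≢o)
  ; at-0 = cong (λ t → 1ℤ - t) (at-0 C)
  ; on-line = λ x y ind → lines x y (on-line C x y ind)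
  }
  where
  lines : ∀ x y → Sp (x ∷ y ∷ []) f ≡ + 4 * s ⊎ Sp (x ∷ y ∷ []) f ≡ + 4 * s + + 12 →
          Sp (x ∷ y ∷ []) (λ x → 1ℤ - f x) ≡ + 4 * (1ℤ - s) ⊎
          Sp (x ∷ y ∷ []) (λ x → 1ℤ - f x) ≡ + 4 * (1ℤ - s) + + 12
  lines x y (inj₁ e) = inj₂ (trans (Sp-mirror f (x ∷ y ∷ [])) (trans (cong (λ t → + 16 - t) e) (p-mirror₁ s)))
  lines x y (inj₂ e) = inj₁ (trans (Sp-mirror f (x ∷ y ∷ [])) (trans (cong (λ t → + 16 - t) e) (p-mirror₂ s)))

mirror-Bit : ∀ {s} → Bit s → Bit (1ℤ - s)
mirror-Bit (inj₁ refl) = inj₂ refl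
mirror-Bit (inj₂ refl) = inj₁ refl

-- Sums of subspaces from their pencils

Σℕ₄ : (GF4 → ℕ) → ℕ
Σℕ₄ n = n o ℕ.+ (n i ℕ.+ (n w ℕ.+ n w²))

Σℕ₄-mono : ∀ {m n : GF4 → ℕ} → (∀ c → m c ≤ n c) → Σℕ₄ m ≤ Σℕ₄ n
Σℕ₄-mono h = ℕₚ.+-mono-≤ (h o) (ℕₚ.+-mono-≤ (h i) (ℕₚ.+-mono-≤ (h w) (h w²)))

Σℕ₄-≤ : ∀ (n : GF4 → ℕ) c → n c ≤ Σℕ₄ n
Σℕ₄-≤ n o = ℕₚ.m≤m+n (n o) _
Σℕ₄-≤ n i = ℕₚ.≤-trans (ℕₚ.m≤m+n (n i) _) (ℕₚ.m≤n+m _ (n o))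
Σℕ₄-≤ n w = ℕₚ.≤-trans (ℕₚ.m≤m+n (n w) _) (ℕₚ.≤-trans (ℕₚ.m≤n+m _ (n i)) (ℕₚ.m≤n+m _ (n o)))
Σℕ₄-≤ n w² = ℕₚ.≤-trans (ℕₚ.m≤n+m (n w²) (n w)) (ℕₚ.≤-trans (ℕₚ.m≤n+m _ (n i)) (ℕₚ.m≤n+m _ (n o)))

Σℕ₄-zero : ∀ (n : GF4 → ℕ) → Σℕ₄ n ≡ 0 → ∀ c → n c ≡ 0
Σℕ₄-zero n e c = ℕₚ.n≤0⇒n≡0 (subst (n c ≤_) e (Σℕ₄-≤ n c))

Sp-point : ∀ {m} {φ : Vecs m → ℤ} {z} → φ 0ᵥ ≡ z → ∀ u → (∀ c → c ≢ o → φ (c ·ᵥ u) ≡ φ u) →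
           Sp (u ∷ []) φ ≡ z + + 3 * φ u
Sp-point {φ = φ} {z} e u h = trans (Sp₁ u φ) (trans (cong₂ _+_ (val o (trans (cong φ (·ᵥ-zeroˡ u)) e))
    (cong₂ _+_ (val i (h i λ ())) (cong₂ _+_ (val w (h w λ ())) (val w² (h w² λ ())))))
  (p z (φ u)))
  where
  val : ∀ a {y} → φ (a ·ᵥ u) ≡ y → φ ((a ·ᵥ u) +ᵥ 0ᵥ) ≡ y
  val a e = trans (cong φ (+ᵥ-identityʳ (a ·ᵥ u))) e
  p : ∀ z x → z + (x + (x + x)) ≡ z + + 3 * x
  p = solve-∀

point-value : ∀ {m} {f : Vecs m → ℤ} {s} → CL f s → ∀ u → Sp (u ∷ []) f ≡ s + + 3 * f u
point-value C u = Sp-point (at-0 C) u λ c → hom C c u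

private
  transport : ∀ {P C A : ℤ} {B : GF4 → ℤ} C' A' (B' : GF4 → ℤ) → P + + 4 * C ≡ A + Σ₄ B →
              C ≡ C' → A ≡ A' → (∀ c → B c ≡ B' c) → P ≡ A' + Σ₄ B' - + 4 * C'
  transport {P} {C} {A} {B} C' A' B' e refl refl h =
    trans (p P (+ 4 * C)) (cong (_- + 4 * C) (trans e (+-congʳ A (Σ₄-cong h))))
    where
    p : ∀ P D → P ≡ (P + D) - D
    p = solve-∀
  p-plane : ∀ s g a b c d e → (+ 4 * s + + 12 * a) + ((+ 4 * s + + 12 * b) + ((+ 4 * s + + 12 * c)
            + ((+ 4 * s + + 12 * d) + (+ 4 * s + + 12 * e)))) - + 4 * (s + + 3 * g)
          ≡ + 16 * s + + 12 * ((a + (b + (c + (d + e)))) - g)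
  p-plane = solve-∀
  p-solid : ∀ s g a b c d e → (+ 16 * s + + 12 * a) + ((+ 16 * s + + 12 * b) + ((+ 16 * s + + 12 * c)
            + ((+ 16 * s + + 12 * d) + (+ 16 * s + + 12 * e)))) - + 4 * (+ 4 * s + + 12 * g)
          ≡ + 64 * s + + 12 * ((a + (b + (c + (d + e)))) - + 4 * g)
  p-solid = solve-∀
  p-four : ∀ s g a b c d e → (+ 64 * s + + 12 * a) + ((+ 64 * s + + 12 * b) + ((+ 64 * s + + 12 * c)
            + ((+ 64 * s + + 12 * d) + (+ 64 * s + + 12 * e)))) - + 4 * (+ 16 * s + + 12 * g)
          ≡ + 256 * s + + 12 * ((a + (b + (c + (d + e)))) - + 4 * g)
  p-four = solve-∀

-- The number of lines of the class on `u` in the plane of `v`, `x`, `u`: these five lines join `u`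
-- to `x` and to the vectors v + c x.
pencil-count : ∀ {m} (f : Vecs m → ℤ) (s : ℤ) (v x u : Vecs m) → ℕ
pencil-count f s v x u = X f s x u ℕ.+ Σℕ₄ λ c → X f s (v +ᵥ (c ·ᵥ x)) u

pencil-count≤5 : ∀ {m} (f : Vecs m → ℤ) s v x u → pencil-count f s v x u ≤ 5
pencil-count≤5 f s v x u = ℕₚ.+-mono-≤ (X≤1 f s x u) (Σℕ₄-mono λ c → X≤1 f s (v +ᵥ (c ·ᵥ x)) u)

-- The five lines on `u` cover the plane and overlap in the multiples of `u`. As the sum of the
-- plane does not depend on `u`, the value f u is the number of lines of the class on `u` in the
-- plane minus a constant of the plane; most bounds on values rest on this.
plane-value : ∀ {m} {f : Vecs m → ℤ} {s} → CL f s → ∀ v x u → Indep (v ∷ x ∷ u ∷ []) →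
              Sp (v ∷ x ∷ u ∷ []) f ≡ + 16 * s + + 12 * (+ pencil-count f s v x u - f u)
plane-value {f = f} {s} C v x u ind = trans
  (transport (s + + 3 * f u) (+ 4 * s + + 12 * + X f s x u) (λ c → + 4 * s + + 12 * + X f s (v +ᵥ (c ·ᵥ x)) u)
    (Sp-pencil v x (u ∷ []) f) (point-value C u) (line-value C (Indep-tail ind))
    (λ c → line-value C (Indep-pencil c ind)))
  (p-plane s (f u) (+ X f s x u) (+ x' o) (+ x' i) (+ x' w) (+ x' w²))
  where
  x' : GF4 → ℕ
  x' c = X f s (v +ᵥ (c ·ᵥ x)) u

-- The five planes on the line of `x` and `u` count the parameter of that line four times too often.
solid-value : ∀ {m} {f : Vecs m → ℤ} {s} → CL f s → ∀ t v x u → Indep (t ∷ v ∷ x ∷ u ∷ []) →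
  ∀ k (ks : GF4 → ℤ) → Sp (v ∷ x ∷ u ∷ []) f ≡ + 16 * s + + 12 * k →
  (∀ c → Sp ((t +ᵥ (c ·ᵥ v)) ∷ x ∷ u ∷ []) f ≡ + 16 * s + + 12 * ks c) →
  Sp (t ∷ v ∷ x ∷ u ∷ []) f ≡ + 64 * s + + 12 * ((k + Σ₄ ks) - + 4 * + X f s x u)
solid-value {f = f} {s} C t v x u ind k ks h hs = trans
  (transport (+ 4 * s + + 12 * + X f s x u) (+ 16 * s + + 12 * k) (λ c → + 16 * s + + 12 * ks c)
    (Sp-pencil t v (x ∷ u ∷ []) f) (line-value C (Indep-tail (Indep-tail ind))) h hs)
  (p-solid s (+ X f s x u) k (ks o) (ks i) (ks w) (ks w²))

four-value : ∀ {m} (f : Vecs m → ℤ) s t r v x u y (ys : GF4 → ℤ) k →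
  Sp (v ∷ x ∷ u ∷ []) f ≡ + 16 * s + + 12 * k →
  Sp (r ∷ v ∷ x ∷ u ∷ []) f ≡ + 64 * s + + 12 * y →
  (∀ c → Sp ((t +ᵥ (c ·ᵥ r)) ∷ v ∷ x ∷ u ∷ []) f ≡ + 64 * s + + 12 * ys c) →
  Sp (t ∷ r ∷ v ∷ x ∷ u ∷ []) f ≡ + 256 * s + + 12 * ((y + Σ₄ ys) - + 4 * k)
four-value f s t r v x u y ys k hk h hs = trans
  (transport (+ 16 * s + + 12 * k) (+ 64 * s + + 12 * y) (λ c → + 64 * s + + 12 * ys c)
    (Sp-pencil t r (v ∷ x ∷ u ∷ []) f) hk h hs)
  (p-four s k y (ys o) (ys i) (ys w) (ys w²))

-- Weights of points and subspaces

wt : ℤ → ℕ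
wt (+ zero) = 0
wt (+ suc n) = suc n ℕ.* n
wt -[1+ n ] = suc n ℕ.* suc (suc n)

weight≡wt : ∀ z → weight z ≡ + wt z
weight≡wt (+ zero) = refl
weight≡wt (+ suc n) = sym (ℤₚ.pos-* (suc n) n)
weight≡wt -[1+ n ] = cong (λ k → + (suc n ℕ.* suc (suc k))) (ℕₚ.+-identityʳ n)

weight-nonneg : ∀ z → 0ℤ ≤ℤ weight z
weight-nonneg z = subst (0ℤ ≤ℤ_) (sym (weight≡wt z)) (+≤+ z≤n)

wf : ∀ {m} → (Vecs m → ℤ) → Vecs m → ℤ
wf f x = weight (f x)

Sp-weight-nonneg : ∀ {j m} (U : Vec (Vecs m) j) (f : Vecs m → ℤ) → 0ℤ ≤ℤ Sp U (wf f)
Sp-weight-nonneg {j} U f = subst (_≤ℤ Sp U (wf f)) (Σᵥ-zero j λ _ → refl)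
  (Σᵥ-mono j λ A → weight-nonneg (f (lin U A)))

weight-Bit : ∀ {s} → Bit s → weight s ≡ 0ℤ
weight-Bit (inj₁ refl) = refl
weight-Bit (inj₂ refl) = refl

-- For s in {0, 1} the zero vector has weight 0; the factor 3 counts the nonzero multiples of `u`.
point-weight : ∀ {m} {f : Vecs m → ℤ} {s} → CL f s → Bit s → ∀ u → Sp (u ∷ []) (wf f) ≡ + 3 * weight (f u)
point-weight C bit u = trans (Sp-point (trans (cong weight (at-0 C)) (weight-Bit bit)) u
    λ c c≢o → cong weight (hom C c u c≢o)) (ℤₚ.+-identityˡ _)

line-weight : ∀ {m} {f : Vecs m → ℤ} {s} → CL f s → Bit s → ∀ x u →
              Sp (x ∷ u ∷ []) (wf f) ≡ + (3 ℕ.* (wt (f u) ℕ.+ Σℕ₄ λ c → wt (f (x +ᵥ (c ·ᵥ u)))))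
line-weight {f = f} {s} C bit x u = trans
  (transport 0ℤ (+ 3 * + wt (f u)) (λ c → + 3 * + n c) (Sp-pencil x u [] (wf f))
    (trans (Sp₀ (wf f)) (trans (cong weight (at-0 C)) (weight-Bit bit))) (pt u) (λ c → pt (x +ᵥ (c ·ᵥ u))))
  (trans (p (+ wt (f u)) (+ n o) (+ n i) (+ n w) (+ n w²)) (sym (ℤₚ.pos-* 3 (wt (f u) ℕ.+ Σℕ₄ n))))
  where
  n : GF4 → ℕ
  n c = wt (f (x +ᵥ (c ·ᵥ u)))
  pt : ∀ v → Sp (v ∷ []) (wf f) ≡ + 3 * + wt (f v)
  pt v = trans (point-weight C bit v) (cong (λ t → + 3 * t) (weight≡wt (f v)))
  p : ∀ a b c d e → + 3 * a + (+ 3 * b + (+ 3 * c + (+ 3 * d + + 3 * e))) - 0ℤ ≡ + 3 * (a + (b + (c + (d + e))))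
  p = solve-∀

module _ {m j} {f : Vecs m → ℤ} {s} (C : CL f s) {U : Vec (Vecs m) j} (iU : Indep U) where
  private
    D : CL (λ A → f (lin U A)) s
    D = pull C iU

  weight-identity : ∀ r k → pow4 j ≡ + 16 * r → Sp U f ≡ + 4 * r * s + + 12 * k →
    + 5 * ((r - 1ℤ) * Sp U (wf f)) ≡ + 4 * ((r * r - 1ℤ) * (s * (s - 1ℤ))) + + 180 * (k * (r - k))
  weight-identity = Quadratic.quadratic-reduced j (λ A → f (lin U A)) s (hom D) (at-0 D) (two-valued D)

private
  p-scaled-plane : ∀ y → + 4 * (+ 15 * 0ℤ) + + 180 * y ≡ + 15 * (+ 12 * y)
  p-scaled-plane = solve-∀
  p-scaled-solid : ∀ z y → + 4 * (+ 255 * z) + + 180 * y ≡ + 15 * (+ 68 * z + + 12 * y)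
  p-scaled-solid = solve-∀
  p-scaled-four : ∀ y → + 4 * (+ 4095 * 0ℤ) + + 180 * y ≡ + 45 * (+ 4 * y)
  p-scaled-four = solve-∀
  p-15 : ∀ W → + 5 * (+ 3 * W) ≡ + 15 * W
  p-15 = solve-∀
  p-75 : ∀ W → + 5 * (+ 15 * W) ≡ + 15 * (+ 5 * W)
  p-75 = solve-∀
  p-315 : ∀ W → + 5 * (+ 63 * W) ≡ + 45 * (+ 7 * W)
  p-315 = solve-∀

plane-weight : ∀ {m} {f : Vecs m → ℤ} {s} → CL f s → Bit s → {U : Vec (Vecs m) 3} → Indep U →
               ∀ k → Sp U f ≡ + 16 * s + + 12 * k → Sp U (wf f) ≡ + 12 * (k * (+ 4 - k))
plane-weight {f = f} {s} C bit {U} iU k e = ℤₚ.*-cancelˡ-≡ (+ 15) (Sp U (wf f)) (+ 12 * (k * (+ 4 - k)))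
  (trans (sym (p-15 (Sp U (wf f)))) (trans (weight-identity C iU (+ 4) k refl e)
  (trans (cong (λ t → + 4 * (+ 15 * t) + + 180 * (k * (+ 4 - k))) (weight-Bit bit))
    (p-scaled-plane (k * (+ 4 - k))))))

-- Stated for arbitrary `s`, because its divisibility by 5 is what later forces `s` to be 0 or 1
-- modulo 5.
solid-weight : ∀ {m} {f : Vecs m → ℤ} {s} → CL f s → {U : Vec (Vecs m) 4} → Indep U →
               ∀ k → Sp U f ≡ + 64 * s + + 12 * k →
               + 5 * Sp U (wf f) ≡ + 68 * weight s + + 12 * (k * (+ 16 - k))
solid-weight {f = f} {s} C {U} iU k e = ℤₚ.*-cancelˡ-≡ (+ 15) (+ 5 * Sp U (wf f))
  (+ 68 * weight s + + 12 * (k * (+ 16 - k)))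
  (trans (sym (p-75 (Sp U (wf f)))) (trans (weight-identity C iU (+ 16) k refl e)
    (p-scaled-solid (weight s) (k * (+ 16 - k)))))

-- The factor 7 comes from r - 1 = 63 and restricts the parameter of a 4-space.
four-weight : ∀ {m} {f : Vecs m → ℤ} {s} → CL f s → Bit s → {U : Vec (Vecs m) 5} → Indep U →
              ∀ k → Sp U f ≡ + 256 * s + + 12 * k → + 7 * Sp U (wf f) ≡ + 4 * (k * (+ 64 - k))
four-weight {f = f} {s} C bit {U} iU k e = ℤₚ.*-cancelˡ-≡ (+ 45) (+ 7 * Sp U (wf f)) (+ 4 * (k * (+ 64 - k)))
  (trans (sym (p-315 (Sp U (wf f)))) (trans (weight-identity C iU (+ 64) k refl e)
  (trans (cong (λ t → + 4 * (+ 4095 * t) + + 180 * (k * (+ 64 - k))) (weight-Bit bit))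
    (p-scaled-four (k * (+ 64 - k))))))

-- The divisibility test is run by the type checker, so an impossible residue is dismissed by naming
-- the two numbers.
indivisible : ∀ {A : Set} m n {m∤n : False (m ∣? n)} → ∀ z → + m * z ≡ + n → A
indivisible m n {m∤n} z e = ⊥-elim (toWitnessFalse m∤n (divides ℤ.∣ z ∣ (trans (sym (cong ℤ.∣_∣ e))
  (trans (ℤₚ.abs-* (+ m) z) (ℕₚ.*-comm m ℤ.∣ z ∣)))))

-- Outside 0, ..., 4 the product k (4 - k) is negative, whereas a total weight is not.
k-range : ∀ k → 0ℤ ≤ℤ + 12 * (k * (+ 4 - k)) → ∃[ n ] k ≡ + n × n ≤ 4
k-range (+ 0) _ = 0 , refl , z≤n
k-range (+ 1) _ = 1 , refl , s≤s z≤n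
k-range (+ 2) _ = 2 , refl , s≤s (s≤s z≤n)
k-range (+ 3) _ = 3 , refl , s≤s (s≤s (s≤s z≤n))
k-range (+ 4) _ = 4 , refl , s≤s (s≤s (s≤s (s≤s z≤n)))
k-range (+ suc (suc (suc (suc (suc n))))) ()
k-range -[1+ n ] ()

cancel-value : ∀ a s {x y} → + a * s + + 12 * x ≡ + a * s + + 12 * y → x ≡ y
cancel-value a s {x} {y} e = ℤₚ.*-cancelˡ-≡ (+ 12) x y (trans (sym (p (+ a * s) (+ 12 * x)))
  (trans (cong (λ t → t - + a * s) e) (p (+ a * s) (+ 12 * y))))
  where
  p : ∀ z x → z + x - z ≡ x
  p = solve-∀

nonzero-value : ∀ {m} {f : Vecs m → ℤ} {s} → CL f s → Bit s → ∀ {x} → f x ≢ 0ℤ → f x ≢ 1ℤ → x ≢ 0ᵥ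
nonzero-value C (inj₁ refl) n₀ n₁ refl = n₀ (at-0 C)
nonzero-value C (inj₂ refl) n₀ n₁ refl = n₁ (at-0 C)

negative-nonzero : ∀ {m} {f : Vecs m → ℤ} {s} → CL f s → Bit s → ∀ {x n} → f x ≡ -[1+ n ] → x ≢ 0ᵥ
negative-nonzero C bit {x} e = nonzero-value C bit (λ e' → contradiction (trans (sym e) e') λ ())
  (λ e' → contradiction (trans (sym e) e') λ ())

-- Moves a given point of the subspace to the end of a basis, the place from which the counting
-- lemmas read its value.
rebase₂ : ∀ {m} {U : Vec (Vecs m) 2} → Indep U → ∀ {A} → A ≢ 0ᵥ →
          ∃[ x ] Indep (x ∷ lin U A ∷ []) × (∀ φ → Sp U φ ≡ Sp (x ∷ lin U A ∷ []) φ)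
rebase₂ {U = U} iU A≢0 with Indep-extend (Indep-single A≢0) (s≤s (s≤s z≤n))
... | B , ind = lin U B , Indep-map iU ind , λ φ →
      trans (sym (Sp-basis ind (λ A → φ (lin U A)))) (sym (Sp-map U (B ∷ _ ∷ []) φ))

rebase₃ : ∀ {m} {U : Vec (Vecs m) 3} → Indep U → ∀ {A} → A ≢ 0ᵥ →
          ∃[ v ] ∃[ x ] Indep (v ∷ x ∷ lin U A ∷ []) × (∀ φ → Sp U φ ≡ Sp (v ∷ x ∷ lin U A ∷ []) φ)
rebase₃ {U = U} iU A≢0 with Indep-extend (Indep-single A≢0) (s≤s (s≤s z≤n))
... | B , ind₂ with Indep-extend ind₂ (s≤s (s≤s (s≤s z≤n)))
...   | D , ind = lin U D , lin U B , Indep-map iU ind , λ φ →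
        trans (sym (Sp-basis ind (λ A → φ (lin U A)))) (sym (Sp-map U (D ∷ B ∷ _ ∷ []) φ))

small-sum : ∀ (n : GF4 → ℕ) → Σℕ₄ n ≡ 2 → (∃[ c ] n c ≡ 0) × (∀ c → n c ≤ 2)
small-sum n e = zero-term , λ c → subst (n c ≤_) e (Σℕ₄-≤ n c)
  where
  positive : ∀ {a} → a ≢ 0 → 1 ≤ a
  positive {zero} h = ⊥-elim (h refl)
  positive {suc a} h = s≤s z≤n
  zero-term : ∃[ c ] n c ≡ 0
  zero-term with n o ℕₚ.≟ 0 | n i ℕₚ.≟ 0 | n w ℕₚ.≟ 0
  ... | yes e₀ | _ | _ = o , e₀
  ... | no _ | yes e₁ | _ = i , e₁
  ... | no _ | no _ | yes e₂ = w , e₂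
  ... | no n₀ | no n₁ | no n₂ = ⊥-elim (ℕₚ.<⇒≱ (s≤s (s≤s (s≤s z≤n))) (subst (3 ≤_) e
        (ℕₚ.+-mono-≤ (positive n₀) (ℕₚ.+-mono-≤ (positive n₁) (ℕₚ.+-mono-≤ (positive n₂) (z≤n {n w²}))))))

-- The integers of weight at most 2 are -1, 0, 1 and 2, and among them only -1 lies below its own
-- weight.
wt≤2⇒ : ∀ z → wt z ≤ 2 → z ≢ -1ℤ → weight z ≤ℤ z
wt≤2⇒ (+ 0) _ _ = +≤+ z≤n
wt≤2⇒ (+ 1) _ _ = +≤+ z≤n
wt≤2⇒ (+ 2) _ _ = ℤₚ.≤-refl
wt≤2⇒ (+ suc (suc (suc n))) h _ = ⊥-elim (ℕₚ.<⇒≱ (ℕₚ.m≤m+n 3 3) (ℕₚ.≤-trans (p n) h))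
  where
  p : ∀ n → 6 ≤ suc (suc (suc n)) ℕ.* suc (suc n)
  p n = ℕₚ.*-mono-≤ (ℕₚ.m≤m+n 3 n) (ℕₚ.m≤m+n 2 n)
wt≤2⇒ -[1+ zero ] _ n = ⊥-elim (n refl)
wt≤2⇒ -[1+ suc n ] h _ = ⊥-elim (ℕₚ.<⇒≱ (ℕₚ.m≤m+n 3 3) (ℕₚ.≤-trans (p n) h))
  where
  p : ∀ n → 6 ≤ suc (suc n) ℕ.* suc (suc (suc n))
  p n = ℕₚ.*-mono-≤ (ℕₚ.m≤m+n 2 n) (ℕₚ.m≤m+n 3 n)

plane-at : ∀ {m} {f : Vecs m → ℤ} {s} → CL f s → ∀ v x u d → Indep (v ∷ x ∷ u ∷ []) → f u ≡ - + d →
           Sp (v ∷ x ∷ u ∷ []) f ≡ + 16 * s + + 12 * + (pencil-count f s v x u ℕ.+ d)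
plane-at {f = f} {s} C v x u d ind e = trans (plane-value C v x u ind)
  (cong (λ t → + 16 * s + + 12 * (+ pencil-count f s v x u + t)) (trans (cong -_ e) (ℤₚ.neg-involutive (+ d))))

-- The five constants -33 add up to -165, which is not a multiple of 9.
modulo-9 : ∀ r a (b : GF4 → ℤ) → + 36 * r ≡ (+ 9 * a - + 33) + Σ₄ (λ c → + 9 * b c - + 33) → ⊥
modulo-9 r a b e = indivisible 9 165 ((a + Σ₄ b) - + 4 * r)
  (trans (p r a (b o) (b i) (b w) (b w²))
    (trans (cong (λ z → (z + + 165) - + 36 * r) (sym e)) (p' (+ 36 * r))))
  where
  p : ∀ r a b c d e → + 9 * ((a + (b + (c + (d + e)))) - + 4 * r)
    ≡ (((+ 9 * a - + 33) + ((+ 9 * b - + 33) + ((+ 9 * c - + 33) + ((+ 9 * d - + 33) + (+ 9 * e - + 33))))) + + 165) - + 36 * r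
  p = solve-∀
  p' : ∀ z → (z + + 165) - z ≡ + 165
  p' = solve-∀

-- A solid of parameter 5 takes no value −1.  All planes through a point of value −1 have
-- k = 1, so each line through it has weight 12, and the weight of every plane is a
-- multiple of 36.  Counting planes through a line and then lines through a point of weight 0
-- gives a contradiction modulo 9.
module Solid {f : Vecs 4 → ℤ} {s : ℤ} (C : CL f s) (bit : Bit s)
             (sum-f : Σᵥ 4 f ≡ + 64 * s + + 60) where

  private
    extend₂ : ∀ {v u : Vecs 4} → Indep (v ∷ u ∷ []) → ∃[ t ] ∃[ r ] Indep (t ∷ r ∷ v ∷ u ∷ [])
    extend₂ ind with Indep-extend ind (s≤s (s≤s (s≤s z≤n)))
    ... | r , ind₃ with Indep-extend ind₃ (s≤s (s≤s (s≤s (s≤s z≤n))))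
    ...   | t , ind₄ = t , r , ind₄

    sum-w : ∀ {U : Vec (Vecs 4) 4} → Indep U → Sp U (wf f) ≡ + 132
    sum-w {U} ind = ℤₚ.*-cancelˡ-≡ (+ 5) (Sp U (wf f)) (+ 132)
      (trans (solid-weight C ind (+ 5) (trans (Sp-basis ind f) sum-f))
        (cong (λ t → + 68 * t + + 660) (weight-Bit bit)))

    p-minus-four : ∀ n → + n - + 4 ≡ + 5 → n ≡ 9
    p-minus-four n e = ℤₚ.+-injective (trans (sym (p (+ n))) (cong (λ t → t + + 4) e))
      where
      p : ∀ z → z - + 4 + + 4 ≡ z
      p = solve-∀

  -- If the line were in the class, each of the five planes on it would have parameter at least 1 +
  -- 1, but these parameters add up to 5 + 4 = 9.
  no-line : ∀ {P} → f P ≡ -1ℤ → ∀ v → Indep (v ∷ P ∷ []) → X f s v P ≡ 0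
  no-line {P} e v ind with X-bit f s v P
  ... | inj₁ x0 = x0
  ... | inj₂ x1 with extend₂ ind
  ...   | t , r , ind₄ = ⊥-elim (ℕₚ.<⇒≱ (ℕₚ.≤-refl {10}) (subst (10 ≤_) nine ten))
    where
    k : ℕ
    k = pencil-count f s r v P ℕ.+ 1
    ks : GF4 → ℕ
    ks c = pencil-count f s (t +ᵥ (c ·ᵥ r)) v P ℕ.+ 1
    two : ∀ y → 2 ≤ pencil-count f s y v P ℕ.+ 1
    two y = ℕₚ.+-mono-≤ (ℕₚ.≤-trans (ℕₚ.≤-reflexive (sym x1)) (ℕₚ.m≤m+n (X f s v P) _)) (ℕₚ.≤-refl {1})
    ten : 10 ≤ k ℕ.+ Σℕ₄ ks
    ten = ℕₚ.+-mono-≤ (two r) (Σℕ₄-mono {λ _ → 2} λ c → two (t +ᵥ (c ·ᵥ r)))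
    value : + (k ℕ.+ Σℕ₄ ks) - + 4 * + X f s v P ≡ + 5
    value = cancel-value 64 s (trans (sym (solid-value C t r v P ind₄ (+ k) (λ c → + ks c)
        (plane-at C r v P 1 (Indep-tail ind₄) e)
        (λ c → plane-at C (t +ᵥ (c ·ᵥ r)) v P 1 (Indep-pencil c ind₄) e)))
      (trans (Sp-basis ind₄ f) sum-f))
    nine : k ℕ.+ Σℕ₄ ks ≡ 9
    nine = p-minus-four (k ℕ.+ Σℕ₄ ks)
      (trans (cong (λ t → + (k ℕ.+ Σℕ₄ ks) - + 4 * + t) (sym x1)) value)

  plane-through : ∀ {P} → f P ≡ -1ℤ → ∀ v x → Indep (v ∷ x ∷ P ∷ []) →
                  Sp (v ∷ x ∷ P ∷ []) f ≡ + 16 * s + + 12 * 1ℤ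
  plane-through {P} e v x ind = trans (plane-at C v x P 1 ind e)
    (cong (λ t → + 16 * s + + 12 * + (t ℕ.+ 1)) count)
    where
    nl : ∀ y → Indep (y ∷ P ∷ []) → X f s y P ≡ 0
    nl = no-line e
    at : ∀ c → X f s (v +ᵥ (c ·ᵥ x)) P ≡ 0
    at c = nl _ (Indep-pencil c ind)
    count : pencil-count f s v x P ≡ 0
    count = cong₂ ℕ._+_ (nl x (Indep-tail ind))
      (cong₂ ℕ._+_ (at o) (cong₂ ℕ._+_ (at i) (cong₂ ℕ._+_ (at w) (at w²))))

  -- The solid has weight 132 and the five planes on the line have weight 36 each, so the line has
  -- weight (180 - 132) / 4 = 12. Divided by 3, this leaves point weights of total 4, of which `P`
  -- takes 2.
  line-through : ∀ {P} → f P ≡ -1ℤ → ∀ x → Indep (x ∷ P ∷ []) →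
                 Σℕ₄ (λ c → wt (f (x +ᵥ (c ·ᵥ P)))) ≡ 2
  line-through {P} e x ind with extend₂ ind
  ... | t , r , ind₄ = three (Σℕ₄ λ c → wt (f (x +ᵥ (c ·ᵥ P)))) (ℤₚ.+-injective
      (trans (trans (cong (λ z → + (3 ℕ.* (wt z ℕ.+ Σℕ₄ λ c → wt (f (x +ᵥ (c ·ᵥ P)))))) (sym e))
        (sym (line-weight C bit x P))) line))
    where
    W : ∀ v → Indep (v ∷ x ∷ P ∷ []) → Sp (v ∷ x ∷ P ∷ []) (wf f) ≡ + 36
    W v ind₃ = plane-weight C bit ind₃ 1ℤ (plane-through e v x ind₃)
    L : ℤ
    L = Sp (x ∷ P ∷ []) (wf f)
    pencil : + 132 + + 4 * L ≡ + 180
    pencil = trans (cong (_+ + 4 * L) (sym (sum-w ind₄))) (trans (Sp-pencil t r (x ∷ P ∷ []) (wf f))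
      (cong₂ _+_ (W r (Indep-tail ind₄)) (Σ₄-cong {g = λ _ → + 36} λ c → W _ (Indep-pencil c ind₄))))
    line : L ≡ + 12
    line = ℤₚ.*-cancelˡ-≡ (+ 4) L (+ 12) (trans (p (+ 4 * L)) (cong (λ z → z - + 132) pencil))
      where
      p : ∀ z → z ≡ + 132 + z - + 132
      p = solve-∀
    three : ∀ n → 3 ℕ.* (2 ℕ.+ n) ≡ 12 → n ≡ 2
    three n h = ℕₚ.+-cancelˡ-≡ 2 n 2 (ℕₚ.*-cancelˡ-≡ (2 ℕ.+ n) 4 3 h)

  module At {P : Vecs 4} (e : f P ≡ -1ℤ) where
    private
      iP : Indep (P ∷ [])
      iP = Indep-single (negative-nonzero C bit e)

    wt≤2 : ∀ x → x ≢ 0ᵥ → wt (f x) ≤ 2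
    wt≤2 x x≢0 with inSpan? (P ∷ []) x
    ... | inj₂ n = subst (λ y → wt (f y) ≤ 2) (trans (cong (x +ᵥ_) (·ᵥ-zeroˡ P)) (+ᵥ-identityʳ x))
          (proj₂ (small-sum (λ c → wt (f (x +ᵥ (c ·ᵥ P)))) (line-through e x (Indep-∷ iP n))) o)
    ... | inj₁ (c ∷ [] , refl) with c ≟₄ o
    ...   | inj₁ refl = ⊥-elim (x≢0 (trans (+ᵥ-identityʳ _) (·ᵥ-zeroˡ P)))
    ...   | inj₂ c≢o = subst (λ z → wt z ≤ 2)
            (sym (trans (cong f (+ᵥ-identityʳ _)) (trans (hom C c P c≢o) e))) ℕₚ.≤-refl

    value≥weight : ∀ x → f x ≢ -1ℤ → weight (f x) ≤ℤ f x
    value≥weight x n with x ≟ᵥ 0ᵥ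
    ... | inj₂ x≢0 = wt≤2⇒ (f x) (wt≤2 x x≢0) n
    ... | inj₁ refl = subst (λ z → weight z ≤ℤ z) (sym (at-0 C)) (at bit)
      where
      at : ∀ {s} → Bit s → weight s ≤ℤ s
      at (inj₁ refl) = ℤₚ.≤-refl
      at (inj₂ refl) = +≤+ z≤n

    isMinusOne : ℤ → Bool
    isMinusOne -[1+ 0 ] = true
    isMinusOne _ = false

    isMinusOne-sound : ∀ z → isMinusOne z ≡ true → z ≡ -1ℤ
    isMinusOne-sound -[1+ zero ] _ = refl

    -- The weight 12 k (4 - k) is 0 or 36 except for k = 2.
    plane-weight-36 : ∀ U → Indep U → ∃[ r ] Sp {j = 3} U (wf f) ≡ + 36 * r
    plane-weight-36 U@(v ∷ x ∷ u ∷ []) ind = go k-bound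
      where
      k : ℤ
      k = + pencil-count f s v x u - f u
      F-value : Sp U f ≡ + 16 * s + + 12 * k
      F-value = plane-value C v x u ind
      W-value : Sp U (wf f) ≡ + 12 * (k * (+ 4 - k))
      W-value = plane-weight C bit ind k F-value
      k-bound : ∃[ n ] k ≡ + n × n ≤ 4
      k-bound = k-range k (subst (0ℤ ≤ℤ_) W-value (Sp-weight-nonneg U f))
      -- A plane with k = 2 contains no value -1, since such values force k = 1. Then no weight on
      -- it exceeds the value, although the total weight is 48 and the sum of values 16s + 24 is at
      -- most 40.
      no-two : k ≡ + 2 → ⊥
      no-two k2 with search 3 (λ A → isMinusOne (f (lin U A)))
      ... | inj₁ (A , h) = contra (rebase₃ ind A≢0)
        where
        fA : f (lin U A) ≡ -1ℤ
        fA = isMinusOne-sound _ h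
        A≢0 : A ≢ 0ᵥ
        A≢0 A0 = negative-nonzero C bit fA (trans (cong (lin U) A0) (lin-0 U))
        contra : ∃[ v ] ∃[ x ] Indep (v ∷ x ∷ lin U A ∷ []) × (∀ φ → Sp U φ ≡ Sp (v ∷ x ∷ lin U A ∷ []) φ) → ⊥
        contra (v' , x' , ind' , same) = contradiction (cancel-value 16 s {1ℤ} {+ 2}
          (trans (sym (plane-through fA v' x' ind')) (trans (sym (same f)) (trans F-value
            (cong (λ t → + 16 * s + + 12 * t) k2))))) λ ()
      ... | inj₂ none = contra bit (subst₂ _≤ℤ_ (trans W-value (cong (λ t → + 12 * (t * (+ 4 - t))) k2))
            (trans F-value (cong (λ t → + 16 * s + + 12 * t) k2))
            (Σᵥ-mono 3 λ A → value≥weight (lin U A) λ h → contradiction (trans (sym (none A)) (cong isMinusOne h)) λ ()))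
        where
        le : ∀ {a b} → + a ≤ℤ + b → a ≤ b
        le (+≤+ h) = h
        contra : ∀ {s} → Bit s → + 48 ≤ℤ + 16 * s + + 24 → ⊥
        contra (inj₁ refl) h = ℕₚ.<⇒≱ (ℕₚ.m≤m+n 25 23) (le h)
        contra (inj₂ refl) h = ℕₚ.<⇒≱ (ℕₚ.m≤m+n 41 7) (le h)
      go : ∃[ n ] k ≡ + n × n ≤ 4 → ∃[ r ] Sp U (wf f) ≡ + 36 * r
      go (0 , e , _) = 0ℤ , trans W-value (cong (λ t → + 12 * (t * (+ 4 - t))) e)
      go (1 , e , _) = 1ℤ , trans W-value (cong (λ t → + 12 * (t * (+ 4 - t))) e)
      go (2 , e , _) = ⊥-elim (no-two e)
      go (3 , e , _) = 1ℤ , trans W-value (cong (λ t → + 12 * (t * (+ 4 - t))) e)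
      go (4 , e , _) = 0ℤ , trans W-value (cong (λ t → + 12 * (t * (+ 4 - t))) e)
      go (suc (suc (suc (suc (suc _)))) , _ , s≤s (s≤s (s≤s (s≤s ()))))

    -- The weights of the five planes on the line add up to a multiple of 36, and they also add up
    -- to 132 plus four times the weight of the line.
    line-weight-9 : ∀ v u → Indep (v ∷ u ∷ []) → ∃[ t ] Sp (v ∷ u ∷ []) (wf f) ≡ + 9 * t - + 33
    line-weight-9 v u ind with extend₂ ind
    ... | t , r , ind₄ = R , ℤₚ.*-cancelˡ-≡ (+ 4) L (+ 9 * R - + 33)
        (trans (p₁ (+ 4 * L)) (trans (cong (λ z → z - + 132) pencil) (p₂ (proj₁ a) (proj₁ (b o)) (proj₁ (b i)) (proj₁ (b w)) (proj₁ (b w²)))))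
      where
      L : ℤ
      L = Sp (v ∷ u ∷ []) (wf f)
      a : ∃[ q ] Sp (r ∷ v ∷ u ∷ []) (wf f) ≡ + 36 * q
      a = plane-weight-36 _ (Indep-tail ind₄)
      b : ∀ c → ∃[ q ] Sp ((t +ᵥ (c ·ᵥ r)) ∷ v ∷ u ∷ []) (wf f) ≡ + 36 * q
      b c = plane-weight-36 _ (Indep-pencil c ind₄)
      R : ℤ
      R = proj₁ a + Σ₄ λ c → proj₁ (b c)
      pencil : + 132 + + 4 * L ≡ + 36 * proj₁ a + Σ₄ λ c → + 36 * proj₁ (b c)
      pencil = trans (cong (_+ + 4 * L) (sym (sum-w ind₄))) (trans (Sp-pencil t r (v ∷ u ∷ []) (wf f))
        (cong₂ _+_ (proj₂ a) (Σ₄-cong λ c → proj₂ (b c))))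
      p₁ : ∀ z → z ≡ + 132 + z - + 132
      p₁ = solve-∀
      p₂ : ∀ a b c d e → + 36 * a + (+ 36 * b + (+ 36 * c + (+ 36 * d + + 36 * e))) - + 132
         ≡ + 4 * (+ 9 * (a + (b + (c + (d + e)))) - + 33)
      p₂ = solve-∀

    zero-point : ∃[ Q ] Indep (Q ∷ []) × wt (f Q) ≡ 0
    zero-point =
      let x , ind = Indep-extend iP (s≤s (s≤s z≤n))
          c , e₀ = proj₁ (small-sum (λ c → wt (f (x +ᵥ (c ·ᵥ P)))) (line-through e x ind))
      in x +ᵥ (c ·ᵥ P) , Indep-pencil c ind , e₀

    no-zero-point : ∀ v y Q → Indep (v ∷ y ∷ Q ∷ []) → wt (f Q) ≡ 0 → ⊥
    no-zero-point v y Q ind₃ wt0 = modulo-9 (proj₁ r) (proj₁ a) (λ c → proj₁ (b c)) pencil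
      where
      r : ∃[ r ] Sp (v ∷ y ∷ Q ∷ []) (wf f) ≡ + 36 * r
      r = plane-weight-36 (v ∷ y ∷ Q ∷ []) ind₃
      a : ∃[ t ] Sp (y ∷ Q ∷ []) (wf f) ≡ + 9 * t - + 33
      a = line-weight-9 y Q (Indep-tail ind₃)
      b : ∀ c → ∃[ t ] Sp ((v +ᵥ (c ·ᵥ y)) ∷ Q ∷ []) (wf f) ≡ + 9 * t - + 33
      b c = line-weight-9 (v +ᵥ (c ·ᵥ y)) Q (Indep-pencil c ind₃)
      W-Q : Sp (Q ∷ []) (wf f) ≡ 0ℤ
      W-Q = trans (point-weight C bit Q) (cong (λ t → + 3 * t) (trans (weight≡wt (f Q)) (cong +_ wt0)))
      pencil : + 36 * proj₁ r ≡ (+ 9 * proj₁ a - + 33) + Σ₄ λ c → + 9 * proj₁ (b c) - + 33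
      pencil = trans (sym (ℤₚ.+-identityʳ (+ 36 * proj₁ r)))
        (trans (cong₂ (λ z z' → z + + 4 * z') (sym (proj₂ r)) (sym W-Q))
        (trans (Sp-pencil v y (Q ∷ []) (wf f)) (cong₂ _+_ (proj₂ a) (Σ₄-cong λ c → proj₂ (b c)))))

    refuted : ⊥
    refuted =
      let Q , ind₁ , wt0 = zero-point
          y , ind₂ = Indep-extend ind₁ (s≤s (s≤s z≤n))
          v , ind₃ = Indep-extend ind₂ (s≤s (s≤s (s≤s z≤n)))
      in no-zero-point v y Q ind₃ wt0

no-minus-one-in-solid : ∀ {f : Vecs 4 → ℤ} {s} → CL f s → Bit s → Σᵥ 4 f ≡ + 64 * s + + 60 →
                        ∀ {P} → f P ≡ -1ℤ → ⊥
no-minus-one-in-solid C bit sum-f e = Solid.At.refuted C bit sum-f e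

-- Points of negative value

Indep-skip₂ : ∀ {j k} {U : Vec (Vecs k) j} {a b y} → Indep (a ∷ b ∷ y ∷ U) → Indep (a ∷ b ∷ U)
Indep-skip₂ {U = U} {a} {b} {y} h = indep λ { (α ∷ β ∷ A) e →
  let q = independent h (α ∷ β ∷ o ∷ A) (trans (cong (λ z → (α ·ᵥ a) +ᵥ ((β ·ᵥ b) +ᵥ z))
            (trans (cong (_+ᵥ lin U A) (·ᵥ-zeroˡ y)) (+ᵥ-identityˡ _))) e)
      q₁ = ∷-tail q
  in cong₂ _∷_ (∷-head q) (cong₂ _∷_ (∷-head q₁) (∷-tail (∷-tail q₁))) }
  where open Indep

Indep-skip₃ : ∀ {j k} {U : Vec (Vecs k) j} {a b c y} → Indep (a ∷ b ∷ c ∷ y ∷ U) → Indep (a ∷ b ∷ c ∷ U)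
Indep-skip₃ {U = U} {a} {b} {c} {y} h = indep λ { (α ∷ β ∷ γ ∷ A) e →
  let q = independent h (α ∷ β ∷ γ ∷ o ∷ A) (trans (cong (λ z → (α ·ᵥ a) +ᵥ ((β ·ᵥ b) +ᵥ ((γ ·ᵥ c) +ᵥ z)))
            (trans (cong (_+ᵥ lin U A) (·ᵥ-zeroˡ y)) (+ᵥ-identityˡ _))) e)
      q₁ = ∷-tail q
      q₂ = ∷-tail q₁
  in cong₂ _∷_ (∷-head q) (cong₂ _∷_ (∷-head q₁) (cong₂ _∷_ (∷-head q₂) (∷-tail (∷-tail q₂)))) }
  where open Indep

Σᵥ-term≤ : ∀ d (f : Vecs d → ℤ) → (∀ x → 0ℤ ≤ℤ f x) → ∀ z → f z ≤ℤ Σᵥ d f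
Σᵥ-term≤ d f h z = subst (_≤ℤ Σᵥ d f) (Σᵥ-δ d f z) (Σᵥ-mono d below)
  where
  below : ∀ x → δ z x * f x ≤ℤ f x
  below x with z =ᵥ x
  ... | true = ℤₚ.≤-reflexive (ℤₚ.*-identityˡ (f x))
  ... | false = subst (_≤ℤ f x) (sym (ℤₚ.*-zeroˡ (f x))) (h x)

opaque
  unfolding Σᵥ

  Σᵥ-slice≤ : ∀ d (f : Vecs (suc d) → ℤ) → (∀ x → 0ℤ ≤ℤ f x) → Σᵥ d (λ x → f (o ∷ x)) ≤ℤ Σᵥ (suc d) f
  Σᵥ-slice≤ d f h = subst (_≤ℤ Σᵥ (suc d) f) (ℤₚ.+-identityʳ _)
    (ℤₚ.+-monoʳ-≤ (Σᵥ d λ x → f (o ∷ x))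
      (ℤₚ.+-mono-≤ (slice i) (ℤₚ.+-mono-≤ (slice w) (slice w²))))
    where
    slice : ∀ a → 0ℤ ≤ℤ Σᵥ d λ x → f (a ∷ x)
    slice a = subst (_≤ℤ Σᵥ d λ x → f (a ∷ x)) (Σᵥ-zero d λ _ → refl) (Σᵥ-mono d λ x → h (a ∷ x))

lin-last₃ : ∀ {m} (v x u : Vecs m) → lin (v ∷ x ∷ u ∷ []) (o ∷ o ∷ i ∷ []) ≡ u
lin-last₃ v x u = trans (cong₂ (λ y z → y +ᵥ (z +ᵥ ((i ·ᵥ u) +ᵥ 0ᵥ))) (·ᵥ-zeroˡ v) (·ᵥ-zeroˡ x))
  (trans (+ᵥ-identityˡ _) (trans (+ᵥ-identityˡ _) (trans (+ᵥ-identityʳ _) (·ᵥ-identity u))))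

lin-last₄ : ∀ {m} (t v x u : Vecs m) → lin (t ∷ v ∷ x ∷ u ∷ []) (o ∷ o ∷ o ∷ i ∷ []) ≡ u
lin-last₄ t v x u = trans (cong (_+ᵥ lin (v ∷ x ∷ u ∷ []) (o ∷ o ∷ i ∷ [])) (·ᵥ-zeroˡ t))
  (trans (+ᵥ-identityˡ _) (lin-last₃ v x u))

lin-last₅ : ∀ {m} (r t v x u : Vecs m) → lin (r ∷ t ∷ v ∷ x ∷ u ∷ []) (o ∷ o ∷ o ∷ o ∷ i ∷ []) ≡ u
lin-last₅ r t v x u = trans (cong (_+ᵥ lin (t ∷ v ∷ x ∷ u ∷ []) (o ∷ o ∷ o ∷ i ∷ [])) (·ᵥ-zeroˡ r))
  (trans (+ᵥ-identityˡ _) (lin-last₄ t v x u))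

k-weight≤3 : ∀ k → k ≤ 4 → + 12 * (+ k * (+ 4 - + k)) ≢ 0ℤ → k ≤ 3
k-weight≤3 0 _ _ = z≤n
k-weight≤3 1 _ _ = s≤s z≤n
k-weight≤3 2 _ _ = s≤s (s≤s z≤n)
k-weight≤3 3 _ _ = s≤s (s≤s (s≤s z≤n))
k-weight≤3 4 _ n = ⊥-elim (n refl)
k-weight≤3 (suc (suc (suc (suc (suc _))))) (s≤s (s≤s (s≤s (s≤s ())))) _

module Negative {m} {f : Vecs m → ℤ} {s : ℤ} (C : CL f s) (bit : Bit s)
                {P : Vecs m} {d : ℕ} (fP : f P ≡ -[1+ d ]) where

  plane-below : ∀ v x → Indep (v ∷ x ∷ P ∷ []) →
                Sp (v ∷ x ∷ P ∷ []) f ≡ + 16 * s + + 12 * + (pencil-count f s v x P ℕ.+ suc d)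
  plane-below v x ind = plane-at C v x P (suc d) ind fP

  private
    weighty : ∀ v x → Sp (v ∷ x ∷ P ∷ []) (wf f) ≢ 0ℤ
    weighty v x W0 = contradiction (ℕₚ.n≤0⇒n≡0 (below (subst₂ _≤ℤ_
        (trans (cong (wf f) (lin-last₃ v x P)) (trans (cong weight fP) (weight≡wt -[1+ d ]))) W0
        (Σᵥ-term≤ 3 (λ A → wf f (lin (v ∷ x ∷ P ∷ []) A)) (λ A → weight-nonneg (f (lin (v ∷ x ∷ P ∷ []) A)))
          (o ∷ o ∷ i ∷ []))))) λ ()
      where
      below : ∀ {a} → + a ≤ℤ 0ℤ → a ≤ 0
      below (+≤+ h) = h

  -- The value at `P` has positive weight, so k (4 - k) is nonzero and k = 4 is excluded. For the
  -- value -1 this is the cap property: no three lines of the class on `P` are coplanar.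
  count≤ : ∀ v x → Indep (v ∷ x ∷ P ∷ []) → pencil-count f s v x P ℕ.+ suc d ≤ 3
  count≤ v x ind = k-weight≤3 k k≤4 λ e → weighty v x (trans W e)
    where
    k : ℕ
    k = pencil-count f s v x P ℕ.+ suc d
    W : Sp (v ∷ x ∷ P ∷ []) (wf f) ≡ + 12 * (+ k * (+ 4 - + k))
    W = plane-weight C bit ind (+ k) (plane-below v x ind)
    k≤4 : k ≤ 4
    k≤4 = let n , e , n≤4 = k-range (+ k) (subst (0ℤ ≤ℤ_) W (Sp-weight-nonneg (v ∷ x ∷ P ∷ []) f))
          in subst (_≤ 4) (sym (ℤₚ.+-injective e)) n≤4

  NoPair : Set
  NoPair = ∀ x y → Indep (y ∷ x ∷ P ∷ []) → X f s x P ≡ 1 → X f s y P ≡ 1 → ⊥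

  -- With no line of the class on `P`, each plane on `P` has parameter d + 1; the final 0ℤ is the
  -- term 4X for the axis of the pencil. The planes are recorded too, because the value -2 is
  -- refuted through their weights.
  EmptySolid : Set
  EmptySolid = ∃[ t ] ∃[ v ] ∃[ x ] Indep (t ∷ v ∷ x ∷ P ∷ []) ×
    Sp (v ∷ x ∷ P ∷ []) f ≡ + 16 * s + + 12 * + suc d ×
    (∀ c → Sp ((t +ᵥ (c ·ᵥ v)) ∷ x ∷ P ∷ []) f ≡ + 16 * s + + 12 * + suc d) ×
    Sp (t ∷ v ∷ x ∷ P ∷ []) f ≡ + 64 * s + + 12 * ((+ suc d + Σ₄ (λ _ → + suc d)) - 0ℤ)

  private
    -- The solid arises from five independent vectors by leaving out `x₀`, so each line on `P` in it
    -- falls under the hypothesis `none`.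
    avoiding : 5 ≤ m → ∀ x₀ → Indep (x₀ ∷ P ∷ []) → (∀ v → Indep (v ∷ x₀ ∷ P ∷ []) → X f s v P ≡ 0) → EmptySolid
    avoiding 5≤m x₀ ind₂ none =
      let x , ind₃ = Indep-extend ind₂ (ℕₚ.≤-trans (ℕₚ.m≤m+n 3 2) 5≤m)
          v , ind₄ = Indep-extend ind₃ (ℕₚ.≤-trans (ℕₚ.m≤m+n 4 1) 5≤m)
          t , ind₅ = Indep-extend ind₄ 5≤m
          solid = Indep-skip₃ ind₅
          p = plane v x ind₄
          ps = λ c → plane (t +ᵥ (c ·ᵥ v)) x (Indep-pencil c ind₅)
      in t , v , x , solid , p , ps ,
         trans (solid-value C t v x P solid (+ suc d) (λ _ → + suc d) p ps)
           (cong (λ n → + 64 * s + + 12 * ((+ suc d + Σ₄ (λ _ → + suc d)) - + 4 * + n)) (none x ind₃))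
      where
      plane : ∀ v x → Indep (v ∷ x ∷ x₀ ∷ P ∷ []) → Sp (v ∷ x ∷ P ∷ []) f ≡ + 16 * s + + 12 * + suc d
      plane v x ind = trans (plane-below v x (Indep-skip₂ ind))
        (cong (λ n → + 16 * s + + 12 * + (n ℕ.+ suc d)) count)
        where
        at : ∀ c → X f s (v +ᵥ (c ·ᵥ x)) P ≡ 0
        at c = none (v +ᵥ (c ·ᵥ x)) (Indep-pencil c ind)
        count : pencil-count f s v x P ≡ 0
        count = cong₂ ℕ._+_ (none x (Indep-tail ind))
          (cong₂ ℕ._+_ (at o) (cong₂ ℕ._+_ (at i) (cong₂ ℕ._+_ (at w) (at w²))))

    0or : ∀ x → (X f s x P ≡ 1 → ⊥) → X f s x P ≡ 0
    0or x n = case-bit (X-bit f s x P)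
      where
      case-bit : X f s x P ≡ 0 ⊎ X f s x P ≡ 1 → X f s x P ≡ 0
      case-bit (inj₁ e) = e
      case-bit (inj₂ e) = ⊥-elim (n e)

  -- Without a pair at most one line of the class passes through `P`, and the solid has to avoid it.
  -- As the goal is absurdity, this line need not be searched for: the solid is built from an
  -- arbitrary `x₀`, and any line of the class met on the way is itself taken as the line to avoid.
  empty-solid : 5 ≤ m → NoPair → (EmptySolid → ⊥) → ⊥
  empty-solid 5≤m no-pair refute =
    let x₀ , ind = Indep-extend (Indep-single (negative-nonzero C bit fP)) (ℕₚ.≤-trans (ℕₚ.m≤m+n 2 3) 5≤m)
    in refute (avoiding 5≤m x₀ ind λ v ind₃ → 0or v (no-line v (Indep-skip ind₃)))
    where
    no-line : ∀ x₀ → Indep (x₀ ∷ P ∷ []) → X f s x₀ P ≡ 1 → ⊥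
    no-line x₀ ind e = refute (avoiding 5≤m x₀ ind λ v ind₃ → 0or v (no-pair x₀ v ind₃ e))

-- Two lines of the class through a point of value -1

line-points : ∀ {m} {f : Vecs m → ℤ} {s} → CL f s → ∀ x u → Indep (x ∷ u ∷ []) →
              f u + Σ₄ (λ c → f (x +ᵥ (c ·ᵥ u))) ≡ s + + 4 * + X f s x u
line-points {f = f} {s} C x u ind = ℤₚ.*-cancelˡ-≡ (+ 3) (f u + Σ₄ g) (s + + 4 * X')
  (trans (p₁ s (f u) (g o) (g i) (g w) (g w²)) (trans (cong (λ t → t - + 5 * s) (sym (trans
    (cong₂ (λ y z → y + + 4 * z) (sym (line-value C ind)) (sym (trans (Sp₀ f) (at-0 C))))
    (trans (Sp-pencil x u [] f) (cong₂ _+_ (point-value C u) (Σ₄-cong λ c → point-value C (x +ᵥ (c ·ᵥ u))))))))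
    (p₂ s X')))
  where
  g : GF4 → ℤ
  g c = f (x +ᵥ (c ·ᵥ u))
  X' : ℤ
  X' = + X f s x u
  p₁ : ∀ s a b c d e → + 3 * (a + (b + (c + (d + e)))) ≡ ((s + + 3 * a)
     + ((s + + 3 * b) + ((s + + 3 * c) + ((s + + 3 * d) + (s + + 3 * e))))) - + 5 * s
  p₁ = solve-∀
  p₂ : ∀ s x → (+ 4 * s + + 12 * x + + 4 * s) - + 5 * s ≡ + 3 * (s + + 4 * x)
  p₂ = solve-∀

large-term : ∀ (n : GF4 → ℕ) → (∀ c → n c ≤ 5) → 17 ≤ Σℕ₄ n → ∃[ c ] n c ≡ 5
large-term n n≤5 h with n o ℕₚ.≟ 5 | n i ℕₚ.≟ 5 | n w ℕₚ.≟ 5 | n w² ℕₚ.≟ 5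
... | yes e | _ | _ | _ = o , e
... | no _ | yes e | _ | _ = i , e
... | no _ | no _ | yes e | _ = w , e
... | no _ | no _ | no _ | yes e = w² , e
... | no n₀ | no n₁ | no n₂ | no n₃ = ⊥-elim (ℕₚ.<⇒≱ h (ℕₚ.+-mono-≤ (below o n₀)
        (ℕₚ.+-mono-≤ (below i n₁) (ℕₚ.+-mono-≤ (below w n₂) (below w² n₃)))))
  where
  below : ∀ c → n c ≢ 5 → n c ≤ 4
  below c ne = ℕₚ.≤-pred (ℕₚ.≤∧≢⇒< (n≤5 c) ne)

-- Among 7, ..., 11 only 10 and 11 make y (16 - y) divisible by 5.
solid-parameter : ∀ N → N ≤ 4 → ∀ W → + 5 * W ≡ + 12 * (+ (7 ℕ.+ N) * (+ 16 - + (7 ℕ.+ N))) →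
                  ∃[ b ] b ≤ 1 × 7 ℕ.+ N ≡ 10 ℕ.+ b
solid-parameter 0 _ W e = indivisible 5 756 W e
solid-parameter 1 _ W e = indivisible 5 768 W e
solid-parameter 2 _ W e = indivisible 5 756 W e
solid-parameter 3 _ W e = 0 , z≤n , refl
solid-parameter 4 _ W e = 1 , s≤s z≤n , refl
solid-parameter (suc (suc (suc (suc (suc _))))) (s≤s (s≤s (s≤s (s≤s ())))) _ _

-- Among 38, ..., 43 only 42 = 6 · 7 and 43 = 64 - 21 make z (64 - z) divisible by 7.
four-parameter : ∀ N → N ≤ 5 → ∀ W → + 7 * W ≡ + 4 * (+ (38 ℕ.+ N) * (+ 64 - + (38 ℕ.+ N))) →
                 38 ℕ.+ N ≡ 42 ⊎ 38 ℕ.+ N ≡ 43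
four-parameter 0 _ W e = indivisible 7 3952 W e
four-parameter 1 _ W e = indivisible 7 3900 W e
four-parameter 2 _ W e = indivisible 7 3840 W e
four-parameter 3 _ W e = indivisible 7 3772 W e
four-parameter 4 _ W e = inj₁ refl
four-parameter 5 _ W e = inj₂ refl
four-parameter (suc (suc (suc (suc (suc (suc _)))))) (s≤s (s≤s (s≤s (s≤s (s≤s ()))))) _ _

lin-middle : ∀ {m} (y x u : Vecs m) c → lin (y ∷ x ∷ u ∷ []) (o ∷ i ∷ c ∷ []) ≡ x +ᵥ (c ·ᵥ u)
lin-middle y x u c = trans (cong₂ (λ a b → a +ᵥ (b +ᵥ ((c ·ᵥ u) +ᵥ 0ᵥ))) (·ᵥ-zeroˡ y) (·ᵥ-identity x))
  (trans (+ᵥ-identityˡ _) (cong (x +ᵥ_) (+ᵥ-identityʳ _)))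

-- Let two lines of sum s + 4 meet in a point of value −1, and span a plane.  Each solid through
-- it has parameter 10 or 11, so a 4-space has parameter between 38 and 43, hence 42 or 43
-- since 7 divides 4z(64 − z).
module Pair {f : Vecs 5 → ℤ} {s : ℤ} (C : CL f s) (bit : Bit s) {P x y : Vecs 5} (fP : f P ≡ -1ℤ)
            (ind₃ : Indep (y ∷ x ∷ P ∷ [])) (Xx : X f s x P ≡ 1) (Xy : X f s y P ≡ 1) where

  open Negative C bit fP

  private
    count≥1 : ∀ v → 1 ≤ pencil-count f s v x P
    count≥1 v = ℕₚ.≤-trans (ℕₚ.≤-reflexive (sym Xx)) (ℕₚ.m≤m+n (X f s x P) _)

    -- The two given lines yield k ≥ 3, and `count≤` yields k ≤ 3.
    plane-3 : Sp (y ∷ x ∷ P ∷ []) f ≡ + 16 * s + + 12 * + 3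
    plane-3 = trans (plane-below y x ind₃) (cong (λ n → + 16 * s + + 12 * + n)
      (ℕₚ.≤-antisym (count≤ y x ind₃) (ℕₚ.+-monoˡ-≤ 1 two)))
      where
      two : 2 ≤ pencil-count f s y x P
      two = ℕₚ.+-mono-≤ (ℕₚ.≤-reflexive (sym Xx)) (ℕₚ.≤-trans (ℕₚ.≤-reflexive (sym
        (trans (cong (λ z → X f s z P) (trans (cong (y +ᵥ_) (·ᵥ-zeroˡ x)) (+ᵥ-identityʳ y))) Xy)))
        (Σℕ₄-≤ (λ c → X f s (y +ᵥ (c ·ᵥ x)) P) o))

    plane-23 : ∀ v → Indep (v ∷ x ∷ P ∷ []) →
               ∃[ b ] b ≤ 1 × Sp (v ∷ x ∷ P ∷ []) f ≡ + 16 * s + + 12 * + (2 ℕ.+ b)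
    plane-23 v ind = go (pencil-count f s v x P) refl (count≥1 v) (count≤ v x ind)
      where
      go : ∀ n → n ≡ pencil-count f s v x P → 1 ≤ n → pencil-count f s v x P ℕ.+ 1 ≤ 3 →
           ∃[ b ] b ≤ 1 × Sp (v ∷ x ∷ P ∷ []) f ≡ + 16 * s + + 12 * + (2 ℕ.+ b)
      go (suc b) e _ h = b , b≤1 , trans (plane-below v x ind) (cong (λ n → + 16 * s + + 12 * + n)
          (trans (cong (ℕ._+ 1) (sym e)) (ℕₚ.+-comm (suc b) 1)))
        where
        b≤1 : b ≤ 1
        b≤1 = ℕₚ.+-cancelˡ-≤ 2 b 1 (subst (_≤ 3) (ℕₚ.+-comm (suc b) 1) (subst (λ n → n ℕ.+ 1 ≤ 3) (sym e) h))

    p-from-7 : ∀ a b c d → (+ 3 + ((+ 2 + a) + ((+ 2 + b) + ((+ 2 + c) + (+ 2 + d))))) - + 4 * + 1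
            ≡ + 7 + (a + (b + (c + d)))
    p-from-7 = solve-∀
    p-from-38 : ∀ a b c d e → ((+ 10 + a) + ((+ 10 + b) + ((+ 10 + c) + ((+ 10 + d) + (+ 10 + e))))) - + 4 * + 3
           ≡ + 38 + (a + (b + (c + (d + e))))
    p-from-38 = solve-∀

    -- The planes on the line of `x` and `P` have parameters 3 and four times 2 + b with b ≤ 1, and
    -- 3 + 4 · 2 - 4 = 7.
    solid-1011 : ∀ v → Indep (v ∷ y ∷ x ∷ P ∷ []) →
                 ∃[ b ] b ≤ 1 × Sp (v ∷ y ∷ x ∷ P ∷ []) f ≡ + 64 * s + + 12 * + (10 ℕ.+ b)
    solid-1011 v ind =
      let b , b≤1 , e = solid-parameter N (Σℕ₄-mono λ c → proj₁ (proj₂ (ks c))) (Sp (v ∷ y ∷ x ∷ P ∷ []) (wf f))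
            (trans (solid-weight C ind (+ (7 ℕ.+ N)) value)
              (trans (cong (λ t → + 68 * t + + 12 * (+ (7 ℕ.+ N) * (+ 16 - + (7 ℕ.+ N)))) (weight-Bit bit))
                     (ℤₚ.+-identityˡ (+ 12 * (+ (7 ℕ.+ N) * (+ 16 - + (7 ℕ.+ N)))))))
      in b , b≤1 , trans value (cong (λ n → + 64 * s + + 12 * + n) e)
      where
      ks : ∀ c → ∃[ b ] b ≤ 1 × Sp ((v +ᵥ (c ·ᵥ y)) ∷ x ∷ P ∷ []) f ≡ + 16 * s + + 12 * + (2 ℕ.+ b)
      ks c = plane-23 (v +ᵥ (c ·ᵥ y)) (Indep-pencil c ind)
      n : GF4 → ℕ
      n c = proj₁ (ks c)
      N : ℕ
      N = Σℕ₄ n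
      value : Sp (v ∷ y ∷ x ∷ P ∷ []) f ≡ + 64 * s + + 12 * + (7 ℕ.+ N)
      value = trans (solid-value C v y x P ind (+ 3) (λ c → + (2 ℕ.+ n c)) plane-3 (λ c → proj₂ (proj₂ (ks c))))
        (cong (λ t → + 64 * s + + 12 * t) (trans
          (cong (λ k → (+ 3 + Σ₄ (λ c → + (2 ℕ.+ n c))) - + 4 * + k) Xx) (p-from-7 (+ n o) (+ n i) (+ n w) (+ n w²))))

  sum-5 : Σᵥ 5 f ≡ + 256 * s + + 12 * + 42 ⊎ Σᵥ 5 f ≡ + 256 * s + + 12 * + 43
  sum-5 =
    let v , ind₄ = Indep-extend ind₃ (s≤s (s≤s (s≤s (s≤s z≤n))))
        t , ind₅ = Indep-extend ind₄ (s≤s (s≤s (s≤s (s≤s (s≤s z≤n)))))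
    in result t v ind₅ (solid-1011 v ind₄) (λ c → solid-1011 (t +ᵥ (c ·ᵥ v)) (Indep-pencil c ind₅))
    where
    result : ∀ t v → Indep (t ∷ v ∷ y ∷ x ∷ P ∷ []) →
      (∃[ b ] b ≤ 1 × Sp (v ∷ y ∷ x ∷ P ∷ []) f ≡ + 64 * s + + 12 * + (10 ℕ.+ b)) →
      (∀ c → ∃[ b ] b ≤ 1 × Sp ((t +ᵥ (c ·ᵥ v)) ∷ y ∷ x ∷ P ∷ []) f ≡ + 64 * s + + 12 * + (10 ℕ.+ b)) →
      Σᵥ 5 f ≡ + 256 * s + + 12 * + 42 ⊎ Σᵥ 5 f ≡ + 256 * s + + 12 * + 43
    result t v ind (b , b≤1 , e) es = finish (four-parameter N N≤5 (Sp (t ∷ v ∷ y ∷ x ∷ P ∷ []) (wf f))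
        (four-weight C bit ind (+ (38 ℕ.+ N)) value))
      where
      n : GF4 → ℕ
      n c = proj₁ (es c)
      N : ℕ
      N = b ℕ.+ Σℕ₄ n
      N≤5 : N ≤ 5
      N≤5 = ℕₚ.+-mono-≤ b≤1 (Σℕ₄-mono λ c → proj₁ (proj₂ (es c)))
      -- Five solids of parameter 10 + b on a plane of parameter 3, and 5 · 10 - 4 · 3 = 38.
      value : Sp (t ∷ v ∷ y ∷ x ∷ P ∷ []) f ≡ + 256 * s + + 12 * + (38 ℕ.+ N)
      value = trans (four-value f s t v y x P (+ (10 ℕ.+ b)) (λ c → + (10 ℕ.+ n c)) (+ 3) plane-3 e (λ c → proj₂ (proj₂ (es c))))
        (cong (λ t → + 256 * s + + 12 * t) (p-from-38 (+ b) (+ n o) (+ n i) (+ n w) (+ n w²)))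
      finish : 38 ℕ.+ N ≡ 42 ⊎ 38 ℕ.+ N ≡ 43 →
               Σᵥ 5 f ≡ + 256 * s + + 12 * + 42 ⊎ Σᵥ 5 f ≡ + 256 * s + + 12 * + 43
      finish (inj₁ h) = inj₁ (trans (sym (Sp-basis ind f)) (trans value (cong (λ n → + 256 * s + + 12 * + n) h)))
      finish (inj₂ h) = inj₂ (trans (sym (Sp-basis ind f)) (trans value (cong (λ n → + 256 * s + + 12 * + n) h)))

  private
    value-on-plane : ∀ c → ∃[ n ] n ≤ 5 × f (x +ᵥ (c ·ᵥ P)) ≡ + n - + 3
    value-on-plane c =
      let v , x' , ind , same = rebase₃ ind₃ {o ∷ i ∷ c ∷ []} (λ ())
          Q = lin (y ∷ x ∷ P ∷ []) (o ∷ i ∷ c ∷ [])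
          n = pencil-count f s v x' Q
      in n , pencil-count≤5 f s v x' Q , trans (cong f (sym (lin-middle y x P c)))
           (rearrange (+ n) (f Q) (cancel-value 16 s (trans (sym (plane-value C v x' Q ind)) (trans (sym (same f)) plane-3))))
      where
      rearrange : ∀ n g → n - g ≡ + 3 → g ≡ n - + 3
      rearrange n g e = trans (p n g) (cong (λ t → n - t) e)
        where
        p : ∀ n g → g ≡ n - (n - g)
        p = solve-∀

  -- In a plane of parameter 3 a value is n - 3, where n ≤ 5 counts the lines of the class on the
  -- point. The four points other than `P` on the line of `x` and `P` have sum s + 5, so their
  -- numbers n add up to at least 17 and one of them is 5.
  value-2 : ∃[ Q ] f Q ≡ + 2
  value-2 =
    let c , e = large-term (λ c → proj₁ (value-on-plane c)) (λ c → proj₁ (proj₂ (value-on-plane c)))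
                  (at-least bit (λ c → proj₁ (value-on-plane c)) total)
    in x +ᵥ (c ·ᵥ P) , trans (proj₂ (proj₂ (value-on-plane c))) (cong (λ n → + n - + 3) e)
    where
    n : GF4 → ℕ
    n c = proj₁ (value-on-plane c)
    total : -1ℤ + Σ₄ (λ c → + n c - + 3) ≡ s + + 4
    total = trans (sym (cong₂ _+_ fP (Σ₄-cong λ c → proj₂ (proj₂ (value-on-plane c)))))
      (trans (line-points C x P (Indep-tail ind₃)) (cong (λ k → s + + 4 * + k) Xx))
    sum≡ : ∀ (n : GF4 → ℕ) k → -1ℤ + Σ₄ (λ c → + n c - + 3) ≡ + k → Σℕ₄ n ≡ 13 ℕ.+ k
    sum≡ n k e = ℤₚ.+-injective (trans (p (+ n o) (+ n i) (+ n w) (+ n w²)) (cong (λ t → + 13 + t) e))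
      where
      p : ∀ a b c d → a + (b + (c + d)) ≡ + 13 + (-1ℤ + ((a - + 3) + ((b - + 3) + ((c - + 3) + (d - + 3)))))
      p = solve-∀
    at-least : ∀ {s} → Bit s → ∀ (n : GF4 → ℕ) → -1ℤ + Σ₄ (λ c → + n c - + 3) ≡ s + + 4 → 17 ≤ Σℕ₄ n
    at-least (inj₁ refl) n e = ℕₚ.≤-reflexive (sym (sum≡ n 4 e))
    at-least (inj₂ refl) n e = ℕₚ.≤-trans (ℕₚ.m≤m+n 17 1) (ℕₚ.≤-reflexive (sym (sum≡ n 5 e)))

module _ {f : Vecs 5 → ℤ} {s : ℤ} (C : CL f s) (bit : Bit s) {P : Vecs 5} (fP : f P ≡ -1ℤ) where
  open Negative C bit fP

  pair-needed : NoPair → ⊥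
  pair-needed no-pair = empty-solid (ℕₚ.≤-refl {5}) no-pair λ (t , v , x , ind , _ , _ , sum) →
    no-minus-one-in-solid (pull C ind) bit sum {o ∷ o ∷ o ∷ i ∷ []} (trans (cong f (lin-last₄ t v x P)) fP)

private
  complementary : ∀ s F a b → F ≡ + 256 * s + + 12 * + a → + 1024 - F ≡ + 256 * (1ℤ - s) + + 12 * + b → a ℕ.+ b ≡ 64
  complementary s _ a b refl e = ℤₚ.+-injective (ℤₚ.*-cancelˡ-≡ (+ 12) (+ a + + b) (+ 64) (trans (p s (+ a) (+ b))
      (trans (cong (λ t → + 768 + (t - (+ 1024 - (+ 256 * s + + 12 * + a)))) (sym e)) (p' s (+ a)))))
    where
    p : ∀ s a b → + 12 * (a + b) ≡ + 768 + ((+ 256 * (1ℤ - s) + + 12 * b) - (+ 1024 - (+ 256 * s + + 12 * a)))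
    p = solve-∀
    p' : ∀ s a → + 768 + ((+ 1024 - (+ 256 * s + + 12 * a)) - (+ 1024 - (+ 256 * s + + 12 * a))) ≡ + 12 * + 64
    p' = solve-∀

-- A value -1 needs a pair of lines, which produces a value 2; this is a value -1 of the mirrored
-- function and needs a pair there. Both parameters are then 42 or 43, but they add up to 64.
no-minus-one₅ : ∀ {f : Vecs 5 → ℤ} {s} → CL f s → Bit s → ∀ {P} → f P ≡ -1ℤ → ⊥
no-minus-one₅ {f} {s} C bit {P} fP = pair-needed C bit fP λ x y ind Xx Xy →
  let module A = Pair C bit fP ind Xx Xy
      Q , fQ = A.value-2
      fQ' = cong (λ t → 1ℤ - t) fQ
  in pair-needed (mirror C) (mirror-Bit bit) fQ' λ x' y' ind' Xx' Xy' →
     let module B = Pair (mirror C) (mirror-Bit bit) fQ' ind' Xx' Xy'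
     in clash A.sum-5 B.sum-5
  where
  mirrored : Σᵥ 5 (λ x → 1ℤ - f x) ≡ + 1024 - Σᵥ 5 f
  mirrored = Σᵥ-mirror 5 f
  clash : Σᵥ 5 f ≡ + 256 * s + + 12 * + 42 ⊎ Σᵥ 5 f ≡ + 256 * s + + 12 * + 43 →
          Σᵥ 5 (λ x → 1ℤ - f x) ≡ + 256 * (1ℤ - s) + + 12 * + 42 ⊎
          Σᵥ 5 (λ x → 1ℤ - f x) ≡ + 256 * (1ℤ - s) + + 12 * + 43 → ⊥
  never : ∀ a b → a ℕ.+ b ≢ 64 → Σᵥ 5 f ≡ + 256 * s + + 12 * + a →
       Σᵥ 5 (λ x → 1ℤ - f x) ≡ + 256 * (1ℤ - s) + + 12 * + b → ⊥
  never a b ne e e' = ne (complementary s (Σᵥ 5 f) a b e (trans (sym mirrored) e'))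
  clash (inj₁ e) (inj₁ e') = never 42 42 (λ ()) e e'
  clash (inj₁ e) (inj₂ e') = never 42 43 (λ ()) e e'
  clash (inj₂ e) (inj₁ e') = never 43 42 (λ ()) e e'
  clash (inj₂ e) (inj₂ e') = never 43 43 (λ ()) e e'

no-minus-one : ∀ {m} {f : Vecs m → ℤ} {s} → CL f s → Bit s → 5 ≤ m → ∀ {P} → f P ≢ -1ℤ
no-minus-one {f = f} C bit 5≤m {P} fP =
  let x , ind₂ = Indep-extend (Indep-single (negative-nonzero C bit fP)) (ℕₚ.≤-trans (ℕₚ.m≤m+n 2 3) 5≤m)
      v , ind₃ = Indep-extend ind₂ (ℕₚ.≤-trans (ℕₚ.m≤m+n 3 2) 5≤m)
      t , ind₄ = Indep-extend ind₃ (ℕₚ.≤-trans (ℕₚ.m≤m+n 4 1) 5≤m)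
      r , ind₅ = Indep-extend ind₄ 5≤m
  in no-minus-one₅ (pull C ind₅) bit {o ∷ o ∷ o ∷ o ∷ i ∷ []} (trans (cong f (lin-last₅ r t v x P)) fP)

no-two : ∀ {m} {f : Vecs m → ℤ} {s} → CL f s → Bit s → 5 ≤ m → ∀ {P} → f P ≢ + 2
no-two C bit 5≤m fP = no-minus-one (mirror C) (mirror-Bit bit) 5≤m (cong (λ t → 1ℤ - t) fP)

-- The remaining values 0, 1, 4 and -3

wt≤2-cases : ∀ z → wt z ≤ 2 → wt z ≡ 0 ⊎ z ≡ -1ℤ ⊎ z ≡ + 2
wt≤2-cases (+ 0) _ = inj₁ refl
wt≤2-cases (+ 1) _ = inj₁ refl
wt≤2-cases (+ 2) _ = inj₂ (inj₂ refl)
wt≤2-cases z@(+ suc (suc (suc n))) h = ⊥-elim (too-big z (λ ()) refl h)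
  where
  too-big : ∀ z → z ≢ -1ℤ → z ≡ + suc (suc (suc n)) → wt z ≤ 2 → ⊥
  too-big _ _ refl h = ℕₚ.<⇒≱ (ℕₚ.m≤m+n 3 3) (ℕₚ.≤-trans (ℕₚ.*-mono-≤ (ℕₚ.m≤m+n 3 n) (ℕₚ.m≤m+n 2 n)) h)
wt≤2-cases -[1+ zero ] _ = inj₂ (inj₁ refl)
wt≤2-cases -[1+ suc n ] h =
  ⊥-elim (ℕₚ.<⇒≱ (ℕₚ.m≤m+n 3 3) (ℕₚ.≤-trans (ℕₚ.*-mono-≤ (ℕₚ.m≤m+n 2 n) (ℕₚ.m≤m+n 3 n)) h))

module _ {m} {f : Vecs m → ℤ} {s} (C : CL f s) (bit : Bit s) (5≤m : 5 ≤ m) where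

  -- Here k ≤ 3 leaves at most one line of the class on `P` in each plane, hence a solid of
  -- parameter 10. It has weight 144 and five planes of weight 48 on a line through `P`, so that
  -- line has weight 24 = 3 (6 + 2). The rest 2 could only come from a value -1 or 2.
  no-minus-two : ∀ {P} → f P ≢ -[1+ 1 ]
  no-minus-two {P} fP = empty-solid 5≤m no-pair refute
    where
    open Negative C bit fP
    no-pair : NoPair
    no-pair x y ind Xx Xy = ℕₚ.<⇒≱ (ℕₚ.≤-refl {4}) (ℕₚ.≤-trans (ℕₚ.+-monoˡ-≤ 2 two) (count≤ y x ind))
      where
      two : 2 ≤ pencil-count f s y x P
      two = ℕₚ.+-mono-≤ (ℕₚ.≤-reflexive (sym Xx)) (ℕₚ.≤-trans (ℕₚ.≤-reflexive (sym
        (trans (cong (λ z → X f s z P) (trans (cong (y +ᵥ_) (·ᵥ-zeroˡ x)) (+ᵥ-identityʳ y))) Xy)))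
        (Σℕ₄-≤ (λ c → X f s (y +ᵥ (c ·ᵥ x)) P) o))
    line : ∀ x → + (3 ℕ.* (wt (f P) ℕ.+ Σℕ₄ λ c → wt (f (x +ᵥ (c ·ᵥ P))))) ≡ + 24 → ⊥
    line x e = nonzero (λ c → zero-weight (f (x +ᵥ (c ·ᵥ P))) (no-minus-one C bit 5≤m) (no-two C bit 5≤m)
                                (proj₂ (small-sum n Σn≡2) c))
      where
      n : GF4 → ℕ
      n c = wt (f (x +ᵥ (c ·ᵥ P)))
      Σn≡2 : Σℕ₄ n ≡ 2
      Σn≡2 = ℕₚ.+-cancelˡ-≡ 6 (Σℕ₄ n) 2 (trans (cong (λ z → wt z ℕ.+ Σℕ₄ n) (sym fP))
        (ℕₚ.*-cancelˡ-≡ (wt (f P) ℕ.+ Σℕ₄ n) 8 3 (ℤₚ.+-injective e)))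
      zero-weight : ∀ z → z ≢ -1ℤ → z ≢ + 2 → wt z ≤ 2 → wt z ≡ 0
      zero-weight z n₁ n₂ h = go (wt≤2-cases z h)
        where
        go : wt z ≡ 0 ⊎ z ≡ -1ℤ ⊎ z ≡ + 2 → wt z ≡ 0
        go (inj₁ e) = e
        go (inj₂ (inj₁ e)) = ⊥-elim (n₁ e)
        go (inj₂ (inj₂ e)) = ⊥-elim (n₂ e)
      nonzero : (∀ c → n c ≡ 0) → ⊥
      nonzero z = contradiction (trans (sym Σn≡2) (cong₂ ℕ._+_ (z o) (cong₂ ℕ._+_ (z i) (cong₂ ℕ._+_ (z w) (z w²))))) λ ()
    refute : EmptySolid → ⊥
    refute (t , v , x , ind , p , ps , sum) = line x (trans (sym (line-weight C bit x P))
        (ℤₚ.*-cancelˡ-≡ (+ 4) L (+ 24) (trans (q₁ (+ 4 * L)) (cong (λ z → z - + 144) pencil))))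
      where
      L : ℤ
      L = Sp (x ∷ P ∷ []) (wf f)
      W-solid : Sp (t ∷ v ∷ x ∷ P ∷ []) (wf f) ≡ + 144
      W-solid = ℤₚ.*-cancelˡ-≡ (+ 5) (Sp (t ∷ v ∷ x ∷ P ∷ []) (wf f)) (+ 144)
        (trans (solid-weight C ind (+ 10) sum) (cong (λ t → + 68 * t + + 720) (weight-Bit bit)))
      pencil : + 144 + + 4 * L ≡ + 240
      pencil = trans (cong (_+ + 4 * L) (sym W-solid)) (trans (Sp-pencil t v (x ∷ P ∷ []) (wf f))
        (cong₂ _+_ (plane-weight C bit (Indep-tail ind) (+ 2) p)
          (Σ₄-cong {g = λ _ → + 48} λ c → plane-weight C bit (Indep-pencil c ind) (+ 2) (ps c))))
      q₁ : ∀ z → z ≡ + 144 + z - + 144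
      q₁ = solve-∀

  private
    plane-on : ∀ {P} → P ≢ 0ᵥ → ∃[ v ] ∃[ x ] Indep (v ∷ x ∷ P ∷ [])
    plane-on P≢0 =
      let x , ind₂ = Indep-extend (Indep-single P≢0) (ℕₚ.≤-trans (ℕₚ.m≤m+n 2 3) 5≤m)
          v , ind₃ = Indep-extend ind₂ (ℕₚ.≤-trans (ℕₚ.m≤m+n 3 2) 5≤m)
      in v , x , ind₃

  negative-value : ∀ {P n} → f P ≡ -[1+ n ] → n ≡ 2
  negative-value {n = 0} fP = ⊥-elim (no-minus-one C bit 5≤m fP)
  negative-value {n = 1} fP = ⊥-elim (no-minus-two fP)
  negative-value {n = 2} fP = refl
  negative-value {n = suc (suc (suc n))} fP =
    let v , x , ind = plane-on (negative-nonzero C bit fP)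
    -- The parameter of a plane on `P` would be at least 4 + n, beyond the bound 3.
    in ⊥-elim (ℕₚ.<⇒≱ (ℕₚ.m≤m+n 4 n) (ℕₚ.≤-trans (ℕₚ.m≤n+m (4 ℕ.+ n) _) (Negative.count≤ C bit fP v x ind)))

data Value : ℤ → Set where
  value-0 : Value 0ℤ
  value-1 : Value 1ℤ
  value-4 : Value (+ 4)
  value-−3 : Value -[1+ 2 ]

values : ∀ {m} {f : Vecs m → ℤ} {s} → CL f s → Bit s → 5 ≤ m → ∀ P → Value (f P)
values {f = f} C bit 5≤m P = go (f P) refl
  where
  go : ∀ z → f P ≡ z → Value z
  go (+ 0) _ = value-0
  go (+ 1) _ = value-1
  -- The mirrored value 1 - (n + 2) is -(n + 1), so `negative-value` applies and leaves only 4.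
  go (+ suc (suc n)) e = big n (negative-value (mirror C) (mirror-Bit bit) 5≤m {P} {n} (cong (λ t → 1ℤ - t) e))
    where
    big : ∀ n → n ≡ 2 → Value (+ suc (suc n))
    big .2 refl = value-4
  go -[1+ n ] e = small n (negative-value C bit 5≤m e)
    where
    small : ∀ n → n ≡ 2 → Value -[1+ n ]
    small .2 refl = value-−3

-- Points of value 4

module Four {m} {f : Vecs m → ℤ} {s} (C : CL f s) (bit : Bit s) (3≤m : 3 ≤ m)
            {P : Vecs m} (fP : f P ≡ + 4) where

  P≢0 : P ≢ 0ᵥ
  P≢0 = nonzero-value C bit (λ e → contradiction (trans (sym fP) e) λ ()) (λ e → contradiction (trans (sym fP) e) λ ())

  private
    weight-P : ∀ (U : Vec (Vecs m) 3) A → lin U A ≡ P → + 12 ≤ℤ Sp U (wf f)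
    weight-P U A e = subst (_≤ℤ Sp U (wf f)) (trans (cong (wf f) e) (cong weight fP))
      (Σᵥ-term≤ 3 (λ A → wf f (lin U A)) (λ A → weight-nonneg (f (lin U A))) A)

    -- A plane on `P` has parameter n - 4 ≤ 1, and the weight 12 of the value 4 forces this
    -- parameter to be positive.
    count-5 : ∀ n → n ≤ 5 → + 12 ≤ℤ + 12 * ((+ n - + 4) * (+ 4 - (+ n - + 4))) → n ≡ 5
    count-5 0 _ ()
    count-5 1 _ ()
    count-5 2 _ ()
    count-5 3 _ ()
    count-5 4 _ (+≤+ ())
    count-5 5 _ _ = refl
    count-5 (suc (suc (suc (suc (suc (suc _)))))) (s≤s (s≤s (s≤s (s≤s (s≤s ()))))) _

  module _ {v x : Vecs m} (ind : Indep (v ∷ x ∷ P ∷ [])) where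
    private
      n : ℕ
      n = pencil-count f s v x P

      value : Sp (v ∷ x ∷ P ∷ []) f ≡ + 16 * s + + 12 * (+ n - + 4)
      value = trans (plane-value C v x P ind) (cong (λ t → + 16 * s + + 12 * (+ n - t)) fP)

      W : Sp (v ∷ x ∷ P ∷ []) (wf f) ≡ + 12 * ((+ n - + 4) * (+ 4 - (+ n - + 4)))
      W = plane-weight C bit ind (+ n - + 4) value

      n≡5 : n ≡ 5
      n≡5 = count-5 n (pencil-count≤5 f s v x P) (subst (+ 12 ≤ℤ_) W (weight-P (v ∷ x ∷ P ∷ []) (o ∷ o ∷ i ∷ []) (lin-last₃ v x P)))

    -- The three nonzero multiples of `P` already contribute 3 · 12, so every other point of the
    -- plane has weight 0.
    plane-weight-36′ : Sp (v ∷ x ∷ P ∷ []) (wf f) ≡ + 36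
    plane-weight-36′ = trans W (cong (λ n → + 12 * ((+ n - + 4) * (+ 4 - (+ n - + 4)))) n≡5)

    line-full : X f s x P ≡ 1
    line-full = first (X-bit f s x P)
      where
      first : X f s x P ≡ 0 ⊎ X f s x P ≡ 1 → X f s x P ≡ 1
      first (inj₂ e) = e
      first (inj₁ e) = ⊥-elim (ℕₚ.<⇒≱ (ℕₚ.≤-refl {5}) (subst (_≤ 4) n≡5
        (ℕₚ.+-mono-≤ (ℕₚ.≤-reflexive e) (Σℕ₄-mono {n = λ _ → 1} λ c → X≤1 f s (v +ᵥ (c ·ᵥ x)) P))))

    line-weight-36 : Sp (x ∷ P ∷ []) (wf f) ≤ℤ + 36
    line-weight-36 = subst₂ _≤ℤ_ refl plane-weight-36′ below
      where
      shift : Sp (x ∷ P ∷ []) (wf f) ≡ Σᵥ 2 λ A → wf f (lin (v ∷ x ∷ P ∷ []) (o ∷ A))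
      shift = Σᵥ-cong 2 λ A → cong (wf f) (sym (trans (cong (_+ᵥ lin (x ∷ P ∷ []) A) (·ᵥ-zeroˡ v)) (+ᵥ-identityˡ _)))
      below : Sp (x ∷ P ∷ []) (wf f) ≤ℤ Sp (v ∷ x ∷ P ∷ []) (wf f)
      below = subst (_≤ℤ Sp (v ∷ x ∷ P ∷ []) (wf f)) (sym shift)
        (Σᵥ-slice≤ 2 (λ A → wf f (lin (v ∷ x ∷ P ∷ []) A)) λ A → weight-nonneg (f (lin (v ∷ x ∷ P ∷ []) A)))

  private
    extended : ∀ x → Indep (x ∷ P ∷ []) → ∃[ v ] Indep (v ∷ x ∷ P ∷ [])
    extended x ind = Indep-extend ind 3≤m

  full : ∀ x → Indep (x ∷ P ∷ []) → X f s x P ≡ 1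
  full x ind = line-full (proj₂ (extended x ind))

  elsewhere : ∀ x → Indep (x ∷ P ∷ []) → f x ≡ 0ℤ ⊎ f x ≡ 1ℤ
  elsewhere x ind = zero-or-one (f x) (subst (λ y → wt (f y) ≡ 0) (trans (cong (x +ᵥ_) (·ᵥ-zeroˡ P)) (+ᵥ-identityʳ x))
      (Σℕ₄-zero n (no-rest (subst₂ _≤ℤ_ (trans (line-weight C bit x P) (cong (λ z → + (3 ℕ.* (wt z ℕ.+ Σℕ₄ n))) fP)) refl
        (line-weight-36 (proj₂ (extended x ind))))) o))
    where
    n : GF4 → ℕ
    n c = wt (f (x +ᵥ (c ·ᵥ P)))
    no-rest : ∀ {k} → + (3 ℕ.* (12 ℕ.+ k)) ≤ℤ + 36 → k ≡ 0
    no-rest {k} (+≤+ h) = ℕₚ.n≤0⇒n≡0 (ℕₚ.+-cancelˡ-≤ 12 k 0 (ℕₚ.*-cancelˡ-≤ 3 h))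
    zero-or-one : ∀ z → wt z ≡ 0 → z ≡ 0ℤ ⊎ z ≡ 1ℤ
    zero-or-one (+ 0) _ = inj₁ refl
    zero-or-one (+ 1) _ = inj₂ refl

-- Reduced row echelon bases

entryAt-+ : ∀ {k} j (x y : Vecs k) → entryAt j (x +ᵥ y) ≡ entryAt j x ⊕ entryAt j y
entryAt-+ j [] [] = refl
entryAt-+ zero (a ∷ x) (b ∷ y) = refl
entryAt-+ (suc j) (a ∷ x) (b ∷ y) = entryAt-+ j x y

entryAt-· : ∀ {k} j c (x : Vecs k) → entryAt j (c ·ᵥ x) ≡ c ⊗ entryAt j x
entryAt-· j c [] = sym (⊗-zeroʳ c)
entryAt-· zero c (a ∷ x) = refl
entryAt-· (suc j) c (a ∷ x) = entryAt-· j c x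

entryAt-0 : ∀ {k} j → entryAt j (0ᵥ {k}) ≡ o
entryAt-0 {zero} j = refl
entryAt-0 {suc k} zero = refl
entryAt-0 {suc k} (suc j) = entryAt-0 {k} j

entryAt-lin : ∀ {k} j (u v : Vecs k) a b →
              entryAt j (lin (u ∷ v ∷ []) (a ∷ b ∷ [])) ≡ (a ⊗ entryAt j u) ⊕ (b ⊗ entryAt j v)
entryAt-lin {k} j u v a b = trans (entryAt-+ j (a ·ᵥ u) ((b ·ᵥ v) +ᵥ 0ᵥ))
  (cong₂ _⊕_ (entryAt-· j a u) (trans (cong (entryAt j) (+ᵥ-identityʳ (b ·ᵥ v))) (entryAt-· j b v)))

pivot-entry : ∀ {k} (x : Vecs k) → T (normalized x) → entryAt (pivot x) x ≡ i
pivot-entry (o ∷ x) t = pivot-entry x t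
pivot-entry (i ∷ x) t = refl

before-pivot : ∀ {k} (x : Vecs k) j → j ℕ.< pivot x → entryAt j x ≡ o
before-pivot (o ∷ x) zero _ = refl
before-pivot (o ∷ x) (suc j) (s≤s h) = before-pivot x j h

pivot-unique : ∀ {k} (x : Vecs k) p → entryAt p x ≢ o → (∀ j → j ℕ.< p → entryAt j x ≡ o) → pivot x ≡ p
pivot-unique [] p n _ = ⊥-elim (n refl)
pivot-unique (o ∷ x) zero n _ = ⊥-elim (n refl)
pivot-unique (i ∷ x) zero _ _ = refl
pivot-unique (w ∷ x) zero _ _ = refl
pivot-unique (w² ∷ x) zero _ _ = refl
pivot-unique (a ∷ x) (suc p) n h with h zero (s≤s z≤n)
... | refl = cong suc (pivot-unique x p n λ j j<p → h (suc j) (s≤s j<p))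

record RREF {k} (u v : Vecs k) : Set where
  field
    normal-u : T (normalized u)
    normal-v : T (normalized v)
    pivots : pivot u ℕ.< pivot v
    cleared : entryAt (pivot v) u ≡ o

rref-split : ∀ {k} {u v : Vecs k} → T (isRREF (u , v)) → RREF u v
rref-split {u = u} {v} t =
  let nu , t₁ = ∧-T {normalized u} t
      nv , t₂ = ∧-T {normalized v} t₁
      pv , t₃ = ∧-T {pivot u ℕ.<ᵇ pivot v} t₂
  in record { normal-u = nu ; normal-v = nv ; pivots = ℕₚ.<ᵇ⇒< (pivot u) (pivot v) pv ; cleared = ==-sound _ _ t₃ }

module _ {k} {u v : Vecs k} (R : RREF u v) where
  open RREF R
  private
    p r : ℕ
    p = pivot u
    r = pivot v

  entry-p : ∀ a b → entryAt p (lin (u ∷ v ∷ []) (a ∷ b ∷ [])) ≡ a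
  entry-p a b = trans (entryAt-lin p u v a b) (trans (cong₂ _⊕_ (cong (a ⊗_) (pivot-entry u normal-u))
      (cong (b ⊗_) (before-pivot v p pivots)))
    (identity₂ (λ a b → (a ⊗ i) ⊕ (b ⊗ o)) (λ a b → a) tt a b))

  entry-r : ∀ a b → entryAt r (lin (u ∷ v ∷ []) (a ∷ b ∷ [])) ≡ b
  entry-r a b = trans (entryAt-lin r u v a b) (trans (cong₂ _⊕_ (cong (a ⊗_) cleared)
      (cong (b ⊗_) (pivot-entry v normal-v)))
    (identity₂ (λ a b → (a ⊗ o) ⊕ (b ⊗ i)) (λ a b → b) tt a b))

  rref-indep : Indep (u ∷ v ∷ [])
  rref-indep = indep λ { (a ∷ b ∷ []) e → cong₂ (λ a b → a ∷ b ∷ [])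
    (trans (sym (entry-p a b)) (trans (cong (entryAt p) e) (entryAt-0 {k} p)))
    (trans (sym (entry-r a b)) (trans (cong (entryAt r) e) (entryAt-0 {k} r))) }

  private
    pivot-p : ∀ a b → a ≢ o → pivot (lin (u ∷ v ∷ []) (a ∷ b ∷ [])) ≡ p
    pivot-p a b a≢o = pivot-unique (lin (u ∷ v ∷ []) (a ∷ b ∷ [])) p (λ e → a≢o (trans (sym (entry-p a b)) e)) λ j j<p →
      trans (entryAt-lin j u v a b) (trans (cong₂ (λ x y → (a ⊗ x) ⊕ (b ⊗ y)) (before-pivot u j j<p)
        (before-pivot v j (ℕₚ.<-trans j<p pivots)))
      (identity₂ (λ a b → (a ⊗ o) ⊕ (b ⊗ o)) (λ a b → o) tt a b))

    second : ∀ b → lin (u ∷ v ∷ []) (o ∷ b ∷ []) ≡ b ·ᵥ v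
    second b = trans (cong₂ _+ᵥ_ (·ᵥ-zeroˡ u) (+ᵥ-identityʳ (b ·ᵥ v))) (+ᵥ-identityˡ (b ·ᵥ v))

    first : lin (u ∷ v ∷ []) (i ∷ o ∷ []) ≡ u
    first = trans (cong₂ _+ᵥ_ (·ᵥ-identity u) (trans (+ᵥ-identityʳ (o ·ᵥ v)) (·ᵥ-zeroˡ v))) (+ᵥ-identityʳ u)

    pivot-r : ∀ b → b ≢ o → pivot (lin (u ∷ v ∷ []) (o ∷ b ∷ [])) ≡ r
    pivot-r b b≢o = pivot-unique (lin (u ∷ v ∷ []) (o ∷ b ∷ [])) r (λ e → b≢o (trans (sym (entry-r o b)) e)) λ j j<r →
      trans (entryAt-lin j u v o b) (trans (cong (λ y → o ⊕ (b ⊗ y)) (before-pivot v j j<r)) (⊗-zeroʳ b))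

    normalized≢0 : ∀ {k} → ¬ T (normalized (0ᵥ {k}))
    normalized≢0 {suc k} t = normalized≢0 {k} t

  -- A combination a u + b v has the pivot of `u` if a ≠ o and that of `v` otherwise. As the pivot
  -- of `u'` is the smaller one, `u'` involves `u` and `v'` does not; normalisation and the cleared
  -- entry then fix the coefficients.
  rref-unique : ∀ {u' v'} → RREF u' v' → ∀ A B → lin (u ∷ v ∷ []) A ≡ u' → lin (u ∷ v ∷ []) B ≡ v' →
                u ≡ u' × v ≡ v'
  rref-unique {u'} {v'} R' (a ∷ b ∷ []) (c ∷ d ∷ []) refl refl = go (a ≟₄ o) (c ≟₄ o)
    where
    module R' = RREF R'
    unit : ∀ {x y} (z : Vecs k) → T (normalized z) → pivot z ≡ y → entryAt y z ≡ x → x ≡ i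
    unit z n refl refl = pivot-entry z n
    go : a ≡ o ⊎ a ≢ o → c ≡ o ⊎ c ≢ o → u ≡ u' × v ≡ v'
    go _ (inj₂ c≢o) with a ≟₄ o
    ... | inj₂ a≢o = ⊥-elim (ℕₚ.<-irrefl (trans (pivot-p a b a≢o) (sym (pivot-p c d c≢o))) R'.pivots)
    ... | inj₁ refl = ⊥-elim (ℕₚ.<-asym R'.pivots (subst₂ ℕ._<_ (sym (pivot-p c d c≢o)) (sym (pivot-r b b≢o)) pivots))
      where
      b≢o : b ≢ o
      b≢o refl = normalized≢0 {k} (subst (λ z → T (normalized z)) (lin-0 (u ∷ v ∷ [])) R'.normal-u)
    go (inj₁ refl) (inj₁ refl) = ⊥-elim (ℕₚ.<-irrefl (trans (pivot-r b b≢o) (sym (pivot-r d d≢o))) R'.pivots)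
      where
      b≢o : b ≢ o
      b≢o refl = normalized≢0 {k} (subst (λ z → T (normalized z)) (lin-0 (u ∷ v ∷ [])) R'.normal-u)
      d≢o : d ≢ o
      d≢o refl = normalized≢0 {k} (subst (λ z → T (normalized z)) (lin-0 (u ∷ v ∷ [])) R'.normal-v)
    go (inj₂ a≢o) (inj₁ refl) = sym (trans (cong₂ (λ a b → lin (u ∷ v ∷ []) (a ∷ b ∷ [])) a≡i b≡o) first) ,
        sym (trans (second d) (trans (cong (_·ᵥ v) d≡i) (·ᵥ-identity v)))
      where
      d≢o : d ≢ o
      d≢o refl = normalized≢0 {k} (subst (λ z → T (normalized z)) (lin-0 (u ∷ v ∷ [])) R'.normal-v)
      a≡i : a ≡ i
      a≡i = unit (lin (u ∷ v ∷ []) (a ∷ b ∷ [])) R'.normal-u (pivot-p a b a≢o) (entry-p a b)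
      d≡i : d ≡ i
      d≡i = unit (lin (u ∷ v ∷ []) (o ∷ d ∷ [])) R'.normal-v (pivot-r d d≢o) (entry-r o d)
      b≡o : b ≡ o
      b≡o = trans (sym (entry-r a b)) (trans (cong (λ j → entryAt j (lin (u ∷ v ∷ []) (a ∷ b ∷ []))) (sym (pivot-r d d≢o))) R'.cleared)

line-indep : ∀ {k} {u v : Vecs k} → T (isRREF (u , v)) → Indep (u ∷ v ∷ [])
line-indep {u = u} {v} t = rref-indep (rref-split {u = u} {v} t)

normalize : ∀ {k} (x : Vecs k) → x ≢ 0ᵥ → ∃[ c ] c ≢ o × T (normalized (c ·ᵥ x))
normalize [] n = ⊥-elim (n refl)
normalize (i ∷ x) n = i , (λ ()) , tt
normalize (w ∷ x) n = w² , (λ ()) , tt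
normalize (w² ∷ x) n = w , (λ ()) , tt
normalize (o ∷ x) n =
  let c , c≢o , t = normalize x λ e → n (cong (o ∷_) e)
  in c , c≢o , subst (λ z → T (normalized (z ∷ (c ·ᵥ x)))) (sym (⊗-zeroʳ c)) t

-- Equality of all sums stands in for equality of subspaces: only line sums are transported, and
-- each row operation preserves them by a lemma on `Sp`.
SameSpan : ∀ {k i j} → Vec (Vecs k) i → Vec (Vecs k) j → Set
SameSpan U U' = ∀ φ → Sp U φ ≡ Sp U' φ

private
  lin-o∷ : ∀ {k} (x y : Vecs k) A → lin ((o ∷ x) ∷ (o ∷ y) ∷ []) A ≡ o ∷ lin (x ∷ y ∷ []) A
  lin-o∷ x y (a ∷ b ∷ []) = cong₂ _∷_ (identity₂ (λ a b → (a ⊗ o) ⊕ ((b ⊗ o) ⊕ o)) (λ _ _ → o) tt a b) refl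

  -- Gaussian elimination with the first pivot in front: scale the first row, clear below it,
  -- normalise the second row, clear above it. Adding a multiple clears an entry, as the
  -- characteristic is 2.
  rref-head : ∀ {k} a (x y : Vecs k) b → a ≢ o → Indep ((a ∷ x) ∷ (b ∷ y) ∷ []) →
              ∃[ u ] ∃[ v ] T (isRREF (u , v)) × SameSpan ((a ∷ x) ∷ (b ∷ y) ∷ []) (u ∷ v ∷ [])
  rref-head {k} a x y b a≢o ind = u , v , ok , λ φ → trans (to-uy φ) (trans (to-uy₀ φ) (trans (to-u₀v φ) (to-uv φ)))
    where
    u₀ y₀ v u : Vecs (suc k)
    u₀ = (a ⁻¹) ·ᵥ (a ∷ x)
    y₀ = (b ∷ y) +ᵥ (b ·ᵥ u₀)
    u₀-head : (a ⁻¹) ⊗ a ≡ i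
    u₀-head = ⁻¹-inverseˡ a a≢o
    y₀-head : b ⊕ (b ⊗ ((a ⁻¹) ⊗ a)) ≡ o
    y₀-head = trans (cong (λ z → b ⊕ (b ⊗ z)) u₀-head) (identity₁ (λ b → b ⊕ (b ⊗ i)) (λ _ → o) tt b)
    y₁ : Vecs k
    y₁ = y +ᵥ (b ·ᵥ ((a ⁻¹) ·ᵥ x))
    ind-uy : Indep ((b ∷ y) ∷ u₀ ∷ [])
    ind-uy = Indep-swap (indep λ { (c ∷ d ∷ []) e →
      let q = independent ind ((c ⊗ (a ⁻¹)) ∷ d ∷ []) (trans (cong (_+ᵥ ((d ·ᵥ (b ∷ y)) +ᵥ 0ᵥ)) (·ᵥ-assoc c (a ⁻¹) (a ∷ x))) e)
      in cong₂ (λ c d → c ∷ d ∷ [])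
           (trans (sym (trans (⊗-assoc c (a ⁻¹) a) (trans (cong (c ⊗_) u₀-head) (trans (⊗-comm c i) (⊗-identityˡ c)))))
             (cong (_⊗ a) (∷-head q)))
           (∷-head (∷-tail q)) })
    y₁≢0 : y₁ ≢ 0ᵥ
    y₁≢0 e = Indep⇒≢0 (Indep-pencil b ind-uy) (cong₂ _∷_ y₀-head e)
    c : GF4
    c = proj₁ (normalize y₁ y₁≢0)
    c≢o : c ≢ o
    c≢o = proj₁ (proj₂ (normalize y₁ y₁≢0))
    v = o ∷ (c ·ᵥ y₁)
    nv : T (normalized (c ·ᵥ y₁))
    nv = proj₂ (proj₂ (normalize y₁ y₁≢0))
    e : GF4
    e = entryAt (pivot (c ·ᵥ y₁)) ((a ⁻¹) ·ᵥ x)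
    u = i ∷ (((a ⁻¹) ·ᵥ x) +ᵥ (e ·ᵥ (c ·ᵥ y₁)))
    clear : entryAt (pivot (c ·ᵥ y₁)) (((a ⁻¹) ·ᵥ x) +ᵥ (e ·ᵥ (c ·ᵥ y₁))) ≡ o
    clear = trans (entryAt-+ (pivot (c ·ᵥ y₁)) ((a ⁻¹) ·ᵥ x) (e ·ᵥ (c ·ᵥ y₁))) (trans (cong (e ⊕_)
      (trans (entryAt-· (pivot (c ·ᵥ y₁)) e (c ·ᵥ y₁)) (cong (e ⊗_) (pivot-entry (c ·ᵥ y₁) nv))))
      (identity₁ (λ e → e ⊕ (e ⊗ i)) (λ _ → o) tt e))
    ok : T (isRREF (u , v))
    ok = T-∧ nv (T-∧ {true} tt (subst (λ z → T (z == o)) (sym clear) tt))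
    to-uy : SameSpan ((a ∷ x) ∷ (b ∷ y) ∷ []) ((b ∷ y) ∷ u₀ ∷ [])
    to-uy φ = trans (sym (Sp-scale (a ⁻¹) (⁻¹-nonzero a a≢o) (a ∷ x) ((b ∷ y) ∷ []) φ)) (Sp-swap u₀ (b ∷ y) [] φ)
    to-uy₀ : SameSpan ((b ∷ y) ∷ u₀ ∷ []) (y₀ ∷ u₀ ∷ [])
    to-uy₀ φ = sym (Sp-shear (b ∷ y) u₀ b [] φ)
    cy₀ : c ·ᵥ y₀ ≡ v
    cy₀ = cong₂ _∷_ (trans (cong (c ⊗_) y₀-head) (⊗-zeroʳ c)) refl
    to-u₀v : SameSpan (y₀ ∷ u₀ ∷ []) (u₀ ∷ v ∷ [])
    to-u₀v φ = trans (sym (Sp-scale c c≢o y₀ (u₀ ∷ []) φ))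
      (trans (cong (λ z → Sp (z ∷ u₀ ∷ []) φ) cy₀) (Sp-swap v u₀ [] φ))
    to-uv : SameSpan (u₀ ∷ v ∷ []) (u ∷ v ∷ [])
    to-uv φ = trans (sym (Sp-shear u₀ v e [] φ)) (cong (λ z → Sp (z ∷ v ∷ []) φ)
      (cong₂ _∷_ (trans (cong₂ _⊕_ u₀-head (⊗-zeroʳ e)) refl) refl))

rref : ∀ {k} (x y : Vecs k) → Indep (x ∷ y ∷ []) →
       ∃[ u ] ∃[ v ] T (isRREF (u , v)) × SameSpan (x ∷ y ∷ []) (u ∷ v ∷ [])
rref [] [] ind = ⊥-elim (Indep⇒≢0 ind refl)
rref {suc k} (a ∷ x) (b ∷ y) ind = go (a ≟₄ o) (b ≟₄ o)
  where
  go : a ≡ o ⊎ a ≢ o → b ≡ o ⊎ b ≢ o →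
       ∃[ u ] ∃[ v ] T (isRREF (u , v)) × SameSpan ((a ∷ x) ∷ (b ∷ y) ∷ []) (u ∷ v ∷ [])
  go (inj₂ a≢o) _ = rref-head a x y b a≢o ind
  go (inj₁ refl) (inj₂ b≢o) =
    let u , v , t , same = rref-head b y x o b≢o (Indep-swap ind)
    in u , v , t , λ φ → trans (Sp-swap (o ∷ x) (b ∷ y) [] φ) (same φ)
  go (inj₁ refl) (inj₁ refl) =
    let u , v , t , same = rref x y (indep λ A e → independent ind A (trans (lin-o∷ x y A) (cong (o ∷_) e)))
    in o ∷ u , o ∷ v , t , λ φ →
       trans (Σᵥ-cong 2 λ A → cong φ (lin-o∷ x y A)) (trans (same λ z → φ (o ∷ z))
         (Σᵥ-cong 2 λ A → cong φ (sym (lin-o∷ u v A))))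

-- Incidence in the list encoding

elems-complete : ∀ a → a ∈ elems
elems-complete o = here refl
elems-complete i = there (here refl)
elems-complete w = there (there (here refl))
elems-complete w² = there (there (there (here refl)))

scalarPairs-complete : ∀ ab → ab ∈ scalarPairs
scalarPairs-complete (a , b) = ∈-cartesianProduct⁺ (elems-complete a) (elems-complete b)

comb-lin : ∀ {k} a b (u v : Vecs k) → comb (a , b) u v ≡ lin (u ∷ v ∷ []) (a ∷ b ∷ [])
comb-lin a b u v = cong ((a ·ᵥ u) +ᵥ_) (sym (+ᵥ-identityʳ (b ·ᵥ v)))

T⇒≡ : ∀ {b} → T b → b ≡ true
T⇒≡ {true} _ = refl

≡⇒T : ∀ {b} → b ≡ true → T b
≡⇒T refl = tt

Bool-ext : ∀ {a b} → (a ≡ true → b ≡ true) → (b ≡ true → a ≡ true) → a ≡ b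
Bool-ext {true} {b} f g = sym (f refl)
Bool-ext {false} {true} f g = g refl
Bool-ext {false} {false} f g = refl

inLine : ∀ {k} → Vecs k → Vecs k → Vecs k → Bool
inLine u v x = any (λ ab → comb ab u v =ᵥ x) scalarPairs

inLine-sound : ∀ {k} (u v x : Vecs k) → inLine u v x ≡ true → ∃[ A ] lin (u ∷ v ∷ []) A ≡ x
inLine-sound u v x h =
  let (a , b) , _ , t = find (any⁻ (λ ab → comb ab u v =ᵥ x) scalarPairs (≡⇒T h))
  in a ∷ b ∷ [] , trans (sym (comb-lin a b u v)) (=ᵥ-sound _ _ t)

inLine-complete : ∀ {k} (u v : Vecs k) A → inLine u v (lin (u ∷ v ∷ []) A) ≡ true
inLine-complete u v (a ∷ b ∷ []) = T⇒≡ (any⁺ (λ ab → comb ab u v =ᵥ z)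
  (lose (scalarPairs-complete (a , b)) (≡⇒T (trans (cong (_=ᵥ z) (comb-lin a b u v)) (=ᵥ-refl z)))))
  where
  z = lin (u ∷ v ∷ []) (a ∷ b ∷ [])

nonzero-pair : ∀ {a b} → (a , b) ∈ nonzeroPairs → a ∷ b ∷ [] ≢ 0ᵥ
nonzero-pair m refl = proj₂ (∈-filter⁻ (λ ab → T? (not (isZero (proj₁ ab) ∧ isZero (proj₂ ab)))) {xs = scalarPairs} m)

nonzero-pair-complete : ∀ {a b} → a ∷ b ∷ [] ≢ 0ᵥ → (a , b) ∈ nonzeroPairs
nonzero-pair-complete {a} {b} n =
  ∈-filter⁺ (λ ab → T? (not (isZero (proj₁ ab) ∧ isZero (proj₂ ab)))) (scalarPairs-complete (a , b)) (nz a b n)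
  where
  nz : ∀ a b → a ∷ b ∷ [] ≢ 0ᵥ → T (not (isZero a ∧ isZero b))
  nz o o n = n refl
  nz o i n = tt
  nz o w n = tt
  nz o w² n = tt
  nz i b n = tt
  nz w b n = tt
  nz w² b n = tt

-- Recognition of hyperplanes

Binary : ∀ {m} → (Vecs m → ℤ) → Set
Binary f = ∀ x → f x ≡ 0ℤ ⊎ f x ≡ 1ℤ

bit : ∀ {z} → z ≡ 0ℤ ⊎ z ≡ 1ℤ → ∃[ n ] n ≤ 1 × z ≡ + n
bit (inj₁ e) = 0 , z≤n , e
bit (inj₂ e) = 1 , s≤s z≤n , e

≤1⇒ : ∀ {n} → n ≤ 1 → n ≢ 0 → n ≡ 1
≤1⇒ {0} _ ne = ⊥-elim (ne refl)
≤1⇒ {1} _ _ = refl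
≤1⇒ {suc (suc _)} (s≤s ()) _

all-ones : ∀ (n : GF4 → ℕ) → (∀ c → n c ≤ 1) → Σℕ₄ n ≡ 4 → ∀ c → n c ≡ 1
all-ones n n≤1 e c = ≤1⇒ (n≤1 c) λ nc → ℕₚ.<⇒≱ (ℕₚ.≤-refl {4}) (subst (_≤ 3) e (bound c nc))
  where
  le : ∀ {a} → a ≡ 0 → a ≤ 0
  le = ℕₚ.≤-reflexive
  bound : ∀ c → n c ≡ 0 → Σℕ₄ n ≤ 3
  bound o z = ℕₚ.+-mono-≤ (le z) (ℕₚ.+-mono-≤ (n≤1 i) (ℕₚ.+-mono-≤ (n≤1 w) (n≤1 w²)))
  bound i z = ℕₚ.+-mono-≤ (n≤1 o) (ℕₚ.+-mono-≤ (le z) (ℕₚ.+-mono-≤ (n≤1 w) (n≤1 w²)))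
  bound w z = ℕₚ.+-mono-≤ (n≤1 o) (ℕₚ.+-mono-≤ (n≤1 i) (ℕₚ.+-mono-≤ (le z) (n≤1 w²)))
  bound w² z = ℕₚ.+-mono-≤ (n≤1 o) (ℕₚ.+-mono-≤ (n≤1 i) (ℕₚ.+-mono-≤ (n≤1 w) (le z)))

single-span : ∀ {m} {x y : Vecs m} → Indep (y ∷ []) → (∃[ c ] x ≡ c ·ᵥ y) ⊎ Indep (x ∷ y ∷ [])
single-span {x = x} {y} iy with inSpan? (y ∷ []) x
... | inj₁ (c ∷ [] , e) = inj₁ (c , trans (sym e) (+ᵥ-identityʳ (c ·ᵥ y)))
... | inj₂ n = inj₂ (Indep-∷ iy n)

0·+ : ∀ {m} (x y : Vecs m) → x +ᵥ (o ·ᵥ y) ≡ x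
0·+ x y = trans (cong (x +ᵥ_) (·ᵥ-zeroˡ y)) (+ᵥ-identityʳ x)

-- With values 0 and 1 and s = 1 the points of a line sum to 1 + 4X, so a line has one or five
-- points of value 1. Such a set of points is a hyperplane or the whole space.
module Ones {m} {f : Vecs m → ℤ} (C : CL f 1ℤ) (binary : Binary f) where

  private
    val : ∀ x → ∃[ n ] n ≤ 1 × f x ≡ + n
    val x = bit (binary x)

  module _ {x y : Vecs m} (ind : Indep (x ∷ y ∷ [])) where
    private
      n : GF4 → ℕ
      n c = proj₁ (val (x +ᵥ (c ·ᵥ y)))

    points : ∀ {k} → f y ≡ + k → k ℕ.+ Σℕ₄ n ≡ 1 ℕ.+ 4 ℕ.* X f 1ℤ x y
    points {k} e = ℤₚ.+-injective (trans (cong₂ _+_ (sym e) (Σ₄-cong {f = λ c → + n c} λ c → sym (proj₂ (proj₂ (val (x +ᵥ (c ·ᵥ y)))))))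
      (trans (line-points C x y ind) (cong (λ t → 1ℤ + t) (sym (ℤₚ.pos-* 4 (X f 1ℤ x y))))))

    full⇒one : X f 1ℤ x y ≡ 1 → f y ≡ 1ℤ × ∀ c → f (x +ᵥ (c ·ᵥ y)) ≡ 1ℤ
    full⇒one full = trans (proj₂ (proj₂ (val y))) (cong +_ ky≡1) , λ c →
        trans (proj₂ (proj₂ (val (x +ᵥ (c ·ᵥ y))))) (cong +_ (all-ones n (λ c → proj₁ (proj₂ (val (x +ᵥ (c ·ᵥ y))))) Σ≡4 c))
      where
      ky : ℕ
      ky = proj₁ (val y)
      sum : ky ℕ.+ Σℕ₄ n ≡ 5
      sum = trans (points (proj₂ (proj₂ (val y)))) (cong (λ t → 1 ℕ.+ 4 ℕ.* t) full)
      Σ≤4 : Σℕ₄ n ≤ 4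
      Σ≤4 = Σℕ₄-mono {n = λ _ → 1} λ c → proj₁ (proj₂ (val (x +ᵥ (c ·ᵥ y))))
      ky≡1 : ky ≡ 1
      ky≡1 = ≤1⇒ (proj₁ (proj₂ (val y))) λ z → ℕₚ.<⇒≱ (ℕₚ.≤-refl {5}) (subst (_≤ 4) (trans (sym (cong (ℕ._+ Σℕ₄ n) z)) sum) Σ≤4)
      Σ≡4 : Σℕ₄ n ≡ 4
      Σ≡4 = ℕₚ.+-cancelˡ-≡ 1 (Σℕ₄ n) 4 (trans (sym (cong (ℕ._+ Σℕ₄ n) ky≡1)) sum)

    one⇒full : f x ≡ 1ℤ → f y ≡ 1ℤ → X f 1ℤ x y ≡ 1
    one⇒full ex ey = go (X-bit f 1ℤ x y)
      where
      go : X f 1ℤ x y ≡ 0 ⊎ X f 1ℤ x y ≡ 1 → X f 1ℤ x y ≡ 1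
      go (inj₂ e) = e
      go (inj₁ e) = contradiction (trans (sym (trans (cong f (0·+ x y)) ex))
          (trans (proj₂ (proj₂ (val (x +ᵥ (o ·ᵥ y))))) (cong +_ (Σℕ₄-zero n Σ≡0 o)))) λ ()
        where
        Σ≡0 : Σℕ₄ n ≡ 0
        Σ≡0 = ℕₚ.+-cancelˡ-≡ 1 (Σℕ₄ n) 0 (trans (points ey) (cong (λ t → 1 ℕ.+ 4 ℕ.* t) e))

    some-one : f y ≡ 0ℤ → ∃[ c ] f (x +ᵥ (c ·ᵥ y)) ≡ 1ℤ
    some-one ey = go (n o ℕₚ.≟ 0) (n i ℕₚ.≟ 0) (n w ℕₚ.≟ 0) (n w² ℕₚ.≟ 0)
      where
      one : ∀ c → n c ≢ 0 → ∃[ c ] f (x +ᵥ (c ·ᵥ y)) ≡ 1ℤ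
      one c ne = c , trans (proj₂ (proj₂ (val (x +ᵥ (c ·ᵥ y))))) (cong +_ (≤1⇒ (proj₁ (proj₂ (val (x +ᵥ (c ·ᵥ y))))) ne))
      go : Dec (n o ≡ 0) → Dec (n i ≡ 0) → Dec (n w ≡ 0) → Dec (n w² ≡ 0) → ∃[ c ] f (x +ᵥ (c ·ᵥ y)) ≡ 1ℤ
      go (no h) _ _ _ = one o h
      go (yes _) (no h) _ _ = one i h
      go (yes _) (yes _) (no h) _ = one w h
      go (yes _) (yes _) (yes _) (no h) = one w² h
      go (yes e₀) (yes e₁) (yes e₂) (yes e₃) = contradiction (trans
        (sym (cong₂ ℕ._+_ e₀ (cong₂ ℕ._+_ e₁ (cong₂ ℕ._+_ e₂ e₃)))) (points ey)) λ ()

  ones-· : ∀ c {x} → f x ≡ 1ℤ → f (c ·ᵥ x) ≡ 1ℤ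
  ones-· c {x} e with c ≟₄ o
  ... | inj₁ refl = trans (cong f (·ᵥ-zeroˡ x)) (at-0 C)
  ... | inj₂ c≢o = trans (hom C c x c≢o) e

  ones-+ : ∀ {x y} → f x ≡ 1ℤ → f y ≡ 1ℤ → f (x +ᵥ y) ≡ 1ℤ
  ones-+ {x} {y} ex ey with y ≟ᵥ 0ᵥ
  ... | inj₁ refl = trans (cong f (+ᵥ-identityʳ x)) ex
  ... | inj₂ y≢0 with single-span {x = x} (Indep-single y≢0)
  ...   | inj₁ (c , refl) = trans (cong f (trans (cong ((c ·ᵥ y) +ᵥ_) (sym (·ᵥ-identity y))) (sym (·ᵥ-distribʳ c i y))))
          (ones-· (c ⊕ i) ey)
  ...   | inj₂ ind = trans (cong (λ z → f (x +ᵥ z)) (sym (·ᵥ-identity y))) (proj₂ (full⇒one ind (one⇒full ind ex ey)) i)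

  module _ {e : Vecs m} (fe : f e ≡ 0ℤ) where
    private
      e≢0 : e ≢ 0ᵥ
      e≢0 refl = contradiction (trans (sym (at-0 C)) fe) λ ()

      project : ∀ x → ∃[ c ] f (x +ᵥ (c ·ᵥ e)) ≡ 1ℤ
      project x with single-span {x = x} (Indep-single e≢0)
      ... | inj₁ (c , refl) = c , trans (cong f (+ᵥ-self (c ·ᵥ e))) (at-0 C)
      ... | inj₂ ind = some-one ind fe

      regroup : ∀ {k} (α β : GF4) c (u z e : Vecs k) →
                ((α ·ᵥ u) +ᵥ z) +ᵥ (((c ⊗ α) ⊕ β) ·ᵥ e) ≡ (α ·ᵥ (u +ᵥ (c ·ᵥ e))) +ᵥ (z +ᵥ (β ·ᵥ e))
      regroup α β c [] [] [] = refl
      regroup α β c (u ∷ us) (z ∷ zs) (e ∷ es) = cong₂ _∷_ (begin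
          ((α ⊗ u) ⊕ z) ⊕ (((c ⊗ α) ⊕ β) ⊗ e)
            ≡⟨ cong (((α ⊗ u) ⊕ z) ⊕_) (trans (⊗-distribʳ (c ⊗ α) β e)
                 (cong (_⊕ (β ⊗ e)) (trans (cong (_⊗ e) (⊗-comm c α)) (⊗-assoc α c e)))) ⟩
          ((α ⊗ u) ⊕ z) ⊕ ((α ⊗ (c ⊗ e)) ⊕ (β ⊗ e))
            ≡⟨ identity₄ (λ a b c d → (a ⊕ b) ⊕ (c ⊕ d)) (λ a b c d → (a ⊕ c) ⊕ (b ⊕ d)) tt
                 (α ⊗ u) z (α ⊗ (c ⊗ e)) (β ⊗ e) ⟩
          ((α ⊗ u) ⊕ (α ⊗ (c ⊗ e))) ⊕ (z ⊕ (β ⊗ e))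
            ≡⟨ cong (_⊕ (z ⊕ (β ⊗ e))) (sym (⊗-distribˡ α u (c ⊗ e))) ⟩
          (α ⊗ (u ⊕ (c ⊗ e))) ⊕ (z ⊕ (β ⊗ e)) ∎)
        (regroup α β c us zs es)
        where open ≡-Reasoning

      -- Projection from the point `e` of value 0: for each generator u some u + c e has value 1,
      -- and c becomes the coefficient of the form. Vectors of value 1 are closed under linear
      -- combinations, which extends this to the span.
      form-on : ∀ {j} (U : Vec (Vecs m) j) → ∃[ h ] ∀ A → f (lin U A +ᵥ (dot h A ·ᵥ e)) ≡ 1ℤ
      form-on [] = [] , λ { [] → trans (cong f (trans (+ᵥ-identityˡ (o ·ᵥ e)) (·ᵥ-zeroˡ e))) (at-0 C) }
      form-on (u ∷ U) =
        let c , fc = project u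
            h , fh = form-on U
        in c ∷ h , λ { (a ∷ A) → trans (cong f (regroup a (dot h A) c u (lin U A) e)) (ones-+ (ones-· a fc) (fh A)) }

      standard : ∀ k → Vec (Vecs k) k
      standard zero = []
      standard (suc k) = (i ∷ 0ᵥ) ∷ map (o ∷_) (standard k)

      lin-standard : ∀ {k} (x : Vecs k) → lin (standard k) x ≡ x
      lin-standard [] = refl
      lin-standard (a ∷ x) = trans (cong₂ _+ᵥ_ (cong₂ _∷_ (trans (⊗-comm a i) (⊗-identityˡ a)) (·ᵥ-zeroʳ a))
          (trans (lin-∷ (standard _) x) (cong (o ∷_) (lin-standard x))))
        (cong₂ _∷_ (⊕-identityʳ a) (+ᵥ-identityˡ x))
        where
        lin-∷ : ∀ {j k} (U : Vec (Vecs k) j) A → lin (map (o ∷_) U) A ≡ o ∷ lin U A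
        lin-∷ [] [] = refl
        lin-∷ (u ∷ U) (b ∷ A) rewrite lin-∷ U A = cong (λ z → z ∷ ((b ·ᵥ u) +ᵥ lin U A))
          (trans (⊕-identityʳ (b ⊗ o)) (⊗-zeroʳ b))

      h : Vecs m
      h = proj₁ (form-on (standard m))

      h-on : ∀ x → f (x +ᵥ (dot h x ·ᵥ e)) ≡ 1ℤ
      h-on x = trans (cong (λ z → f (z +ᵥ (dot h x ·ᵥ e))) (sym (lin-standard x))) (proj₂ (form-on (standard m)) x)

      kernel⇒one : ∀ x → dot h x ≡ o → f x ≡ 1ℤ
      kernel⇒one x hx = trans (cong f (sym (0·+ x e))) (trans (cong (λ c → f (x +ᵥ (c ·ᵥ e))) (sym hx)) (h-on x))

      one⇒kernel : ∀ x → f x ≡ 1ℤ → dot h x ≡ o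
      one⇒kernel x fx with dot h x ≟₄ o
      ... | inj₁ hx = hx
      -- Both x and x + h(x) e have value 1, hence so does their sum h(x) e, against the value 0 at
      -- `e`.
      ... | inj₂ hx = contradiction (trans (sym fe) (trans (sym (hom C (dot h x) e hx))
          (trans (cong f (cancel x (dot h x ·ᵥ e))) (ones-+ fx (h-on x))))) λ ()
        where
        cancel : ∀ x z → z ≡ x +ᵥ (x +ᵥ z)
        cancel x z = trans (sym (+ᵥ-identityˡ z)) (trans (cong (_+ᵥ z) (sym (+ᵥ-self x))) (+ᵥ-assoc x x z))

      dot-0 : ∀ {k} (x : Vecs k) → dot 0ᵥ x ≡ o
      dot-0 [] = refl
      dot-0 (a ∷ x) = dot-0 x

      dot-· : ∀ {k} c (h x : Vecs k) → dot (c ·ᵥ h) x ≡ c ⊗ dot h x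
      dot-· c [] [] = sym (⊗-zeroʳ c)
      dot-· c (a ∷ h) (b ∷ x) = trans (cong₂ _⊕_ (⊗-assoc c a b) (dot-· c h x)) (sym (⊗-distribˡ c (a ⊗ b) (dot h x)))

      h≢0 : h ≢ 0ᵥ
      h≢0 h0 = contradiction (trans (sym fe) (kernel⇒one e (trans (cong (λ h → dot h e) h0) (dot-0 e)))) λ ()

      scaled-kernel : ∀ c x → c ≢ o → dot (c ·ᵥ h) x ≡ o → dot h x ≡ o
      scaled-kernel c x c≢o e = trans (sym (trans (cong (_⊗ dot h x) (⁻¹-inverseˡ c c≢o)) (⊗-identityˡ (dot h x))))
        (trans (⊗-assoc (c ⁻¹) c (dot h x)) (trans (cong ((c ⁻¹) ⊗_) (trans (sym (dot-· c h x)) e)) (⊗-zeroʳ (c ⁻¹))))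

    hyperplane : ∃[ h ] T (normalized h) × ∀ x → (isZero (dot h x) ≡ true → f x ≡ 1ℤ) × (f x ≡ 1ℤ → isZero (dot h x) ≡ true)
    hyperplane =
      let c , c≢o , t = normalize h h≢0
      in c ·ᵥ h , t , λ x →
         (λ z → kernel⇒one x (scaled-kernel c x c≢o (==-sound _ o (≡⇒T z)))) ,
         (λ fx → trans (cong isZero (trans (dot-· c h x) (trans (cong (c ⊗_) (one⇒kernel x fx)) (⊗-zeroʳ c)))) refl)

-- From the function back to the line set

Link : ∀ {n} → (Vecs (suc n) → ℤ) → ℤ → LineSet n → Set
Link {n} f s L = ∀ u v (t : T (isRREF (u , v))) → X f s u v ≡ χ L ((u , v) , t)

χ-true : ∀ {n} (L : LineSet n) l → χ L l ≡ 1 → L l ≡ true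
χ-true L l e with L l
... | true = refl

true-χ : ∀ {n} (L : LineSet n) l → L l ≡ true → χ L l ≡ 1
true-χ L l e rewrite e = refl

∧-≡true : ∀ {a b} → a ∧ b ≡ true → a ≡ true × b ≡ true
∧-≡true {true} e = refl , e

hyperplane-lines : ∀ {m} {f : Vecs m → ℤ} (C : CL f 1ℤ) (binary : Binary f) {h : Vecs m} →
  (∀ x → (isZero (dot h x) ≡ true → f x ≡ 1ℤ) × (f x ≡ 1ℤ → isZero (dot h x) ≡ true)) →
  ∀ {u v} → Indep (u ∷ v ∷ []) →
  (X f 1ℤ u v ≡ 1 → isZero (dot h u) ∧ isZero (dot h v) ≡ true) ×
  (isZero (dot h u) ∧ isZero (dot h v) ≡ true → X f 1ℤ u v ≡ 1)
hyperplane-lines {f = f} C binary ch {u} {v} ind =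
  (λ e → let fv , fu = Ones.full⇒one C binary ind e
         in cong₂ _∧_ (proj₂ (ch u) (trans (cong f (sym (0·+ u v))) (fu o))) (proj₂ (ch v) fv)) ,
  (λ e → let hu , hv = ∧-≡true e in Ones.one⇒full C binary ind (proj₁ (ch u) hu) (proj₁ (ch v) hv))

is0 : ℤ → Bool
is0 (+ 0) = true
is0 _ = false

is0-sound : ∀ z → is0 z ≡ true → z ≡ 0ℤ
is0-sound (+ 0) _ = refl

binary-example : ∀ {n} {f : Vecs (suc n) → ℤ} {L : LineSet n} → CL f 1ℤ → Binary f → Link f 1ℤ L → IsExample n L
binary-example {n} {f} {L} C binary link with search (suc n) (λ x → is0 (f x))
... | inj₁ (e , h0) =
  let h , t , ch = Ones.hyperplane C binary (is0-sound _ h0)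
  in inj₂ (inj₁ ((h , t) , λ { ((u , v) , r) →
       let to , from = hyperplane-lines C binary {h} ch (line-indep r)
       in Bool-ext (λ e → to (trans (link u v r) (true-χ L ((u , v) , r) e)))
                   (λ e → χ-true L ((u , v) , r) (trans (sym (link u v r)) (from e))) }))
... | inj₂ none = inj₁ λ { ((u , v) , r) → χ-true L ((u , v) , r) (trans (sym (link u v r))
    (Ones.one⇒full C binary (line-indep r) (one u) (one v))) }
  where
  one : ∀ x → f x ≡ 1ℤ
  one x with binary x
  ... | inj₂ e = e
  ... | inj₁ e = contradiction (trans (sym (none x)) (cong is0 e)) λ ()

line-sum : ∀ {m} {φ : Vecs m → ℤ} {z} → φ 0ᵥ ≡ z → (∀ c x → c ≢ o → φ (c ·ᵥ x) ≡ φ x) → ∀ x u →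
           Sp (x ∷ u ∷ []) φ ≡ z + + 3 * (φ u + Σ₄ λ c → φ (x +ᵥ (c ·ᵥ u)))
line-sum {φ = φ} {z} φ0 hom x u = trans (p (Sp (x ∷ u ∷ []) φ) z)
  (trans (cong (_- + 4 * z) (trans (cong (λ t → Sp (x ∷ u ∷ []) φ + + 4 * t) (sym (trans (Sp₀ φ) φ0)))
      (trans (Sp-pencil x u [] φ) (cong₂ _+_ (pt u) (Σ₄-cong λ c → pt (x +ᵥ (c ·ᵥ u)))))))
    (p' z (φ u) (φ (x +ᵥ (o ·ᵥ u))) (φ (x +ᵥ (i ·ᵥ u))) (φ (x +ᵥ (w ·ᵥ u))) (φ (x +ᵥ (w² ·ᵥ u)))))
  where
  pt : ∀ v → Sp (v ∷ []) φ ≡ z + + 3 * φ v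
  pt v = Sp-point φ0 v λ c → hom c v
  p : ∀ S z → S ≡ S + + 4 * z - + 4 * z
  p = solve-∀
  p' : ∀ z a b c d e → ((z + + 3 * a) + ((z + + 3 * b) + ((z + + 3 * c) + ((z + + 3 * d) + (z + + 3 * e))))) - + 4 * z
     ≡ z + + 3 * (a + (b + (c + (d + e))))
  p' = solve-∀

-- All lines on `P` are in the class, and the other four points of each sum to `s`. Replacing the
-- value 4 by 0 therefore removes exactly these lines from the class and leaves a function with
-- values 0 and 1.
module Star {n} {f : Vecs (suc n) → ℤ} {s} {L : LineSet n} (C : CL f s) (sbit : Bit s) (3≤m : 3 ≤ suc n)
            (link : Link f s L) {P : Vecs (suc n)} (fP : f P ≡ + 4) where

  open Four C sbit 3≤m fP

  private
    iP : Indep (P ∷ [])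
    iP = Indep-single P≢0

    scale : ∃[ c ] c ≢ o × T (normalized (c ·ᵥ P))
    scale = normalize P P≢0

    c₀ : GF4
    c₀ = proj₁ scale

    point : Point n
    point = c₀ ·ᵥ P , proj₂ (proj₂ scale)

    on⇒through : ∀ u v → inLine u v (c₀ ·ᵥ P) ≡ true → ∃[ A ] lin (u ∷ v ∷ []) A ≡ P
    on⇒through u v h =
      let A , e = inLine-sound u v (c₀ ·ᵥ P) h
      in (c₀ ⁻¹) ·ᵥ A , trans (lin-· (u ∷ v ∷ []) (c₀ ⁻¹) A)
           (trans (cong ((c₀ ⁻¹) ·ᵥ_) e) (·ᵥ-cancel c₀ (proj₁ (proj₂ scale)) P))

    through⇒on : ∀ u v A → lin (u ∷ v ∷ []) A ≡ P → inLine u v (c₀ ·ᵥ P) ≡ true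
    through⇒on u v A e = subst (λ x → inLine u v x ≡ true) (trans (lin-· (u ∷ v ∷ []) c₀ A) (cong (c₀ ·ᵥ_) e))
      (inLine-complete u v (c₀ ·ᵥ A))

    rebased : ∀ {u v} → Indep (u ∷ v ∷ []) → ∀ A → lin (u ∷ v ∷ []) A ≡ P →
              ∃[ x ] Indep (x ∷ P ∷ []) × SameSpan (u ∷ v ∷ []) (x ∷ P ∷ [])
    rebased {u} {v} ind A refl = rebase₂ ind {A} λ A0 → P≢0 (trans (cong (lin (u ∷ v ∷ [])) A0) (lin-0 (u ∷ v ∷ [])))

    through-full : ∀ {u v} → Indep (u ∷ v ∷ []) → ∀ A → lin (u ∷ v ∷ []) A ≡ P → X f s u v ≡ 1
    through-full ind A e =
      let x , ind' , same = rebased ind A e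
      in trans (cong (differs s) (same f)) (full x ind')

    line-rest : ∀ x → Indep (x ∷ P ∷ []) → Σ₄ (λ c → f (x +ᵥ (c ·ᵥ P))) ≡ s
    line-rest x ind = trans (p₁ (f P) Σ') (trans (cong₂ _-_ (trans (line-points C x P ind)
        (cong (λ k → s + + 4 * + k) (full x ind))) fP) (p₂ s))
      where
      Σ' : ℤ
      Σ' = Σ₄ λ c → f (x +ᵥ (c ·ᵥ P))
      p₁ : ∀ a b → b ≡ (a + b) - a
      p₁ = solve-∀
      p₂ : ∀ s → (s + + 4 * + 1) - + 4 ≡ s
      p₂ = solve-∀

  trimmed : Vecs (suc n) → ℤ
  trimmed x with x ≟ᵥ 0ᵥ | single-span {x = x} iP
  -- The zero vector is tested first: it is a multiple of `P` as well, but has to keep the value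
  -- `s`.
  ... | inj₁ _ | _ = s
  ... | inj₂ _ | inj₁ _ = 0ℤ
  ... | inj₂ _ | inj₂ _ = f x

  trimmed-0 : trimmed 0ᵥ ≡ s
  trimmed-0 with 0ᵥ {suc n} ≟ᵥ 0ᵥ | single-span {x = 0ᵥ} iP
  ... | inj₁ _ | _ = refl
  ... | inj₂ n | _ = ⊥-elim (n refl)

  private
    independent-of : ∀ {c} → Indep ((c ·ᵥ P) ∷ P ∷ []) → ⊥
    independent-of {c} ind with ∷-head (independent ind (i ∷ c ∷ []) (trans (cong₂ _+ᵥ_ (·ᵥ-identity (c ·ᵥ P))
        (+ᵥ-identityʳ (c ·ᵥ P))) (+ᵥ-self (c ·ᵥ P))))
    ... | ()

  trimmed-multiple : ∀ c → c ≢ o → trimmed (c ·ᵥ P) ≡ 0ℤ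
  trimmed-multiple c c≢o with (c ·ᵥ P) ≟ᵥ 0ᵥ | single-span {x = c ·ᵥ P} iP
  ... | inj₁ e | _ = ⊥-elim (P≢0 (trans (sym (·ᵥ-cancel c c≢o P)) (trans (cong ((c ⁻¹) ·ᵥ_) e) (·ᵥ-zeroʳ (c ⁻¹)))))
  ... | inj₂ _ | inj₁ _ = refl
  ... | inj₂ _ | inj₂ ind = ⊥-elim (independent-of ind)

  trimmed-other : ∀ x → Indep (x ∷ P ∷ []) → trimmed x ≡ f x
  trimmed-other x ind with x ≟ᵥ 0ᵥ | single-span {x = x} iP
  ... | inj₁ e | _ = ⊥-elim (Indep⇒≢0 ind e)
  ... | inj₂ _ | inj₁ (c , refl) = ⊥-elim (independent-of ind)
  ... | inj₂ _ | inj₂ _ = refl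

  trimmed-binary : Binary trimmed
  trimmed-binary x with x ≟ᵥ 0ᵥ | single-span {x = x} iP
  ... | inj₁ _ | _ = sbit
  ... | inj₂ _ | inj₁ _ = inj₁ refl
  ... | inj₂ _ | inj₂ ind = elsewhere x ind

  private
    scale-indep : ∀ c x → c ≢ o → Indep (x ∷ P ∷ []) → Indep ((c ·ᵥ x) ∷ P ∷ [])
    scale-indep c x c≢o ind = Indep-∷ iP λ A e → h A e
      where
      h : ∀ A → lin (P ∷ []) A ≢ c ·ᵥ x
      h A e with ∷-head (independent ind (i ∷ ((c ⁻¹) ·ᵥ A)) (trans (cong₂ _+ᵥ_ (·ᵥ-identity x)
          (trans (lin-· (P ∷ []) (c ⁻¹) A) (trans (cong ((c ⁻¹) ·ᵥ_) e) (·ᵥ-cancel c c≢o x)))) (+ᵥ-self x)))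
      ... | ()

    trimmed-hom : ∀ c x → c ≢ o → trimmed (c ·ᵥ x) ≡ trimmed x
    trimmed-hom c x c≢o = go (x ≟ᵥ 0ᵥ) (single-span {x = x} iP)
      where
      go : x ≡ 0ᵥ ⊎ x ≢ 0ᵥ → (∃[ a ] x ≡ a ·ᵥ P) ⊎ Indep (x ∷ P ∷ []) → trimmed (c ·ᵥ x) ≡ trimmed x
      go (inj₁ refl) _ = cong trimmed (·ᵥ-zeroʳ c)
      go (inj₂ x≢0) (inj₂ ind) = trans (trimmed-other (c ·ᵥ x) (scale-indep c x c≢o ind))
        (trans (hom C c x c≢o) (sym (trimmed-other x ind)))
      go (inj₂ x≢0) (inj₁ (a , refl)) = trans (cong trimmed (sym (·ᵥ-assoc c a P)))
        (trans (trimmed-multiple (c ⊗ a) (nz c a c≢o a≢o)) (sym (trimmed-multiple a a≢o)))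
        where
        a≢o : a ≢ o
        a≢o refl = x≢0 (·ᵥ-zeroˡ P)
        nz : ∀ c a → c ≢ o → a ≢ o → c ⊗ a ≢ o
        nz c a c≢o a≢o e = a≢o (trans (sym (trans (cong (_⊗ a) (⁻¹-inverseˡ c c≢o)) (⊗-identityˡ a)))
          (trans (⊗-assoc (c ⁻¹) c a) (trans (cong ((c ⁻¹) ⊗_) e) (⊗-zeroʳ (c ⁻¹)))))

    trimmed-through : ∀ x → Indep (x ∷ P ∷ []) → Sp (x ∷ P ∷ []) trimmed ≡ + 4 * s
    trimmed-through x ind = trans (line-sum trimmed-0 trimmed-hom x P) (trans (cong (λ t → s + + 3 * t)
        (cong₂ _+_ (trans (cong trimmed (sym (·ᵥ-identity P))) (trimmed-multiple i λ ()))
          (trans (Σ₄-cong λ c → trimmed-other (x +ᵥ (c ·ᵥ P)) (Indep-shear c ind)) (line-rest x ind))))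
      (p s))
      where
      p : ∀ s → s + + 3 * (0ℤ + s) ≡ + 4 * s
      p = solve-∀

    trimmed-off : ∀ {u v} → Indep (u ∷ v ∷ []) → (∀ A → lin (u ∷ v ∷ []) A ≢ P) →
                  Sp (u ∷ v ∷ []) trimmed ≡ Sp (u ∷ v ∷ []) f
    trimmed-off {u} {v} ind off = Σᵥ-cong 2 λ A → at A (A ≟ᵥ 0ᵥ) (single-span {x = lin (u ∷ v ∷ []) A} iP)
      where
      at : ∀ A → A ≡ 0ᵥ ⊎ A ≢ 0ᵥ → (∃[ a ] lin (u ∷ v ∷ []) A ≡ a ·ᵥ P) ⊎ Indep (lin (u ∷ v ∷ []) A ∷ P ∷ []) →
           trimmed (lin (u ∷ v ∷ []) A) ≡ f (lin (u ∷ v ∷ []) A)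
      at A (inj₁ refl) _ = trans (cong trimmed (lin-0 (u ∷ v ∷ []))) (trans trimmed-0
        (sym (trans (cong f (lin-0 (u ∷ v ∷ []))) (at-0 C))))
      at A (inj₂ _) (inj₂ ind') = trimmed-other _ ind'
      at A (inj₂ A≢0) (inj₁ (a , e)) with a ≟₄ o
      ... | inj₁ refl = ⊥-elim (A≢0 (independent ind A (trans e (·ᵥ-zeroˡ P))))
      ... | inj₂ a≢o = ⊥-elim (off ((a ⁻¹) ·ᵥ A) (trans (lin-· (u ∷ v ∷ []) (a ⁻¹) A)
            (trans (cong ((a ⁻¹) ·ᵥ_) e) (·ᵥ-cancel a a≢o P))))

    trimmed-CL : CL trimmed s
    trimmed-CL = record { hom = trimmed-hom ; at-0 = trimmed-0 ; on-line = λ x y ind → lines x y ind (inSpan? (x ∷ y ∷ []) P) }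
      where
      lines : ∀ x y → Indep (x ∷ y ∷ []) → (∃[ A ] lin (x ∷ y ∷ []) A ≡ P) ⊎ (∀ A → lin (x ∷ y ∷ []) A ≢ P) →
              Sp (x ∷ y ∷ []) trimmed ≡ + 4 * s ⊎ Sp (x ∷ y ∷ []) trimmed ≡ + 4 * s + + 12
      lines x y ind (inj₁ (A , e)) =
        let x' , ind' , same = rebased ind A e
        in inj₁ (trans (same trimmed) (trimmed-through x' ind'))
      lines x y ind (inj₂ off) = subst (λ t → t ≡ + 4 * s ⊎ t ≡ + 4 * s + + 12) (sym (trimmed-off ind off)) (on-line C x y ind)

    membership : ∀ u v r →
      (∀ {A} → lin (u ∷ v ∷ []) A ≡ P → L ((u , v) , r) ≡ true × onLine point ((u , v) , r) ≡ true) ×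
      ((∀ A → lin (u ∷ v ∷ []) A ≢ P) → onLine point ((u , v) , r) ≡ false)
    membership u v r = (λ {A} e → χ-true L ((u , v) , r) (trans (sym (link u v r))
          (through-full (line-indep r) A e)) , through⇒on u v A e) ,
      λ off → not-true λ h → let A , e = on⇒through u v h in off A e
      where
      not-true : ∀ {b} → (b ≡ true → ⊥) → b ≡ false
      not-true {false} _ = refl
      not-true {true} h = ⊥-elim (h refl)

  star : s ≡ 0ℤ → IsExample n L
  star refl = inj₂ (inj₂ (inj₁ (point , λ { ((u , v) , r) → same u v r (inSpan? (u ∷ v ∷ []) P) })))
    where
    -- For s = 0 the other four points of a line on `P` have values 0 or 1 and sum 0.
    f≡0 : ∀ x → Indep (x ∷ P ∷ []) → f x ≡ 0ℤ
    f≡0 x ind = trans (cong f (sym (0·+ x P))) (trans (proj₂ (val o)) (cong +_ (Σℕ₄-zero k Σk≡0 o)))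
      where
      val : ∀ c → ∃[ k ] f (x +ᵥ (c ·ᵥ P)) ≡ + k
      val c = let k , _ , e = bit (elsewhere (x +ᵥ (c ·ᵥ P)) (Indep-shear c ind)) in k , e
      k : GF4 → ℕ
      k c = proj₁ (val c)
      Σk≡0 : Σℕ₄ k ≡ 0
      Σk≡0 = ℤₚ.+-injective (trans (Σ₄-cong {f = λ c → + k c} λ c → sym (proj₂ (val c))) (line-rest x ind))
    trimmed≡0 : ∀ x → trimmed x ≡ 0ℤ
    trimmed≡0 x with x ≟ᵥ 0ᵥ | single-span {x = x} iP
    ... | inj₁ _ | _ = refl
    ... | inj₂ _ | inj₁ _ = refl
    ... | inj₂ _ | inj₂ ind = f≡0 x ind
    same : ∀ u v r → (∃[ A ] lin (u ∷ v ∷ []) A ≡ P) ⊎ (∀ A → lin (u ∷ v ∷ []) A ≢ P) →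
           L ((u , v) , r) ≡ onLine point ((u , v) , r)
    same u v r (inj₁ (A , e)) = let l , on = proj₁ (membership u v r) {A} e in trans l (sym on)
    same u v r (inj₂ off) = trans (not-in (trans (sym (link u v r)) (cong (differs 0ℤ)
        (trans (sym (trimmed-off (line-indep r) off)) (Σᵥ-zero 2 λ A → trimmed≡0 (lin (u ∷ v ∷ []) A))))))
      (sym (proj₂ (membership u v r) off))
      where
      not-in : χ L ((u , v) , r) ≡ 0 → L ((u , v) , r) ≡ false
      not-in e with L ((u , v) , r)
      ... | false = refl

  star-or-hyperplane : s ≡ 1ℤ → IsExample n L
  star-or-hyperplane refl =
    let h , t , ch = Ones.hyperplane trimmed-CL trimmed-binary {P} (trans (cong trimmed (sym (·ᵥ-identity P))) (trimmed-multiple i λ ()))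
    in inj₂ (inj₂ (inj₂ (point , (h , t) , outside h ch , λ { ((u , v) , r) → same h t ch u v r (inSpan? (u ∷ v ∷ []) P) })))
    where
    Ch : Vecs (suc n) → Set
    Ch h = ∀ x → (isZero (dot h x) ≡ true → trimmed x ≡ 1ℤ) × (trimmed x ≡ 1ℤ → isZero (dot h x) ≡ true)
    -- The trimmed value at `P` is 0, while the hyperplane consists of the values 1.
    outside : ∀ h → Ch h → T (not (isZero (dot h (c₀ ·ᵥ P))))
    outside h ch with isZero (dot h (c₀ ·ᵥ P)) in e
    ... | false = tt
    ... | true = contradiction (trans (sym (trimmed-multiple c₀ (proj₁ (proj₂ scale)))) (proj₁ (ch (c₀ ·ᵥ P)) e)) λ ()
    same : ∀ h t → Ch h → ∀ u v r → (∃[ A ] lin (u ∷ v ∷ []) A ≡ P) ⊎ (∀ A → lin (u ∷ v ∷ []) A ≢ P) →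
           L ((u , v) , r) ≡ starOrIn point (h , t) ((u , v) , r)
    same h t ch u v r (inj₁ (A , e)) = let l , on = proj₁ (membership u v r) {A} e
      in trans l (sym (cong (_∨ lineInHyp ((u , v) , r) (h , t)) on))
    same h t ch u v r (inj₂ off) = trans
      (Bool-ext (λ e → to (trans X-same (trans (link u v r) (true-χ L ((u , v) , r) e))))
                (λ e → χ-true L ((u , v) , r) (trans (sym (link u v r)) (trans (sym X-same) (from e)))))
      (sym (cong (_∨ lineInHyp ((u , v) , r) (h , t)) (proj₂ (membership u v r) off)))
      where
      ind : Indep (u ∷ v ∷ [])
      ind = line-indep r
      X-same : X trimmed 1ℤ u v ≡ X f 1ℤ u v
      X-same = cong (differs 1ℤ) (trimmed-off ind off)
      both = hyperplane-lines trimmed-CL trimmed-binary {h} ch ind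
      to = proj₁ both
      from = proj₂ both

mirror-link : ∀ {n} {f : Vecs (suc n) → ℤ} {s} {L : LineSet n} → CL f s → Link f s L →
              Link (λ x → 1ℤ - f x) (1ℤ - s) (complement L)
mirror-link {f = f} {s} {L} C link u v r = go (L ((u , v) , r)) refl
  where
  ind : Indep (u ∷ v ∷ [])
  ind = line-indep r
  X' : ℕ
  X' = X (λ x → 1ℤ - f x) (1ℤ - s) u v
  sum : X f s u v ℕ.+ X' ≡ 1
  sum = ℤₚ.+-injective (ℤₚ.*-cancelˡ-≡ (+ 12) (+ X f s u v + + X') 1ℤ
    (trans (p s (+ X f s u v) (+ X')) (trans (cong (λ t → t - (+ 16 - (+ 4 * s + + 12 * + X f s u v)) + + 12)
      (trans (sym (line-value (mirror C) ind)) (trans (Sp-mirror f (u ∷ v ∷ [])) (cong (λ t → + 16 - t) (line-value C ind)))))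
      (p' (+ 16 - (+ 4 * s + + 12 * + X f s u v))))))
    where
    p : ∀ s x y → + 12 * (x + y) ≡ (+ 4 * (1ℤ - s) + + 12 * y) - (+ 16 - (+ 4 * s + + 12 * x)) + + 12
    p = solve-∀
    p' : ∀ z → z - z + + 12 ≡ + 12
    p' = solve-∀
  χ' : ∀ b → L ((u , v) , r) ≡ b → χ (complement L) ((u , v) , r) ≡ (if not b then 1 else 0)
  χ' b e rewrite e = refl
  χ₀ : ∀ b → L ((u , v) , r) ≡ b → X f s u v ≡ (if b then 1 else 0)
  χ₀ b e = trans (link u v r) (cong (λ b → if b then 1 else 0) e)
  go : ∀ b → L ((u , v) , r) ≡ b → X' ≡ χ (complement L) ((u , v) , r)
  go true e = trans (ℕₚ.+-cancelˡ-≡ 1 X' 0 (trans (cong (ℕ._+ X') (sym (χ₀ true e))) sum)) (sym (χ' true e))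
  go false e = trans (trans (cong (ℕ._+ X') (sym (χ₀ false e))) sum) (sym (χ' false e))

-- Normalisation modulo 5

classify : ∀ {n} {f : Vecs (suc n) → ℤ} {s} {L : LineSet n} → CL f s → Bit s → 4 ≤ n → Link f s L →
           IsExample n L ⊎ IsExample n (complement L)
classify {n} {f} {s} {L} C sbit 4≤n link = go (search (suc n) (λ x → is4 (f x))) (search (suc n) (λ x → is-3 (f x)))
  where
  5≤m : 5 ≤ suc n
  5≤m = s≤s 4≤n
  3≤m : 3 ≤ suc n
  3≤m = ℕₚ.≤-trans (ℕₚ.m≤m+n 3 2) 5≤m
  is4 is-3 : ℤ → Bool
  is4 (+ 4) = true
  is4 _ = false
  is-3 -[1+ 2 ] = true
  is-3 _ = false
  is4-sound : ∀ z → is4 z ≡ true → z ≡ + 4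
  is4-sound (+ 4) _ = refl
  is-3-sound : ∀ z → is-3 z ≡ true → z ≡ -[1+ 2 ]
  is-3-sound -[1+ 2 ] _ = refl
  with-4 : ∀ {f s L} → CL f s → Bit s → Link f s L → ∀ {P} → f P ≡ + 4 → IsExample n L
  with-4 {L = L} C (inj₁ e) link fP = Star.star {L = L} C (inj₁ e) 3≤m link fP e
  with-4 {L = L} C (inj₂ e) link fP = Star.star-or-hyperplane {L = L} C (inj₂ e) 3≤m link fP e
  without : ∀ {s} → CL f s → Bit s → Link f s L → Binary f → IsExample n L ⊎ IsExample n (complement L)
  without C (inj₂ refl) link binary = inj₁ (binary-example {L = L} C binary link)
  -- Hyperplanes are recognised for s = 1 only; for s = 0 the complementary class has parameter 1.
  without C (inj₁ refl) link binary = inj₂ (binary-example {L = complement L} (mirror C) flip (mirror-link {L = L} C link))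
    where
    flip : Binary (λ x → 1ℤ - f x)
    flip x = mirror-Bit (binary x)
  go : (∃[ x ] is4 (f x) ≡ true) ⊎ (∀ x → is4 (f x) ≡ false) →
       (∃[ x ] is-3 (f x) ≡ true) ⊎ (∀ x → is-3 (f x) ≡ false) → IsExample n L ⊎ IsExample n (complement L)
  go (inj₁ (P , h)) _ = inj₁ (with-4 {L = L} C sbit link (is4-sound (f P) h))
  go (inj₂ _) (inj₁ (P , h)) = inj₂ (with-4 {L = complement L} (mirror C) (mirror-Bit sbit) (mirror-link {L = L} C link)
    (cong (λ t → 1ℤ - t) (is-3-sound (f P) h)))
  go (inj₂ no-4) (inj₂ no-3) = without C sbit link λ x → binary (f x) (values C sbit 5≤m x) (no-4 x) (no-3 x)
    where
    binary : ∀ z → Value z → is4 z ≡ false → is-3 z ≡ false → z ≡ 0ℤ ⊎ z ≡ 1ℤ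
    binary _ value-0 _ _ = inj₁ refl
    binary _ value-1 _ _ = inj₂ refl

Sp-δ : ∀ {j k} {U : Vec (Vecs k) j} → Indep U → Sp U (δ 0ᵥ) ≡ 1ℤ
Sp-δ {j} {k} {U} ind = trans
  (Σᵥ-single j _ 0ᵥ λ A A≢0 → δ-distinct λ e → A≢0 (independent ind A (sym e)))
  (trans (cong (δ (0ᵥ {k})) (lin-0 U)) (δ-self (0ᵥ {k})))

Sp-+ : ∀ {j k} (U : Vec (Vecs k) j) (φ ψ : Vecs k → ℤ) → Sp U (λ x → φ x + ψ x) ≡ Sp U φ + Sp U ψ
Sp-+ {j} U φ ψ = Σᵥ-+ j (λ A → φ (lin U A)) (λ A → ψ (lin U A))

Sp-* : ∀ {j k} (U : Vec (Vecs k) j) c (φ : Vecs k → ℤ) → Sp U (λ x → c * φ x) ≡ c * Sp U φ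
Sp-* {j} U c φ = Σᵥ-* j c (λ A → φ (lin U A))

Sp-const : ∀ {j k} (U : Vec (Vecs k) j) c → Sp U (λ _ → c) ≡ pow4 j * c
Sp-const {j} U c = Σᵥ-const j c

δ-· : ∀ {k} c (x : Vecs k) → c ≢ o → δ 0ᵥ (c ·ᵥ x) ≡ δ 0ᵥ x
δ-· {k} c x c≢o with 0ᵥ ≟ᵥ x
... | inj₁ refl = cong (δ (0ᵥ {k})) (·ᵥ-zeroʳ c)
... | inj₂ ne = trans (δ-distinct λ e → ne (trans (sym (·ᵥ-zeroʳ (c ⁻¹))) (trans (cong ((c ⁻¹) ·ᵥ_) e) (·ᵥ-cancel c c≢o x))))
  (sym (δ-distinct ne))

-- The δ term keeps the value at 0 equal to the parameter, which drops by 5t.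
shifted : ∀ {m} → ℤ → (Vecs m → ℤ) → Vecs m → ℤ
shifted t f x = (f x + - t) + (- (+ 4 * t)) * δ 0ᵥ x

shifted-line : ∀ {m} t (f : Vecs m → ℤ) s {x y} k → Indep (x ∷ y ∷ []) → Sp (x ∷ y ∷ []) f ≡ + 4 * s + + 12 * k →
               Sp (x ∷ y ∷ []) (shifted t f) ≡ + 4 * (s - + 5 * t) + + 12 * k
shifted-line t f s {x} {y} k ind e = trans (Sp-+ (x ∷ y ∷ []) (λ x → f x + - t) (λ x → (- (+ 4 * t)) * δ 0ᵥ x))
  (trans (cong₂ _+_ (trans (Sp-+ (x ∷ y ∷ []) f (λ _ → - t)) (cong₂ _+_ e (Sp-const (x ∷ y ∷ []) (- t))))
      (trans (Sp-* (x ∷ y ∷ []) (- (+ 4 * t)) (δ 0ᵥ)) (cong (λ z → (- (+ 4 * t)) * z) (Sp-δ ind))))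
    (p s t k))
  where
  p : ∀ s t k → (+ 4 * s + + 12 * k + + 16 * - t) + (- (+ 4 * t)) * 1ℤ ≡ + 4 * (s - + 5 * t) + + 12 * k
  p = solve-∀

shift-CL : ∀ {m} t {f : Vecs m → ℤ} {s} → CL f s → CL (shifted t f) (s - + 5 * t)
shift-CL {m} t {f} {s} C = record
  { hom = λ c x c≢o → cong₂ (λ a b → (a + - t) + (- (+ 4 * t)) * b) (hom C c x c≢o) (δ-· c x c≢o)
  ; at-0 = trans (cong₂ (λ a b → (a + - t) + (- (+ 4 * t)) * b) (at-0 C) (δ-self (0ᵥ {m}))) (p s t)
  ; on-line = λ x y ind → lines x y ind (X-bit f s x y)
  }
  where
  p : ∀ s t → (s + - t) + (- (+ 4 * t)) * 1ℤ ≡ s - + 5 * t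
  p = solve-∀
  lines : ∀ x y → Indep (x ∷ y ∷ []) → X f s x y ≡ 0 ⊎ X f s x y ≡ 1 →
          Sp (x ∷ y ∷ []) (shifted t f) ≡ + 4 * (s - + 5 * t) ⊎ Sp (x ∷ y ∷ []) (shifted t f) ≡ + 4 * (s - + 5 * t) + + 12
  lines x y ind (inj₁ e) = inj₁ (trans (shifted-line t f s 0ℤ ind (trans (line-value C ind) (cong (λ k → + 4 * s + + 12 * + k) e)))
    (ℤₚ.+-identityʳ _))
  lines x y ind (inj₂ e) = inj₂ (shifted-line t f s 1ℤ ind (trans (line-value C ind) (cong (λ k → + 4 * s + + 12 * + k) e)))

differs-value : ∀ s k → k ≡ 0 ⊎ k ≡ 1 → differs s (+ 4 * s + + 12 * + k) ≡ k
differs-value s k h with (+ 4 * s + + 12 * + k) ℤₚ.≟ + 4 * s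
differs-value s k (inj₁ refl) | yes _ = refl
differs-value s k (inj₂ refl) | yes e = contradiction (trans (sym (p (+ 4 * s))) (trans (cong (_- + 4 * s) e) (p' (+ 4 * s)))) λ ()
  where
  p : ∀ z → z + + 12 - z ≡ + 12
  p = solve-∀
  p' : ∀ z → z - z ≡ 0ℤ
  p' = solve-∀
differs-value s k (inj₁ refl) | no n = ⊥-elim (n (ℤₚ.+-identityʳ _))
differs-value s k (inj₂ refl) | no _ = refl

shift-X : ∀ {m} t {f : Vecs m → ℤ} {s} → CL f s → ∀ {x y} → Indep (x ∷ y ∷ []) →
          X (shifted t f) (s - + 5 * t) x y ≡ X f s x y
shift-X t {f} {s} C {x} {y} ind = trans (cong (differs (s - + 5 * t))
    (shifted-line t f s (+ X f s x y) ind (line-value C ind)))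
  (differs-value (s - + 5 * t) (X f s x y) (X-bit f s x y))

solid-exists : ∀ {m} {f : Vecs m → ℤ} {s} → CL f s → {U : Vec (Vecs m) 4} → Indep U →
               ∃[ y ] Sp U f ≡ + 64 * s + + 12 * y
solid-exists {f = f} {s} C {t ∷ v ∷ x ∷ u ∷ []} ind = _ ,
  solid-value C t v x u ind (+ pencil-count f s v x u - f u) (λ c → + pencil-count f s (t +ᵥ (c ·ᵥ v)) x u - f u)
    (plane-value C v x u (Indep-tail ind)) (λ c → plane-value C (t +ᵥ (c ·ᵥ v)) x u (Indep-pencil c ind))

residue : ∀ z → ∃[ r ] ∃[ t ] r ℕ.< 5 × z ≡ + r + + 5 * t
residue z = z % + 5 , z / + 5 , n%d<d z (+ 5) , trans (a≡a%n+[a/n]*n z (+ 5)) (cong (λ t → + (z % + 5) + t) (ℤₚ.*-comm (z / + 5) (+ 5)))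

-- Only the residue of `y` matters, and for s = 2, 3, 4 none of the five makes 68 s (s - 1) + 12 y
-- (16 - y) divisible by 5.
modulo-5 : ∀ r → r ℕ.< 5 → ∀ W y → + 5 * W ≡ + 68 * weight (+ r) + + 12 * (y * (+ 16 - y)) → Bit (+ r)
modulo-5 r r<5 W y e with residue y
... | r' , t , r'<5 , refl = cases r r<5 r' r'<5 _ (trans (p W (+ r') t) (trans (cong (_- + 5 * K) e) (p' (weight (+ r)) (+ r') t)))
  where
  K : ℤ
  -- 5K is what 12 y (16 - y) loses when y = r' + 5t is replaced by r'.
  K = + 12 * (t * (+ 16 - (+ r' + + 5 * t)) - + r' * t)
  p : ∀ W r t → + 5 * (W - + 12 * (t * (+ 16 - (r + + 5 * t)) - r * t)) ≡ + 5 * W - + 5 * (+ 12 * (t * (+ 16 - (r + + 5 * t)) - r * t))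
  p = solve-∀
  p' : ∀ w r t → + 68 * w + + 12 * ((r + + 5 * t) * (+ 16 - (r + + 5 * t))) - + 5 * (+ 12 * (t * (+ 16 - (r + + 5 * t)) - r * t))
     ≡ + 68 * w + + 12 * (r * (+ 16 - r))
  p' = solve-∀
  cases : ∀ r → r ℕ.< 5 → ∀ r' → r' ℕ.< 5 → ∀ Z → + 5 * Z ≡ + 68 * weight (+ r) + + 12 * (+ r' * (+ 16 - + r')) → Bit (+ r)
  cases 0 _ _ _ _ _ = inj₁ refl
  cases 1 _ _ _ _ _ = inj₂ refl
  cases 2 _ 0 _ Z e = indivisible 5 136 Z e
  cases 2 _ 1 _ Z e = indivisible 5 316 Z e
  cases 2 _ 2 _ Z e = indivisible 5 472 Z e
  cases 2 _ 3 _ Z e = indivisible 5 604 Z e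
  cases 2 _ 4 _ Z e = indivisible 5 712 Z e
  cases 3 _ 0 _ Z e = indivisible 5 408 Z e
  cases 3 _ 1 _ Z e = indivisible 5 588 Z e
  cases 3 _ 2 _ Z e = indivisible 5 744 Z e
  cases 3 _ 3 _ Z e = indivisible 5 876 Z e
  cases 3 _ 4 _ Z e = indivisible 5 984 Z e
  cases 4 _ 0 _ Z e = indivisible 5 816 Z e
  cases 4 _ 1 _ Z e = indivisible 5 996 Z e
  cases 4 _ 2 _ Z e = indivisible 5 1152 Z e
  cases 4 _ 3 _ Z e = indivisible 5 1284 Z e
  cases 4 _ 4 _ Z e = indivisible 5 1392 Z e
  cases (suc (suc (suc (suc (suc _))))) (s≤s (s≤s (s≤s (s≤s (s≤s ()))))) _ _ _ _
  cases _ _ (suc (suc (suc (suc (suc _))))) (s≤s (s≤s (s≤s (s≤s (s≤s ()))))) _ _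

nonzero-vector : ∀ {m} → 1 ≤ m → ∃[ x ] x ≢ 0ᵥ {m}
nonzero-vector (s≤s _) = i ∷ 0ᵥ , λ ()

solid : ∀ {m} → 4 ≤ m → ∃[ U ] Indep {j = 4} {k = m} U
solid 4≤m =
  let u , u≢0 = nonzero-vector (ℕₚ.≤-trans (s≤s z≤n) 4≤m)
      x , ind₂ = Indep-extend (Indep-single u≢0) (ℕₚ.≤-trans (ℕₚ.m≤m+n 2 2) 4≤m)
      v , ind₃ = Indep-extend ind₂ (ℕₚ.≤-trans (ℕₚ.m≤m+n 3 1) 4≤m)
      t , ind₄ = Indep-extend ind₃ 4≤m
  in t ∷ v ∷ x ∷ u ∷ [] , ind₄

-- A single solid determines `s` modulo 5, and shifting by the quotient makes the residue itself the
-- parameter.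
classify-any : ∀ {n} {f : Vecs (suc n) → ℤ} {s} {L : LineSet n} → CL f s → 4 ≤ n → Link f s L →
               IsExample n L ⊎ IsExample n (complement L)
classify-any {n} {f} {s} {L} C 4≤n link =
  let r , t , r<5 , e = residue s
      C' = subst (CL (shifted t f)) (trans (cong (_- + 5 * t) e) (p (+ r) t)) (shift-CL t C)
      U , ind = solid (ℕₚ.≤-trans 4≤n (ℕₚ.n≤1+n n))
      y , ey = solid-exists C' ind
  in classify {L = L} C' (modulo-5 r r<5 (Sp U (wf (shifted t f))) y (solid-weight C' ind y ey)) 4≤n
       λ u v k → trans (cong (λ s → X (shifted t f) s u v) (sym (trans (cong (_- + 5 * t) e) (p (+ r) t))))
         (trans (shift-X t C (line-indep k)) (link u v k))
  where
  p : ∀ r t → r + + 5 * t - + 5 * t ≡ r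
  p = solve-∀

-- Sums over the list of all lines

⟦_⟧ : Bool → ℤ
⟦ b ⟧ = if b then 1ℤ else 0ℤ

sumL : ∀ {A : Set} → List A → (A → ℤ) → ℤ
sumL [] g = 0ℤ
sumL (x ∷ xs) g = g x + sumL xs g

sumL-cong : ∀ {A : Set} (xs : List A) {g h : A → ℤ} → (∀ x → g x ≡ h x) → sumL xs g ≡ sumL xs h
sumL-cong [] e = refl
sumL-cong (x ∷ xs) e = cong₂ _+_ (e x) (sumL-cong xs e)

private
  interchange : ∀ a b c d → (a + b) + (c + d) ≡ (a + c) + (b + d)
  interchange = solve-∀

sumL-+ : ∀ {A : Set} (xs : List A) (g h : A → ℤ) → sumL xs (λ x → g x + h x) ≡ sumL xs g + sumL xs h
sumL-+ [] g h = refl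
sumL-+ (x ∷ xs) g h = trans (cong (λ t → g x + h x + t) (sumL-+ xs g h)) (interchange (g x) (h x) (sumL xs g) (sumL xs h))

sumL-* : ∀ {A : Set} (xs : List A) c (g : A → ℤ) → sumL xs (λ x → c * g x) ≡ c * sumL xs g
sumL-* [] c g = sym (ℤₚ.*-zeroʳ c)
sumL-* (x ∷ xs) c g = trans (cong (λ t → c * g x + t) (sumL-* xs c g)) (sym (ℤₚ.*-distribˡ-+ c (g x) (sumL xs g)))

sumL-++ : ∀ {A : Set} (xs ys : List A) g → sumL (xs ++ ys) g ≡ sumL xs g + sumL ys g
sumL-++ [] ys g = sym (ℤₚ.+-identityˡ _)
sumL-++ (x ∷ xs) ys g = trans (cong (λ t → g x + t) (sumL-++ xs ys g)) (sym (ℤₚ.+-assoc (g x) (sumL xs g) (sumL ys g)))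

sumL-map : ∀ {A B : Set} (h : A → B) xs g → sumL (Data.List.map h xs) g ≡ sumL xs (λ x → g (h x))
sumL-map h [] g = refl
sumL-map h (x ∷ xs) g = cong (λ t → g (h x) + t) (sumL-map h xs g)

sumL-cartesian : ∀ {A B : Set} (xs : List A) (ys : List B) g →
                 sumL (cartesianProduct xs ys) g ≡ sumL xs λ x → sumL ys λ y → g (x , y)
sumL-cartesian [] ys g = refl
sumL-cartesian (x ∷ xs) ys g = trans (sumL-++ (Data.List.map (x ,_) ys) (cartesianProduct xs ys) g)
  (cong₂ _+_ (sumL-map (x ,_) ys g) (sumL-cartesian xs ys g))

sumL-filter : ∀ {A : Set} (p : A → Bool) xs → + length (filterᵇ p xs) ≡ sumL xs (λ x → ⟦ p x ⟧)
sumL-filter p [] = refl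
sumL-filter p (x ∷ xs) with p x
... | true = cong (λ t → 1ℤ + t) (sumL-filter p xs)
... | false = trans (sumL-filter p xs) (sym (ℤₚ.+-identityˡ _))

-- The definition of keep abstracts the equation f x ≡ b together with b, so a
-- with-abstraction of f x alone is ill-typed.  The dummy argument of unit type makes the two
-- sides g x tt and g x p of that equation convertible, but syntactically distinct.
private
  dummy : ∀ {A : Set} (g : A → ⊤ → Bool) p x → g x tt ≡ g x p
  dummy g p x = refl

  keep-step′ : ∀ {A : Set} (g : A → ⊤ → Bool) (p : ⊤) x xs →
    (Σ (g x tt ≡ true) λ e → keep (λ x → g x p) (x ∷ xs) ≡ (x , subst T {true} {g x tt} (sym e) tt) ∷ keep (λ x → g x p) xs) ⊎
    (g x tt ≡ false × keep (λ x → g x p) (x ∷ xs) ≡ keep (λ x → g x p) xs)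
  keep-step′ g p x xs with g x p | dummy g p x
  ... | true | e = inj₁ (e , refl)
  ... | false | e = inj₂ (e , refl)

keep-step : ∀ {A : Set} (f : A → Bool) x xs →
  (∃[ t ] keep f (x ∷ xs) ≡ (x , t) ∷ keep f xs) ⊎ (f x ≡ false × keep f (x ∷ xs) ≡ keep f xs)
keep-step f x xs with keep-step′ (λ x _ → f x) tt x xs
... | inj₁ (e , h) = inj₁ (subst T (sym e) tt , h)
... | inj₂ h = inj₂ h

-- Extension by zero, which turns a sum over a list filtered by `keep` into one over the unfiltered
-- list.
extend : ∀ b → (T b → ℤ) → ℤ
extend true φ = φ tt
extend false φ = 0ℤ

extend-at : ∀ b φ t → extend b φ ≡ φ t
extend-at true φ tt = refl

extend-false : ∀ b φ → b ≡ false → extend b φ ≡ 0ℤ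
extend-false .false φ refl = refl

extend-zero : ∀ b φ → (∀ t → φ t ≡ 0ℤ) → extend b φ ≡ 0ℤ
extend-zero true φ h = h tt
extend-zero false φ h = refl

sumL-keep : ∀ {A : Set} (f : A → Bool) xs (φ : Σ A (λ a → T (f a)) → ℤ) →
            sumL (keep f xs) φ ≡ sumL xs λ x → extend (f x) λ t → φ (x , t)
sumL-keep f [] φ = refl
sumL-keep f (x ∷ xs) φ with keep-step f x xs
... | inj₁ (t , e) = trans (cong (λ ys → sumL ys φ) e) (cong₂ _+_ (sym (extend-at (f x) (λ t → φ (x , t)) t)) (sumL-keep f xs φ))
... | inj₂ (n , e) = trans (cong (λ ys → sumL ys φ) e) (trans (sumL-keep f xs φ)
  (trans (sym (ℤₚ.+-identityˡ _)) (cong₂ _+_ (sym (extend-false (f x) (λ t → φ (x , t)) n)) refl)))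

opaque
  unfolding Σᵥ

  sumL-allVecs : ∀ k (g : Vecs k → ℤ) → sumL (allVecs k) g ≡ Σᵥ k g
  sumL-allVecs zero g = ℤₚ.+-identityʳ (g [])
  sumL-allVecs (suc k) g = trans (step o _) (cong (λ t → Σᵥ k (λ x → g (o ∷ x)) + t)
      (trans (step i _) (cong (λ t → Σᵥ k (λ x → g (i ∷ x)) + t)
      (trans (step w _) (cong (λ t → Σᵥ k (λ x → g (w ∷ x)) + t)
      (trans (step w² []) (ℤₚ.+-identityʳ _)))))))
    where
    step : ∀ a ys → sumL (Data.List.map (a ∷_) (allVecs k) ++ ys) g ≡ Σᵥ k (λ x → g (a ∷ x)) + sumL ys g
    step a ys = trans (sumL-++ (Data.List.map (a ∷_) (allVecs k)) ys g) (cong (_+ sumL ys g)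
      (trans (sumL-map (a ∷_) (allVecs k) g) (sumL-allVecs k λ x → g (a ∷ x))))

sumL-lines : ∀ n (φ : Line n → ℤ) →
  sumL (allLines n) φ ≡ Σᵥ (suc n) λ u → Σᵥ (suc n) λ v → extend (isRREF (u , v)) λ t → φ ((u , v) , t)
sumL-lines n φ = trans (sumL-keep isRREF (cartesianProduct (allVecs (suc n)) (allVecs (suc n))) φ)
  (trans (sumL-cartesian (allVecs (suc n)) (allVecs (suc n)) _)
  (trans (sumL-cong (allVecs (suc n)) λ u → sumL-allVecs (suc n) _) (sumL-allVecs (suc n) _)))

-- Expresses in summed form that each line occurs exactly once in `allLines`.
sumL-single : ∀ n (φ : Line n → ℤ) u v t →
  (∀ u' v' t' → u' ≢ u ⊎ v' ≢ v → φ ((u' , v') , t') ≡ 0ℤ) → sumL (allLines n) φ ≡ φ ((u , v) , t)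
sumL-single n φ u v t h = trans (sumL-lines n φ)
  (trans (Σᵥ-single (suc n) _ u λ u' u'≢u → Σᵥ-zero (suc n) λ v' →
            extend-zero (isRREF (u' , v')) (λ t' → φ ((u' , v') , t')) λ t' → h u' v' t' (inj₁ u'≢u))
  (trans (Σᵥ-single (suc n) _ v λ v' v'≢v →
            extend-zero (isRREF (u , v')) (λ t' → φ ((u , v') , t')) λ t' → h u v' t' (inj₂ v'≢v))
    (extend-at (isRREF (u , v)) (λ t' → φ ((u , v) , t')) t)))

sumL-Sp : ∀ {A : Set} {j k} (xs : List A) (U : Vec (Vecs k) j) (g : A → Vecs k → ℤ) →
          Sp U (λ x → sumL xs λ a → g a x) ≡ sumL xs λ a → Sp U (g a)
sumL-Sp {j = j} [] U g = Σᵥ-zero j λ _ → refl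
sumL-Sp (a ∷ xs) U g = trans (Sp-+ U (g a) (λ x → sumL xs λ a → g a x))
  (cong (λ t → Sp U (g a) + t) (sumL-Sp xs U g))

⟦∧⟧ : ∀ a b → ⟦ a ∧ b ⟧ ≡ ⟦ a ⟧ * ⟦ b ⟧
⟦∧⟧ true b = sym (ℤₚ.*-identityˡ ⟦ b ⟧)
⟦∧⟧ false b = sym (ℤₚ.*-zeroˡ ⟦ b ⟧)

⟦true⟧ : ∀ {b} → b ≡ true → ⟦ b ⟧ ≡ 1ℤ
⟦true⟧ refl = refl

⟦false⟧ : ∀ {b} → b ≡ false → ⟦ b ⟧ ≡ 0ℤ
⟦false⟧ refl = refl

≢true⇒false : ∀ {b} → b ≢ true → b ≡ false
≢true⇒false {false} _ = refl
≢true⇒false {true} n = ⊥-elim (n refl)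

-- Vectors common to two lines

meets-sound : ∀ {n} (m l : Line n) → meets m l ≡ true →
  ∃[ A ] A ≢ 0ᵥ × (∃[ B ] lin (proj₁ (proj₁ l) ∷ proj₂ (proj₁ l) ∷ []) A ≡ lin (proj₁ (proj₁ m) ∷ proj₂ (proj₁ m) ∷ []) B)
meets-sound ((u , v) , r) ((u' , v') , r') h =
  let (a , b) , mem , t = find (any⁻ (λ ab → any (λ cd → comb ab u v =ᵥ comb cd u' v') scalarPairs) nonzeroPairs (≡⇒T h))
      (c , d) , _ , t' = find (any⁻ (λ cd → comb (a , b) u v =ᵥ comb cd u' v') scalarPairs t)
      e = trans (sym (comb-lin a b u v)) (trans (=ᵥ-sound _ _ t') (comb-lin c d u' v'))
  in c ∷ d ∷ [] , (λ z → nonzero-pair {a} {b} mem (independent (line-indep r) (a ∷ b ∷ [])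
       (trans e (trans (cong (lin (u' ∷ v' ∷ [])) z) (lin-0 (u' ∷ v' ∷ [])))))) , a ∷ b ∷ [] , sym e

meets-complete : ∀ {n} (m l : Line n) A B → A ≢ 0ᵥ →
  lin (proj₁ (proj₁ l) ∷ proj₂ (proj₁ l) ∷ []) A ≡ lin (proj₁ (proj₁ m) ∷ proj₂ (proj₁ m) ∷ []) B → meets m l ≡ true
meets-complete ((u , v) , r) ((u' , v') , r') (c ∷ d ∷ []) (a ∷ b ∷ []) A≢0 e =
  T⇒≡ (any⁺ (λ ab → any (λ cd → comb ab u v =ᵥ comb cd u' v') scalarPairs)
    (lose (nonzero-pair-complete {a} {b} B≢0) (any⁺ (λ cd → comb (a , b) u v =ᵥ comb cd u' v')
      (lose (scalarPairs-complete (c , d)) (≡⇒T (trans (cong₂ _=ᵥ_ (comb-lin a b u v) (trans (comb-lin c d u' v') e))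
        (=ᵥ-refl (lin (u ∷ v ∷ []) (a ∷ b ∷ [])))))))))
  where
  B≢0 : a ∷ b ∷ [] ≢ 0ᵥ
  B≢0 z = A≢0 (independent (line-indep r') (c ∷ d ∷ [])
    (trans e (trans (cong (lin (u ∷ v ∷ [])) z) (lin-0 (u ∷ v ∷ [])))))

module Common {n} {u v u' v' : Vecs (suc n)} (r : T (isRREF (u , v))) (r' : T (isRREF (u' , v'))) where
  private
    m l : Line n
    m = (u , v) , r
    l = (u' , v') , r'
    U U' : Vec (Vecs (suc n)) 2
    U = u ∷ v ∷ []
    U' = u' ∷ v' ∷ []
    on : Vecs 2 → Bool
    on A = inLine u v (lin U' A)

    on-+ : ∀ A B → on A ≡ true → on B ≡ true → on (A +ᵥ B) ≡ true
    on-+ A B hA hB =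
      let A' , eA = inLine-sound u v (lin U' A) hA
          B' , eB = inLine-sound u v (lin U' B) hB
      in subst (λ x → inLine u v x ≡ true)
           (trans (lin-+ U A' B') (trans (cong₂ _+ᵥ_ eA eB) (sym (lin-+ U' A B)))) (inLine-complete u v (A' +ᵥ B'))

    on-· : ∀ c A → on A ≡ true → on (c ·ᵥ A) ≡ true
    on-· c A hA =
      let A' , eA = inLine-sound u v (lin U' A) hA
      in subst (λ x → inLine u v x ≡ true)
           (trans (lin-· U c A') (trans (cong (c ·ᵥ_) eA) (sym (lin-· U' c A)))) (inLine-complete u v (c ·ᵥ A'))

    on-0 : on 0ᵥ ≡ true
    on-0 = subst (λ x → inLine u v x ≡ true) (trans (lin-0 U) (sym (lin-0 U'))) (inLine-complete u v 0ᵥ)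

    all-on : ∀ {A B} → Indep (A ∷ B ∷ []) → on A ≡ true → on B ≡ true → ∀ E → on E ≡ true
    all-on {A} {B} ind hA hB E with basis-spans ind E
    ... | a ∷ b ∷ [] , refl = on-+ (a ·ᵥ A) ((b ·ᵥ B) +ᵥ 0ᵥ) (on-· a A hA) (on-+ (b ·ᵥ B) 0ᵥ (on-· b B hB) on-0)

    first : lin U' (i ∷ o ∷ []) ≡ u'
    first = trans (cong₂ _+ᵥ_ (·ᵥ-identity u') (trans (+ᵥ-identityʳ (o ·ᵥ v')) (·ᵥ-zeroˡ v'))) (+ᵥ-identityʳ u')
    second : lin U' (o ∷ i ∷ []) ≡ v'
    second = trans (cong₂ _+ᵥ_ (·ᵥ-zeroˡ u') (trans (+ᵥ-identityʳ (i ·ᵥ v')) (·ᵥ-identity v'))) (+ᵥ-identityˡ v')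

    all-on⇒same : (∀ E → on E ≡ true) → sameLine m l ≡ true
    all-on⇒same h =
      let A , eA = inLine-sound u v (lin U' (i ∷ o ∷ [])) (h (i ∷ o ∷ []))
          B , eB = inLine-sound u v (lin U' (o ∷ i ∷ [])) (h (o ∷ i ∷ []))
          eu , ev = rref-unique (rref-split {u = u} {v} r) (rref-split {u = u'} {v'} r') A B (trans eA first) (trans eB second)
      in cong₂ _∧_ (trans (cong (u =ᵥ_) (sym eu)) (=ᵥ-refl u)) (trans (cong (v =ᵥ_) (sym ev)) (=ᵥ-refl v))

    count : ℤ
    count = Σᵥ 2 λ A → ⟦ on A ⟧

    count-same : sameLine m l ≡ true → count ≡ + 16
    count-same h with =ᵥ-sound u u' (proj₁ (∧-T {u =ᵥ u'} (≡⇒T h))) | =ᵥ-sound v v' (proj₂ (∧-T {u =ᵥ u'} (≡⇒T h)))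
    ... | refl | refl = trans (Σᵥ-cong 2 {g = λ _ → 1ℤ} λ A → ⟦true⟧ (inLine-complete u v A)) (Σᵥ-const 2 1ℤ)

    -- Two independent common vectors would make the spans equal and, by uniqueness of echelon
    -- bases, the lines the same. So the common vectors are the four multiples of `A`.
    count-meet : sameLine m l ≢ true → (∃[ A ] A ≢ 0ᵥ × (∃[ B ] lin U' A ≡ lin U B)) → count ≡ + 4
    count-meet n (A , A≢0 , B , e) = trans (Σᵥ-support iA (λ A → ⟦ on A ⟧) λ E off → ⟦false⟧ (≢true⇒false λ onE →
        n (all-on⇒same (all-on (Indep-∷ iA off) onE onA))))
      (trans (Σᵥ-cong 1 {g = λ _ → 1ℤ} λ { (c ∷ []) → ⟦true⟧ (trans (cong on (+ᵥ-identityʳ (c ·ᵥ A))) (on-· c A onA)) })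
             (Σᵥ-const 1 1ℤ))
      where
      onA : on A ≡ true
      onA = subst (λ x → inLine u v x ≡ true) (sym e) (inLine-complete u v B)
      iA : Indep (A ∷ [])
      iA = Indep-single A≢0

    count-skew : meets m l ≢ true → count ≡ 1ℤ
    count-skew n = trans (Σᵥ-single 2 _ 0ᵥ λ A A≢0 → ⟦false⟧ (≢true⇒false λ onA →
        let B , e = inLine-sound u v (lin U' A) onA in n (meets-complete m l A B A≢0 (sym e)))) (⟦true⟧ on-0)

  -- The spans share 16, 4 or 1 vectors according as the lines coincide, meet in a point or are
  -- skew.
  common : Sp (u' ∷ v' ∷ []) (λ x → ⟦ inLine u v x ⟧)
         ≡ 1ℤ + (+ 3 * ⟦ not (sameLine m l) ∧ meets m l ⟧ + + 15 * ⟦ sameLine m l ⟧)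
  common = go (sameLine m l) (meets m l) refl refl
    where
    go : ∀ a b → sameLine m l ≡ a → meets m l ≡ b → count ≡ 1ℤ + (+ 3 * ⟦ not a ∧ b ⟧ + + 15 * ⟦ a ⟧)
    go true _ e _ = count-same e
    go false true e e' = count-meet (λ h → contradiction (trans (sym e) h) λ ()) (meets-sound m l e')
    go false false _ e' = count-skew λ h → contradiction (trans (sym e') h) λ ()

-- The number of lines through a point

module Lines {n} (L : LineSet n) (x : ℤ)
             (hyp : ∀ l → + meetCount L l ≡ + 5 * x + (+ geomPart n - 1ℤ) * + χ L l) where

  private
    lines : List (Line n)
    lines = allLines n

    onL : Line n → Vecs (suc n) → Bool
    onL ((u , v) , _) = inLine u v

    degree : Vecs (suc n) → ℤ
    degree z = sumL lines λ m → ⟦ L m ⟧ * ⟦ onL m z ⟧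

    size : ℤ
    size = sumL lines λ m → ⟦ L m ⟧

    zero-on : ∀ m → onL m 0ᵥ ≡ true
    zero-on ((u , v) , _) = subst (λ z → inLine u v z ≡ true) (lin-0 (u ∷ v ∷ [])) (inLine-complete u v 0ᵥ)

    degree-0 : degree 0ᵥ ≡ size
    degree-0 = sumL-cong lines λ m → trans (cong (λ t → ⟦ L m ⟧ * t) (⟦true⟧ (zero-on m))) (ℤₚ.*-identityʳ ⟦ L m ⟧)

    on-scale : ∀ m c z → onL m z ≡ true → onL m (c ·ᵥ z) ≡ true
    on-scale ((u , v) , _) c z h =
      let A , e = inLine-sound u v z h
      in subst (λ z → inLine u v z ≡ true) (trans (lin-· (u ∷ v ∷ []) c A) (cong (c ·ᵥ_) e)) (inLine-complete u v (c ·ᵥ A))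

    degree-· : ∀ c z → c ≢ o → degree (c ·ᵥ z) ≡ degree z
    degree-· c z c≢o = sumL-cong lines λ m → cong (λ b → ⟦ L m ⟧ * ⟦ b ⟧)
      (Bool-ext (λ h → subst (λ z → onL m z ≡ true) (·ᵥ-cancel c c≢o z) (on-scale m (c ⁻¹) (c ·ᵥ z) h)) (on-scale m c z))

    module _ (u v : Vecs (suc n)) (r : T (isRREF (u , v))) where
      l : Line n
      l = (u , v) , r

      meeting : + meetCount L l ≡ sumL lines λ m → ⟦ L m ⟧ * ⟦ not (sameLine m l) ∧ meets m l ⟧
      meeting = trans (sumL-filter (λ m → L m ∧ not (sameLine m l) ∧ meets m l) lines)
        (sumL-cong lines λ m → ⟦∧⟧ (L m) (not (sameLine m l) ∧ meets m l))

      ⟦⟧-χ : ⟦ L l ⟧ ≡ + χ L l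
      ⟦⟧-χ with L l
      ... | true = refl
      ... | false = refl

      itself : sumL lines (λ m → ⟦ L m ⟧ * ⟦ sameLine m l ⟧) ≡ + χ L l
      itself = trans (sumL-single n (λ m → ⟦ L m ⟧ * ⟦ sameLine m l ⟧) u v r λ u' v' t' h →
          trans (cong (λ t → ⟦ L ((u' , v') , t') ⟧ * t) (⟦false⟧ (distinct u' v' h))) (ℤₚ.*-zeroʳ ⟦ L ((u' , v') , t') ⟧))
        (trans (cong (λ t → ⟦ L l ⟧ * t) (⟦true⟧ (cong₂ _∧_ (=ᵥ-refl u) (=ᵥ-refl v))))
          (trans (ℤₚ.*-identityʳ ⟦ L l ⟧) ⟦⟧-χ))
        where
        distinct : ∀ u' v' → u' ≢ u ⊎ v' ≢ v → (u' =ᵥ u) ∧ (v' =ᵥ v) ≡ false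
        distinct u' v' (inj₁ ne) rewrite ≢⇒=ᵥ-false ne = refl
        distinct u' v' (inj₂ ne) rewrite ≢⇒=ᵥ-false ne = ∧-false (u' =ᵥ u)
          where
          ∧-false : ∀ b → b ∧ false ≡ false
          ∧-false true = refl
          ∧-false false = refl

      -- After exchanging the sums, each line of the class contributes the number of its vectors on
      -- `l`; the common zero vector adds up to `size`.
      degrees-on-line : Sp (u ∷ v ∷ []) degree ≡ size + (+ 3 * + meetCount L l + + 15 * + χ L l)
      degrees-on-line = trans (sumL-Sp lines (u ∷ v ∷ []) (λ m z → ⟦ L m ⟧ * ⟦ onL m z ⟧))
        (trans (sumL-cong lines each)
        (trans (sumL-+ lines (λ m → ⟦ L m ⟧) _) (cong (λ t → size + t)
        (trans (sumL-+ lines (λ m → + 3 * (⟦ L m ⟧ * ⟦ not (sameLine m l) ∧ meets m l ⟧)) (λ m → + 15 * (⟦ L m ⟧ * ⟦ sameLine m l ⟧)))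
          (cong₂ _+_
            (trans (sumL-* lines (+ 3) (λ m → ⟦ L m ⟧ * ⟦ not (sameLine m l) ∧ meets m l ⟧)) (cong (λ t → + 3 * t) (sym meeting)))
            (trans (sumL-* lines (+ 15) (λ m → ⟦ L m ⟧ * ⟦ sameLine m l ⟧)) (cong (λ t → + 15 * t) itself)))))))
        where
        p : ∀ a b c → a * (1ℤ + (+ 3 * b + + 15 * c)) ≡ a + (+ 3 * (a * b) + + 15 * (a * c))
        p = solve-∀
        each : ∀ m → Sp (u ∷ v ∷ []) (λ z → ⟦ L m ⟧ * ⟦ onL m z ⟧)
             ≡ ⟦ L m ⟧ + (+ 3 * (⟦ L m ⟧ * ⟦ not (sameLine m l) ∧ meets m l ⟧) + + 15 * (⟦ L m ⟧ * ⟦ sameLine m l ⟧))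
        each m@((u' , v') , r') = trans (Sp-* (u ∷ v ∷ []) ⟦ L m ⟧ (λ z → ⟦ onL m z ⟧))
          (trans (cong (λ t → ⟦ L m ⟧ * t) (Common.common {n} {u'} {v'} {u} {v} r' r))
            (p ⟦ L m ⟧ ⟦ not (sameLine m l) ∧ meets m l ⟧ ⟦ sameLine m l ⟧))

  -- The degree minus `x` at points, and 0 at the zero vector, where the degree is `size`. By the
  -- defining equation the five points of a line then sum to (geomPart n + 4) χ.
  excess : Vecs (suc n) → ℤ
  excess z = (degree z + - x) + (- (size - x)) * δ 0ᵥ z

  excess-0 : excess 0ᵥ ≡ 0ℤ
  excess-0 = trans (cong₂ (λ a b → (a + - x) + (- (size - x)) * b) degree-0 (δ-self (0ᵥ {suc n}))) (p size x)
    where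
    p : ∀ a x → (a + - x) + (- (a - x)) * 1ℤ ≡ 0ℤ
    p = solve-∀

  excess-· : ∀ c z → c ≢ o → excess (c ·ᵥ z) ≡ excess z
  excess-· c z c≢o = cong₂ (λ a b → (a + - x) + (- (size - x)) * b) (degree-· c z c≢o) (δ-· c z c≢o)

  excess-line : ∀ u v (r : T (isRREF (u , v))) →
                Sp (u ∷ v ∷ []) excess ≡ + 3 * ((+ geomPart n + + 4) * + χ L ((u , v) , r))
  excess-line u v r = trans (Sp-+ (u ∷ v ∷ []) (λ z → degree z + - x) (λ z → (- (size - x)) * δ 0ᵥ z))
    (trans (cong₂ _+_ (trans (Sp-+ (u ∷ v ∷ []) degree (λ _ → - x)) (cong₂ _+_ (degrees-on-line u v r) (Sp-const (u ∷ v ∷ []) (- x))))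
      (trans (Sp-* (u ∷ v ∷ []) (- (size - x)) (δ 0ᵥ)) (cong (λ t → (- (size - x)) * t) (Sp-δ (line-indep {u = u} {v} r)))))
    (trans (cong (λ t → ((size + (+ 3 * t + + 15 * c)) + + 16 * - x) + (- (size - x)) * 1ℤ) (hyp ((u , v) , r)))
      (p size x (+ geomPart n) c)))
    where
    c : ℤ
    c = + χ L ((u , v) , r)
    p : ∀ a x g c → ((a + (+ 3 * (+ 5 * x + (g - 1ℤ) * c) + + 15 * c)) + + 16 * - x) + (- (a - x)) * 1ℤ ≡ + 3 * ((g + + 4) * c)
    p = solve-∀

-- The sum is 4 (1 + 4 + ... + 4^(n-2)). Only divisibility and positivity of the quotient are
-- recorded, the latter because the quotient is cancelled later.
geomPart-multiple : ∀ n → 4 ≤ n → ∃[ d ] + geomPart n + + 4 ≡ + 4 * + suc d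
geomPart-multiple (suc zero) (s≤s ())
geomPart-multiple (suc (suc k)) _ =
  let d , e = multiple k (λ j → suc (suc j)) (λ j → suc j , refl)
  in d , trans (cong (λ t → + t + + 4) e) (trans (cong (_+ + 4) (ℤₚ.pos-* 4 d)) (p (+ d)))
  where
  p : ∀ d → + 4 * d + + 4 ≡ + 4 * (1ℤ + d)
  p = solve-∀
  -- Generalised over the exponents, since `drop 2 (upTo n)` reduces to `applyUpTo` of a shifted
  -- function; positive exponents provide the factor 4.
  multiple : ∀ k (g : ℕ → ℕ) → (∀ j → ∃[ h ] g j ≡ suc h) →
             ∃[ d ] ℕᴸ.sum (Data.List.map (4 ℕ.^_) (applyUpTo g k)) ≡ 4 ℕ.* d
  multiple zero g h = 0 , refl
  multiple (suc k) g h =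
    let d , e = multiple k (λ j → g (suc j)) (λ j → h (suc j))
        e₀ , e' = h 0
    in 4 ℕ.^ e₀ ℕ.+ d , trans (cong₂ ℕ._+_ (cong (4 ℕ.^_) e') e) (sym (ℕₚ.*-distribˡ-+ 4 (4 ℕ.^ e₀) d))

-- From point degrees to integral point values

module Rescale {n} (4≤n : 4 ≤ n) (L : LineSet n) (d : ℕ) (f : Vecs (suc n) → ℤ)
               (hom-f : ∀ c z → c ≢ o → f (c ·ᵥ z) ≡ f z) (f-0 : f 0ᵥ ≡ 0ℤ)
               (f-line : ∀ u v r → Sp (u ∷ v ∷ []) f ≡ + 3 * (+ 4 * + suc d * + χ L ((u , v) , r))) where

  private
    M : ℤ
    M = + suc d

    m : ℕ
    m = suc n

    χ-bit : ∀ l → χ L l ≡ 0 ⊎ χ L l ≡ 1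
    χ-bit l with L l
    ... | true = inj₂ refl
    ... | false = inj₁ refl

    line-f : ∀ {x y} → Indep (x ∷ y ∷ []) → ∃[ k ] Sp (x ∷ y ∷ []) f ≡ + 12 * (M * k)
    line-f {x} {y} ind =
      let u , v , r , same = rref x y ind
      in + χ L ((u , v) , r) , trans (same f) (trans (f-line u v r) (p M (+ χ L ((u , v) , r))))
      where
      p : ∀ M k → + 3 * (+ 4 * M * k) ≡ + 12 * (M * k)
      p = solve-∀

    plane-f : ∀ v x u → Indep (v ∷ x ∷ u ∷ []) → ∃[ k ] Sp (v ∷ x ∷ u ∷ []) f ≡ + 12 * (M * k - f u)
    plane-f v x u ind =
      let a , ea = line-f (Indep-tail ind)
          b = λ c → line-f (Indep-pencil c ind)
      in a + Σ₄ (λ c → proj₁ (b c)) ,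
         trans (p₁ (Sp (v ∷ x ∷ u ∷ []) f) (+ 4 * Sp (u ∷ []) f)) (trans (cong₂ _-_ (trans (Sp-pencil v x (u ∷ []) f)
             (cong₂ _+_ ea (Σ₄-cong λ c → proj₂ (b c)))) (cong (λ t → + 4 * t) (Sp-point {φ = f} f-0 u λ c → hom-f c u)))
           (p₂ M (f u) a (proj₁ (b o)) (proj₁ (b i)) (proj₁ (b w)) (proj₁ (b w²))))
      where
      p₁ : ∀ a b → a ≡ (a + b) - b
      p₁ = solve-∀
      p₂ : ∀ M z a b c d e → + 12 * (M * a) + (+ 12 * (M * b) + (+ 12 * (M * c) + (+ 12 * (M * d) + + 12 * (M * e)))) - + 4 * (0ℤ + + 3 * z)
         ≡ + 12 * (M * (a + (b + (c + (d + e)))) - z)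
      p₂ = solve-∀

    5≤m : 5 ≤ m
    5≤m = s≤s 4≤n

    base : ∃[ u ] u ≢ 0ᵥ {m}
    base = nonzero-vector (ℕₚ.≤-trans (s≤s z≤n) 5≤m)

    u₀ : Vecs m
    u₀ = proj₁ base

    c₀ : ℤ
    c₀ = f u₀

    -- If `z` and `u₀` are distinct points, they lie in a common plane. Its sum, computed from
    -- either point, gives M k - f u₀ = M k' - f z, so the two values agree modulo `M`.
    difference : ∀ z → z ≢ 0ᵥ → ∃[ e ] f z ≡ c₀ + M * e
    difference z z≢0 = go (single-span {x = z} (Indep-single (proj₂ base)))
      where
      go : (∃[ c ] z ≡ c ·ᵥ u₀) ⊎ Indep (z ∷ u₀ ∷ []) → ∃[ e ] f z ≡ c₀ + M * e
      go (inj₁ (c , refl)) = 0ℤ , trans (hom-f c u₀ λ { refl → z≢0 (·ᵥ-zeroˡ u₀) })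
        (sym (trans (cong (λ t → c₀ + t) (ℤₚ.*-zeroʳ M)) (ℤₚ.+-identityʳ c₀)))
      go (inj₂ ind) =
        let t , ind₃ = Indep-extend ind (ℕₚ.≤-trans (ℕₚ.m≤m+n 3 2) 5≤m)
            ind₃' = Indep-swap (Indep-rotate ind₃)
            k , e = plane-f t z u₀ ind₃
            k' , e' = plane-f t u₀ z ind₃'
            same = Sp-∷-cong t (z ∷ u₀ ∷ []) (u₀ ∷ z ∷ []) (Sp-swap z u₀ []) f
        in k' - k , solve-for M k k' c₀ (f z) (ℤₚ.*-cancelˡ-≡ (+ 12) (M * k - c₀) (M * k' - f z)
             (trans (sym e) (trans same e')))
        where
        Indep-rotate : ∀ {t} → Indep (t ∷ z ∷ u₀ ∷ []) → Indep (u₀ ∷ t ∷ z ∷ [])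
        Indep-rotate h = indep λ { (a ∷ b ∷ c ∷ []) e →
          let q = independent h (b ∷ c ∷ a ∷ []) (trans (rot _ _ _) e)
          in cong₂ _∷_ (∷-head (∷-tail (∷-tail q))) (cong₂ _∷_ (∷-head q) (cong (_∷ []) (∷-head (∷-tail q)))) }
          where
          rot : ∀ (x y z : Vecs m) → x +ᵥ (y +ᵥ (z +ᵥ 0ᵥ)) ≡ z +ᵥ (x +ᵥ (y +ᵥ 0ᵥ))
          rot x y z = trans (cong (λ t → x +ᵥ (y +ᵥ t)) (+ᵥ-identityʳ z)) (trans (sym (+ᵥ-assoc x y z))
            (trans (+ᵥ-comm (x +ᵥ y) z) (cong (λ t → z +ᵥ (x +ᵥ t)) (sym (+ᵥ-identityʳ y)))))
        solve-for : ∀ M k k' a b → M * k - a ≡ M * k' - b → b ≡ a + M * (k' - k)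
        solve-for M k k' a b e = trans (p M k k' a b) (trans (cong (λ t → (M * k' + a - M * k) + (t - (M * k' - b))) e) (p' M k k' a b))
          where
          p : ∀ M k k' a b → b ≡ (M * k' + a - M * k) + ((M * k - a) - (M * k' - b))
          p = solve-∀
          p' : ∀ M k k' a b → (M * k' + a - M * k) + ((M * k' - b) - (M * k' - b)) ≡ a + M * (k' - k)
          p' = solve-∀

    -- The quotient (f - c₀) / M at points. The value at 0 is provisional; `g` replaces it by `s`.
    g₀ : Vecs m → ℤ
    g₀ z with z ≟ᵥ 0ᵥ
    ... | inj₁ _ = 0ℤ
    ... | inj₂ z≢0 = proj₁ (difference z z≢0)

    g₀-0 : g₀ 0ᵥ ≡ 0ℤ
    g₀-0 with 0ᵥ {m} ≟ᵥ 0ᵥ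
    ... | inj₁ _ = refl
    ... | inj₂ n = ⊥-elim (n refl)

    f-g₀ : ∀ z → f z ≡ (c₀ + M * g₀ z) + (- c₀) * δ 0ᵥ z
    f-g₀ z with z ≟ᵥ 0ᵥ
    ... | inj₁ refl = trans f-0 (sym (trans (cong (λ t → (c₀ + M * 0ℤ) + (- c₀) * t) (δ-self (0ᵥ {m}))) (p c₀ M)))
      where
      p : ∀ c M → (c + M * 0ℤ) + (- c) * 1ℤ ≡ 0ℤ
      p = solve-∀
    ... | inj₂ z≢0 = trans (proj₂ (difference z z≢0)) (sym (trans (cong (λ t → (c₀ + M * e) + (- c₀) * t) (δ-distinct λ h → z≢0 (sym h)))
        (trans (cong (λ t → (c₀ + M * e) + t) (ℤₚ.*-zeroʳ (- c₀))) (ℤₚ.+-identityʳ (c₀ + M * e)))))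
      where
      e : ℤ
      e = proj₁ (difference z z≢0)

    g₀-hom : ∀ c z → c ≢ o → g₀ (c ·ᵥ z) ≡ g₀ z
    g₀-hom c z c≢o = ℤₚ.*-cancelˡ-≡ M (g₀ (c ·ᵥ z)) (g₀ z) (trans (p c₀ (M * g₀ (c ·ᵥ z)) (δ 0ᵥ z))
        (trans (cong (λ t → t - c₀ + c₀ * δ 0ᵥ z) (trans (trans (cong (λ t → (c₀ + M * g₀ (c ·ᵥ z)) + (- c₀) * t) (sym (δ-· c z c≢o)))
          (sym (f-g₀ (c ·ᵥ z)))) (trans (hom-f c z c≢o) (f-g₀ z))))
        (sym (p c₀ (M * g₀ z) (δ 0ᵥ z)))))
      where
      p : ∀ c y t → y ≡ ((c + y) + (- c) * t) - c + c * t
      p = solve-∀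

    σ : Vecs m → Vecs m → ℤ
    σ x y = g₀ y + Σ₄ λ c → g₀ (x +ᵥ (c ·ᵥ y))

    g₀-line : ∀ x y → Sp (x ∷ y ∷ []) g₀ ≡ + 3 * σ x y
    g₀-line x y = trans (line-sum g₀-0 g₀-hom x y) (ℤₚ.+-identityˡ (+ 3 * σ x y))

    -- The values of `f` at the five points of the line sum to 5 c₀ + M σ on the one hand and to 4 M
    -- k on the other.
    balance : ∀ {x y} (ind : Indep (x ∷ y ∷ [])) k → Sp (x ∷ y ∷ []) f ≡ + 12 * (M * k) → M * (+ 4 * k - σ x y) ≡ + 5 * c₀
    balance {x} {y} ind k e = ℤₚ.*-cancelˡ-≡ (+ 3) (M * (+ 4 * k - σ x y)) (+ 5 * c₀)
      (trans (p M k (σ x y)) (trans (cong (λ t → t - M * (+ 3 * σ x y)) (trans (sym e)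
        (trans (Sp-cong (x ∷ y ∷ []) f-g₀) (trans (Sp-+ (x ∷ y ∷ []) (λ z → c₀ + M * g₀ z) (λ z → (- c₀) * δ 0ᵥ z))
          (cong₂ _+_ (trans (Sp-+ (x ∷ y ∷ []) (λ _ → c₀) (λ z → M * g₀ z)) (cong₂ _+_ (Sp-const (x ∷ y ∷ []) c₀)
              (trans (Sp-* (x ∷ y ∷ []) M g₀) (cong (λ t → M * t) (g₀-line x y)))))
            (trans (Sp-* (x ∷ y ∷ []) (- c₀) (δ 0ᵥ)) (cong (λ t → (- c₀) * t) (Sp-δ ind))))))))
        (p' M c₀ (+ 3 * σ x y))))
      where
      p : ∀ M k s → + 3 * (M * (+ 4 * k - s)) ≡ + 12 * (M * k) - M * (+ 3 * s)
      p = solve-∀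
      p' : ∀ M c s → ((+ 16 * c + M * s) + (- c) * 1ℤ) - M * s ≡ + 3 * (+ 5 * c)
      p' = solve-∀

    reference : ∃[ x ] Indep (x ∷ u₀ ∷ [])
    reference = Indep-extend (Indep-single (proj₂ base)) (ℕₚ.≤-trans (ℕₚ.m≤m+n 2 3) 5≤m)

    -- By `balance` this is -5 c₀ / M; reading it off a reference line makes it an integer without a
    -- division.
    s : ℤ
    s = σ (proj₁ reference) u₀ - + 4 * proj₁ (line-f (proj₂ reference))

    σ-value : ∀ {x y} (ind : Indep (x ∷ y ∷ [])) k → Sp (x ∷ y ∷ []) f ≡ + 12 * (M * k) → σ x y ≡ s + + 4 * k
    σ-value {x} {y} ind k e = rearrange (+ 4 * k) (σ x y) (+ 4 * k₀) (σ (proj₁ reference) u₀)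
        (ℤₚ.*-cancelˡ-≡ M (+ 4 * k - σ x y) (+ 4 * k₀ - σ (proj₁ reference) u₀)
          (trans (balance ind k e) (sym (balance (proj₂ reference) k₀ (proj₂ (line-f (proj₂ reference)))))))
      where
      k₀ : ℤ
      k₀ = proj₁ (line-f (proj₂ reference))
      rearrange : ∀ a b a' b' → a - b ≡ a' - b' → b ≡ (b' - a') + a
      rearrange a b a' b' e = trans (p a b) (trans (cong (λ t → a - t) e) (p' a a' b'))
        where
        p : ∀ a b → b ≡ a - (a - b)
        p = solve-∀
        p' : ∀ a a' b' → a - (a' - b') ≡ (b' - a') + a
        p' = solve-∀

    g : Vecs m → ℤ
    g z = g₀ z + s * δ 0ᵥ z

    g-line : ∀ {x y} (ind : Indep (x ∷ y ∷ [])) k → Sp (x ∷ y ∷ []) f ≡ + 12 * (M * k) → Sp (x ∷ y ∷ []) g ≡ + 4 * s + + 12 * k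
    g-line {x} {y} ind k e = trans (Sp-+ (x ∷ y ∷ []) g₀ (λ z → s * δ 0ᵥ z))
      (trans (cong₂ _+_ (trans (g₀-line x y) (cong (λ t → + 3 * t) (σ-value ind k e)))
        (trans (Sp-* (x ∷ y ∷ []) s (δ 0ᵥ)) (cong (λ t → s * t) (Sp-δ ind)))) (p s k))
      where
      p : ∀ s k → + 3 * (s + + 4 * k) + s * 1ℤ ≡ + 4 * s + + 12 * k
      p = solve-∀

    f-line' : ∀ u v r → Sp (u ∷ v ∷ []) f ≡ + 12 * (M * + χ L ((u , v) , r))
    f-line' u v r = trans (f-line u v r) (p M (+ χ L ((u , v) , r)))
      where
      p : ∀ M k → + 3 * (+ 4 * M * k) ≡ + 12 * (M * k)
      p = solve-∀

    g-CL : CL g s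
    g-CL = record
      { hom = λ c z c≢o → cong₂ (λ a b → a + s * b) (g₀-hom c z c≢o) (δ-· c z c≢o)
      ; at-0 = trans (cong₂ (λ a b → a + s * b) g₀-0 (δ-self (0ᵥ {m}))) (trans (ℤₚ.+-identityˡ (s * 1ℤ)) (ℤₚ.*-identityʳ s))
      ; on-line = λ x y ind →
          let u , v , r , same = rref x y ind
          in two-values x y (χ L ((u , v) , r)) (χ-bit ((u , v) , r)) (g-line ind (+ χ L ((u , v) , r)) (trans (same f) (f-line' u v r)))
      }
      where
      two-values : ∀ x y k → k ≡ 0 ⊎ k ≡ 1 → Sp (x ∷ y ∷ []) g ≡ + 4 * s + + 12 * + k →
                   Sp (x ∷ y ∷ []) g ≡ + 4 * s ⊎ Sp (x ∷ y ∷ []) g ≡ + 4 * s + + 12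
      two-values x y k (inj₁ refl) e = inj₁ (trans e (ℤₚ.+-identityʳ (+ 4 * s)))
      two-values x y k (inj₂ refl) e = inj₂ e

    g-link : Link g s L
    g-link u v r = trans (cong (differs s) (g-line (line-indep r) (+ χ L ((u , v) , r)) (f-line' u v r)))
      (differs-value s (χ L ((u , v) , r)) (χ-bit ((u , v) , r)))

  example : IsExample n L ⊎ IsExample n (complement L)
  example = classify-any {L = L} g-CL 4≤n g-link

theorem3 : (n : ℕ) → 4 ≤ n → (L : LineSet n) → IsCameronLiebler n L →
    ∃[ S ] (IsExample n S × ((L ≐ S) ⊎ (L ≐ complement S)))
theorem3 n 4≤n L (x , hyp) = conclude example
  where
  open Lines L x hyp
  d : ℕ
  d = proj₁ (geomPart-multiple n 4≤n)
  open Rescale 4≤n L d excess excess-· excess-0 (λ u v r → trans (excess-line u v r)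
    (cong (λ t → + 3 * (t * + χ L ((u , v) , r))) (proj₂ (geomPart-multiple n 4≤n))))
  not-not : ∀ b → b ≡ not (not b)
  not-not true = refl
  not-not false = refl
  conclude : IsExample n L ⊎ IsExample n (complement L) → ∃[ S ] (IsExample n S × ((L ≐ S) ⊎ (L ≐ complement S)))
  conclude (inj₁ e) = L , e , inj₁ λ l → refl
  conclude (inj₂ e) = complement L , e , inj₂ λ l → not-not (L l)
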